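{- For $n>2$, the number of maximal chains in $\mathrm{Weak}(\mathcal{U}_n)$ is equal to twice the number of standard Young tableaux of shifted staircase shape $\Delta_n$, hence equal to $$2\binom{n}{2}!\cdot\prod_{i=0}^{n-2}\frac{i!}{(2i+1)!}.$$
   Context: A permutation $\pi\in\mathcal{S}_n$ is unimodal if either every prefix set $\{\pi(1),\dots,\pi(j)\}$, $1\le j\le n$, or every suffix set $\{\pi(j),\dots,\pi(n)\}$, $1\le j\le n$, is an interval $\{a,a+1,\dots,b\}$ in $\mathbb{Z}$. $\mathcal{U}_n$ is the set of unimodal permutations in $\mathcal{S}_n$. The (right) weak order $\mathrm{Weak}(\mathcal{S}_n)$ is defined by $\pi\le\tau$ iff $\ell(\pi)+\ell(\pi^{ -1}\tau)=\ell(\tau)$, where $\ell$ is the length (number of inversions) with respect to the adjacent transpositions and products are compositions $(\pi\tau)(x)=\pi(\tau(x))$. $\mathrm{Weak}(\mathcal{U}_n)$ is the subposet of $\mathrm{Weak}(\mathcal{S}_n)$ induced by $\mathcal{U}_n$. The shifted staircase shape $\Delta_n$ is the set of boxes $(i,j)$, $1\le i<j\le n$ (row $i$, column $j$); a standard Young tableau of this shape is a filling with $1,\dots,\binom n2$, each used once, with entries increasing along each row (left to right) and each column (top to bottom). -}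

module Defs where

open import Data.Bool.Base using (Bool; T)
open import Data.Fin.Base using (Fin; _<_; _≤_)
open import Data.Fin.Permutation using (Permutation′; _⟨$⟩ʳ_; _∘ₚ_; flip) renaming (_≈_ to _≈ₚ_)
open import Data.Fin.Properties using (_<?_)
open import Data.Integer.Base using (+_)
open import Data.List.Base using (allFin; cartesianProduct; filter; foldr; length; map; upTo)
open import Data.Nat.Base as ℕ using (ℕ; _!)
open import Data.Nat.Combinatorics using (_C_)
open import Data.Nat.Properties using (_!≢0)
open import Data.Product.Base using (_×_; _,_; ∃; ∃₂)
open import Data.Rational.Base as ℚ using (ℚ; 1ℚ)
open import Data.Sum.Base using (_⊎_)
open import Function.Bundles using (_⤖_; Bijection; Inverse)
open import Level using (0ℓ)
open import Relation.Binary.Bundles using (Setoid)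
open import Relation.Binary.Core using (Rel)
import Relation.Binary.Construct.On as On
open import Relation.Binary.PropositionalEquality using (_≡_; setoid; _→-setoid_)
open import Relation.Nullary.Decidable using (Dec; _×-dec_)
open import Relation.Unary using (Pred; _≐_)

-- Throughout, Fin n stands for {1,…,n}: the element with toℕ equal to k
-- stands for k + 1.

------------------------------------------------------------------------
-- Cardinality

HasSize : Setoid 0ℓ 0ℓ → ℕ → Set
HasSize S k = Inverse S (setoid (Fin k))

------------------------------------------------------------------------
-- Maximal chains

-- Subsets are Bool-valued, hence decidable; they are only used for a finite
-- carrier with decidable equality, where classically every subset is of this
-- form.

module Chains {A : Set} (_≈_ _⊑_ : Rel A 0ℓ) where

  record Subset : Set where
    field
      member : A → Bool
      resp   : ∀ {x y} → x ≈ y → member x ≡ member y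

  open Subset public

  infix 4 _∈_ _⊆_

  _∈_ : A → Subset → Set
  x ∈ X = T (member X x)

  _⊆_ : Subset → Subset → Set
  X ⊆ Y = ∀ x → x ∈ X → x ∈ Y

  IsChain : Subset → Set
  IsChain X = ∀ x y → x ∈ X → y ∈ X → x ⊑ y ⊎ y ⊑ x

  record MaximalChain : Set where
    field
      subset  : Subset
      isChain : IsChain subset
      maximal : ∀ Y → IsChain Y → subset ⊆ Y → Y ⊆ subset

  maximalChains : Setoid 0ℓ 0ℓ
  maximalChains = On.setoid (A →-setoid Bool) (λ X → member (MaximalChain.subset X))

------------------------------------------------------------------------
-- Unimodal permutations

-- The empty set also satisfies this (take b < a).  Prefix and suffix sets are
-- non-empty, so for them this means being some {a,…,b} with a ≤ b.
IsInterval : ∀ {n} → Pred (Fin n) 0ℓ → Set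
IsInterval {n} P = ∃₂ λ (a b : Fin n) → P ≐ (λ v → a ≤ v × v ≤ b)

PrefixSet SuffixSet : ∀ {n} → Permutation′ n → Fin n → Pred (Fin n) 0ℓ
PrefixSet π j v = ∃ λ i → i ≤ j × π ⟨$⟩ʳ i ≡ v
SuffixSet π j v = ∃ λ i → j ≤ i × π ⟨$⟩ʳ i ≡ v

Unimodal : ∀ {n} → Permutation′ n → Set
Unimodal π = (∀ j → IsInterval (PrefixSet π j)) ⊎ (∀ j → IsInterval (SuffixSet π j))

record 𝒰 (n : ℕ) : Set where
  field
    perm     : Permutation′ n
    unimodal : Unimodal perm

open 𝒰 public

------------------------------------------------------------------------
-- Weak order

Inversion : ∀ {n} → Permutation′ n → Fin n × Fin n → Set
Inversion π (i , j) = i < j × π ⟨$⟩ʳ j < π ⟨$⟩ʳ i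

inversion? : ∀ {n} (π : Permutation′ n) p → Dec (Inversion π p)
inversion? π (i , j) = (i <? j) ×-dec (π ⟨$⟩ʳ j <? π ⟨$⟩ʳ i)

ℓ : ∀ {n} → Permutation′ n → ℕ
ℓ {n} π = length (filter (inversion? π) (cartesianProduct (allFin n) (allFin n)))

-- _∘ₚ_ composes in diagrammatic order, so τ ∘ₚ flip π is x ↦ π⁻¹(τ(x)).
_≤ᵂ_ : ∀ {n} → Rel (Permutation′ n) 0ℓ
π ≤ᵂ τ = ℓ π ℕ.+ ℓ (τ ∘ₚ flip π) ≡ ℓ τ

-- Elements of 𝒰 n are compared as permutations, ignoring the proof of
-- unimodality.
_≈ᵁ_ _≤ᵁ_ : ∀ {n} → Rel (𝒰 n) 0ℓ
u ≈ᵁ v = perm u ≈ₚ perm v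
u ≤ᵁ v = perm u ≤ᵂ perm v

maximalChainsWeakU : ℕ → Setoid 0ℓ 0ℓ
maximalChainsWeakU n = Chains.maximalChains {𝒰 n} _≈ᵁ_ _≤ᵁ_

------------------------------------------------------------------------
-- Standard Young tableaux of shifted staircase shape

record Box (n : ℕ) : Set where
  constructor box
  field
    row col  : Fin n
    .row<col : row < col

record SYT (n : ℕ) : Set where
  field
    filling : Box n ⤖ Fin (n C 2)

  entry : Box n → Fin (n C 2)
  entry = Bijection.to filling

  field
    row-increasing : ∀ {i j k} .(i<j : i < j) .(i<k : i < k) →
                     j < k → entry (box i j i<j) < entry (box i k i<k)
    col-increasing : ∀ {i j k} .(i<k : i < k) .(j<k : j < k) →
                     i < j → entry (box i k i<k) < entry (box j k j<k)

standardYoungTableaux : ℕ → Setoid 0ℓ 0ℓ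
standardYoungTableaux n = On.setoid (Box n →-setoid Fin (n C 2)) SYT.entry

------------------------------------------------------------------------
-- The product formula

fromℕ : ℕ → ℚ
fromℕ k = + k ℚ./ 1

-- ∏[i< m ] f is f 0 * f 1 * ⋯ * f (m - 1).
∏[i<_] : ℕ → (ℕ → ℚ) → ℚ
∏[i< m ] f = foldr ℚ._*_ 1ℚ (map f (upTo m))

factor : ℕ → ℚ
factor i = ((+ (i !)) ℚ./ ((2 ℕ.* i ℕ.+ 1) !)) {{(2 ℕ.* i ℕ.+ 1) !≢0}}

{-# OPTIONS --safe #-}
module Submission where

-- Record a permutation by its inversions, as pairs of values a < b, i.e. boxes
-- of Δₙ.  Then π ≤ᵂ τ means inclusion, the prefix-unimodal permutations are
-- exactly those whose inversions form an order ideal of Δₙ, and the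
-- suffix-unimodal ones those whose inversions form a filter; conjugation by the
-- longest element exchanges the two.  An ideal and a filter are comparable only
-- if one of them is ∅ or Δₙ, so a maximal chain stays on one side, and on the
-- left it adds the boxes of Δₙ one at a time: it is a standard tableau.
--
-- Tableaux of a strict shape λ with N boxes are counted by removing the largest
-- entry.  That their number is N! ∏ 1/λᵢ! ∏_{i<j} (λᵢ - λⱼ)/(λᵢ + λⱼ) reduces,
-- with aᵢ = λᵢ(λᵢ - 1) and bᵢ = λᵢ(λᵢ + 1), to
--   Σᵢ ∏ⱼ (aᵢ - bⱼ) / ∏_{j≠i} (aᵢ - aⱼ) = Σᵢ (aᵢ - bᵢ),
-- the divided difference of a monic polynomial of degree n at n points.

-- The numbers `a` and `b` come from factoring. Lowering x to x - 1 multiplies (x - z)/(x + z) by (x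
-- + z)(x - z - 1) / ((x + z - 1)(x - z)), where the numerator is x(x - 1) - z(z + 1) and the
-- denominator is x(x - 1) - z(z - 1). Exchanging x and z gives the effect of lowering z, so one
-- quotient serves the rows above and below the one that is shortened. The numerator vanishes when x
-- - 1 = z, that is, when the row cannot be shortened; so the sum may run over all rows. The factor
-- with j = i is -2λᵢ and supplies the change of λᵢ!.
--
-- The two sides of the poset are told apart by the first box added: the least box (1,2) for ideals,
-- its mirror image (n - 1,n) for filters. These are different boxes because n > 2, whence the
-- factor 2.
--
-- A maximal chain is only a decidable subset of a type that is not enumerated. Its next member is
-- therefore sought among finitely many candidates, one for each side and each pair of values.

-- Sizes of setoids: transport along bijections and counting by fibres.

module Cardinality where

  open import Defs
  open import Data.Fin.Base as Fin using (Fin; zero; suc; splitAt; join)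
  open import Data.Fin.Properties using (splitAt-join; join-splitAt)
  open import Data.Nat.Base using (ℕ; zero; suc)
  open import Data.Product.Base using (_,_; proj₁; ∃)
  open import Data.Sum.Base using (inj₁; inj₂)
  open import Function.Base using (_∘_)
  open import Function.Bundles using (Inverse)
  import Function.Construct.Composition as Compose
  open import Level using (0ℓ)
  open import Relation.Binary.Bundles using (Setoid)
  import Relation.Binary.Construct.On as On
  open import Relation.Nullary.Negation using (¬_; contradiction)
  open import Relation.Binary.PropositionalEquality using (_≡_; refl; sym; trans; cong; setoid)
  open import Data.Nat.Properties using (+-0-commutativeMonoid)
  open import Algebra.Properties.CommutativeMonoid.Sum +-0-commutativeMonoid using (sum)

  module _ (S T : Setoid 0ℓ 0ℓ) where
    private
      module S = Setoid S
      module T = Setoid T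

    -- Injectivity of `to` turns the single round trip `to∘from` into both the congruence of `from`
    -- and the other round trip, so later bijections owe only one composite.
    mkInverse : (to : S.Carrier → T.Carrier) → (∀ {x y} → x S.≈ y → to x T.≈ to y) →
                (∀ {x y} → to x T.≈ to y → x S.≈ y) →
                (from : T.Carrier → S.Carrier) → (∀ y → to (from y) T.≈ y) → Inverse S T
    mkInverse to to-cong to-inj from to∘from = record
      { to        = to
      ; from      = from
      ; to-cong   = to-cong
      ; from-cong = λ {y} {z} y≈z → to-inj (T.trans (to∘from y) (T.trans y≈z (T.sym (to∘from z))))
      ; inverse   = (λ {y} {x} x≈fy → T.trans (to-cong x≈fy) (to∘from y))
                  , (λ {x} {y} y≈tx → to-inj (T.trans (to∘from y) y≈tx))
      }

  HasSize-resp : ∀ {S T k} → Inverse S T → HasSize T k → HasSize S k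
  HasSize-resp = Compose.inverse

  empty-size : ∀ S → ¬ Setoid.Carrier S → HasSize S 0
  empty-size S empty = mkInverse S (setoid (Fin 0)) (λ x → contradiction x empty)
    (λ {x} _ → contradiction x empty) (λ {x} _ → contradiction x empty) (λ ()) (λ ())

  Fibre : (S : Setoid 0ℓ 0ℓ) {l : ℕ} → (Setoid.Carrier S → Fin l) → Fin l → Setoid 0ℓ 0ℓ
  Fibre S idx i = On.setoid {B = ∃ λ x → idx x ≡ i} S proj₁

  private
    locate : ∀ {l} (c : Fin l → ℕ) → Fin (sum c) → ∃ λ i → Fin (c i)
    locate {suc l} c k with splitAt (c zero) k
    ... | inj₁ a = zero , a
    ... | inj₂ b = let i , a = locate (c ∘ suc) b in suc i , a

    place : ∀ {l} (c : Fin l → ℕ) → (∃ λ i → Fin (c i)) → Fin (sum c)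
    place {suc l} c (zero  , a) = join (c zero) _ (inj₁ a)
    place {suc l} c (suc i , a) = join (c zero) _ (inj₂ (place (c ∘ suc) (i , a)))

    locate-place : ∀ {l} (c : Fin l → ℕ) p → locate c (place c p) ≡ p
    locate-place {suc l} c (zero , a)
      rewrite splitAt-join (c zero) (sum (c ∘ suc)) (inj₁ a) = refl
    locate-place {suc l} c (suc i , a)
      rewrite splitAt-join (c zero) (sum (c ∘ suc)) (inj₂ (place (c ∘ suc) (i , a)))
            | locate-place (c ∘ suc) (i , a) = refl

    place-locate : ∀ {l} (c : Fin l → ℕ) k → place c (locate c k) ≡ k
    place-locate {suc l} c k with splitAt (c zero) k | join-splitAt (c zero) _ k
    ... | inj₁ a | eq = eq
    ... | inj₂ b | eq = trans (cong (join (c zero) _ ∘ inj₂) (place-locate (c ∘ suc) b)) eq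

  -- An element is determined by its index and its code within the fibre; such pairs are numbered by
  -- laying the blocks `Fin (c i)` end to end.
  fibres-size : ∀ (S : Setoid 0ℓ 0ℓ) {l} (idx : Setoid.Carrier S → Fin l) →
                (∀ {x y} → Setoid._≈_ S x y → idx x ≡ idx y) →
                (c : Fin l → ℕ) → (∀ i → HasSize (Fibre S idx i) (c i)) → HasSize S (sum c)
  fibres-size S {l} idx idx-cong c sizes = mkInverse S (setoid (Fin (sum c))) to to-cong to-inj from to∘from
    where
    module S = Setoid S
    module I i = Inverse (sizes i)

    code : S.Carrier → ∃ λ i → Fin (c i)
    code x = idx x , I.to (idx x) (x , refl)

    -- `idx x` and `idx y` are only propositionally equal, so the indices and the membership proofs
    -- are generalised before the equation between them is matched.
    code-cong′ : ∀ {x y i j} (p : idx x ≡ i) (q : idx y ≡ j) → i ≡ j → x S.≈ y →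
                 _≡_ {A = ∃ λ i → Fin (c i)} (i , I.to i (x , p)) (j , I.to j (y , q))
    code-cong′ {i = i} p q refl x≈y = cong (i ,_) (I.to-cong i x≈y)

    decode : (∃ λ i → Fin (c i)) → S.Carrier
    decode (i , a) = proj₁ (I.from i a)

    decode-code : ∀ x → decode (code x) S.≈ x
    decode-code x = I.inverseʳ (idx x) refl

    to : S.Carrier → Fin (sum c)
    to = place c ∘ code

    to-cong : ∀ {x y} → x S.≈ y → to x ≡ to y
    to-cong x≈y = cong (place c) (code-cong′ refl refl (idx-cong x≈y) x≈y)

    to-inj : ∀ {x y} → to x ≡ to y → x S.≈ y
    to-inj {x} {y} eq = S.trans (S.sym (decode-code x)) (S.trans (S.reflexive (cong decode code≡)) (decode-code y))
      where
      code≡ : code x ≡ code y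
      code≡ = trans (sym (locate-place c _)) (trans (cong (locate c) eq) (locate-place c _))

    from : Fin (sum c) → S.Carrier
    from = decode ∘ locate c

    to∘from : ∀ k → to (from k) ≡ k
    to∘from k = let i , a = locate c k
                    x , p = I.from i a
                in trans (cong (place c) (trans (code-cong′ refl p p S.refl) (cong (i ,_) (I.inverseˡ i {a} {x , p} (S.refl {x})))))
                         (place-locate c k)

-- Maximal chains of a bounded graded poset as paths with one element per rank.

module GradedPosets where

  open import Defs
  open import Data.Bool.Base using (T; _∨_)
  open import Data.Bool.Properties using (T-∨; T?)
  open import Relation.Unary using (Pred)
  import Relation.Unary as U
  open import Data.Nat.Base using (ℕ; zero; suc; _≤_; _<_; z≤n; s≤s⁻¹)
  open import Data.Nat.Properties
  open import Data.Product.Base using (_×_; _,_; proj₁; proj₂; ∃)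
  open import Data.Sum.Base using (_⊎_; inj₁; inj₂; swap)
  open import Function.Bundles using (Equivalence; _⇔_; mk⇔)
  open import Level using (0ℓ)
  open import Relation.Binary.Bundles using (Setoid)
  open import Relation.Binary.Core using (Rel)
  open import Relation.Binary.Definitions using (Decidable)
  open import Relation.Binary.Structures using (IsEquivalence)
  open import Relation.Binary.PropositionalEquality using (_≡_; refl; sym; trans; cong; cong₂; subst)
  open import Relation.Nullary.Decidable using (Dec; yes; no; ⌊_⌋; toWitness; fromWitness; decidable-stable; does-⇔; _×-dec_; isYes≗does)
  open import Relation.Nullary.Negation using (¬_; contradiction)
  open Cardinality

  ⌊⌋-⇔ : ∀ {P Q : Set} → P ⇔ Q → (P? : Dec P) (Q? : Dec Q) → ⌊ P? ⌋ ≡ ⌊ Q? ⌋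
  ⌊⌋-⇔ P⇔Q P? Q? = trans (isYes≗does P?) (trans (does-⇔ P⇔Q P? Q?) (sym (isYes≗does Q?)))

  -- `cover x` offers finitely many candidates for an element just above `x`; some may be useless,
  -- but `interpolate` promises a good one between any two comparable elements of different rank.
  -- This makes the search for the next member of a chain decidable.
  module GradedPoset
    {A : Set} (_≈_ _⊑_ : Rel A 0ℓ)
    (≈-isEquivalence : IsEquivalence _≈_) (_≈?_ : Decidable _≈_)
    (reflexive : ∀ x y → x ≈ y → x ⊑ y)
    (transitive : ∀ x y z → x ⊑ y → y ⊑ z → x ⊑ z)
    (rank : A → ℕ)
    (monotone : ∀ x y → x ⊑ y → rank x ≤ rank y)
    (determined : ∀ x y → x ⊑ y → rank x ≡ rank y → x ≈ y)
    (bot top : A) (bot-min : ∀ x → bot ⊑ x) (top-max : ∀ x → x ⊑ top)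
    (rank-bot : rank bot ≡ 0)
    {I : Set} (any-I? : ∀ {P : Pred I 0ℓ} → U.Decidable P → Dec (∃ P)) (cover : A → I → A)
    (interpolate : ∀ x y → x ⊑ y → rank x < rank y →
                   ∃ λ i → x ⊑ cover x i × cover x i ⊑ y × rank (cover x i) ≡ suc (rank x))
    where

    open IsEquivalence ≈-isEquivalence using () renaming (refl to ≈-refl; sym to ≈-sym; trans to ≈-trans)
    open Chains _≈_ _⊑_
    open MaximalChain

    private
      ⊑-reflexive : ∀ {x y} → x ≈ y → x ⊑ y
      ⊑-reflexive = reflexive _ _

      ⊑-trans : ∀ {x y z} → x ⊑ y → y ⊑ z → x ⊑ z
      ⊑-trans = transitive _ _ _

      rank-mono : ∀ {x y} → x ⊑ y → rank x ≤ rank y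
      rank-mono = monotone _ _

      rank-≈ : ∀ {x y} → x ⊑ y → rank x ≡ rank y → x ≈ y
      rank-≈ = determined _ _

    height : ℕ
    height = rank top

    -- A saturated chain from bottom to top. The values of `at` beyond `height` are arbitrary, and
    -- the equality of `gradedPaths` ignores them.
    record GradedPath : Set where
      field
        at      : ℕ → A
        rank-at : ∀ {k} → k ≤ height → rank (at k) ≡ k
        step    : ∀ {k} → k < height → at k ⊑ at (suc k)

      at-mono : ∀ {j k} → j ≤ k → k ≤ height → at j ⊑ at k
      at-mono {k = zero} z≤n _ = ⊑-reflexive ≈-refl
      at-mono {k = suc k} j≤1+k k<h with m≤n⇒m<n∨m≡n j≤1+k
      ... | inj₁ j<1+k = ⊑-trans (at-mono (s≤s⁻¹ j<1+k) (<⇒≤ k<h)) (step k<h)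
      ... | inj₂ refl = ⊑-reflexive ≈-refl

    open GradedPath public

    gradedPaths : Setoid 0ℓ 0ℓ
    gradedPaths = record
      { Carrier = GradedPath
      ; _≈_ = λ p q → ∀ {k} → k ≤ height → at p k ≈ at q k
      ; isEquivalence = record
        { refl  = λ _ → ≈-refl
        ; sym   = λ e k≤h → ≈-sym (e k≤h)
        ; trans = λ e f k≤h → ≈-trans (e k≤h) (f k≤h)
        }
      }

    rank-resp : ∀ {x y} → x ≈ y → rank x ≡ rank y
    rank-resp x≈y = ≤-antisym (rank-mono (⊑-reflexive x≈y)) (rank-mono (⊑-reflexive (≈-sym x≈y)))

    rank≤height : ∀ x → rank x ≤ height
    rank≤height x = rank-mono (top-max x)

    ∈-resp : ∀ X {x y} → x ≈ y → x ∈ X → y ∈ X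
    ∈-resp X x≈y = subst T (resp X x≈y)

    private
      comparable-rank : ∀ {x y} → x ⊑ y ⊎ y ⊑ x → rank x ≤ rank y → x ⊑ y
      comparable-rank (inj₁ x⊑y) _ = x⊑y
      comparable-rank (inj₂ y⊑x) x≤y = ⊑-reflexive (≈-sym (rank-≈ y⊑x (≤-antisym (rank-mono y⊑x) x≤y)))

    chain-≈ : ∀ X → IsChain X → ∀ {x y} → x ∈ X → y ∈ X → rank x ≡ rank y → x ≈ y
    chain-≈ X chain x∈X y∈X eq = rank-≈ (comparable-rank (chain _ _ x∈X y∈X) (≤-reflexive eq)) eq

    -- An element is compared with the only member of the path that it could be, the one of its own
    -- rank; this keeps membership decidable.
    pathSubset : GradedPath → Subset
    pathSubset p .member x = ⌊ x ≈? at p (rank x) ⌋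
    pathSubset p .resp {x} {y} x≈y = ⌊⌋-⇔ (mk⇔ f g) (x ≈? at p (rank x)) (y ≈? at p (rank y))
      where
      r = rank-resp x≈y
      f : x ≈ at p (rank x) → y ≈ at p (rank y)
      f e = subst (λ k → y ≈ at p k) r (≈-trans (≈-sym x≈y) e)
      g : y ≈ at p (rank y) → x ≈ at p (rank x)
      g e = subst (λ k → x ≈ at p k) (sym r) (≈-trans x≈y e)

    at∈path : ∀ p {k} → k ≤ height → at p k ∈ pathSubset p
    at∈path p {k} k≤h = fromWitness (subst (λ j → at p k ≈ at p j) (sym (rank-at p k≤h)) ≈-refl)

    pathChain : GradedPath → MaximalChain
    pathChain p .subset = pathSubset p
    pathChain p .isChain x y x∈ y∈ with ≤-total (rank x) (rank y)
    ... | inj₁ x≤y = inj₁ (⊑-trans (⊑-reflexive (toWitness x∈)) (⊑-trans (at-mono p x≤y (rank≤height y)) (⊑-reflexive (≈-sym (toWitness y∈)))))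
    ... | inj₂ y≤x = inj₂ (⊑-trans (⊑-reflexive (toWitness y∈)) (⊑-trans (at-mono p y≤x (rank≤height x)) (⊑-reflexive (≈-sym (toWitness x∈)))))
    -- `Y` contains the path's element of rank `rank y`, and a chain has at most one element of each
    -- rank.
    pathChain p .maximal Y chainY X⊆Y y y∈Y =
      fromWitness (chain-≈ Y chainY y∈Y (X⊆Y _ (at∈path p (rank≤height y))) (sym (rank-at p (rank≤height y))))

    pathChain-injective : ∀ {p q} → (∀ x → member (pathSubset p) x ≡ member (pathSubset q) x) →
                          ∀ {k} → k ≤ height → at p k ≈ at q k
    pathChain-injective {p} {q} eq {k} k≤h =
      subst (λ j → at p k ≈ at q j) (rank-at p k≤h) (toWitness (subst T (eq (at p k)) (at∈path p k≤h)))

    module _ (M : MaximalChain) where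
      private
        X = subset M

      insert : A → Subset
      insert z .member x = member X x ∨ ⌊ x ≈? z ⌋
      insert z .resp {x} {y} x≈y = cong₂ _∨_ (resp X x≈y)
        (⌊⌋-⇔ (mk⇔ (≈-trans (≈-sym x≈y)) (≈-trans x≈y)) (x ≈? z) (y ≈? z))

      -- Maximality, applied to the chain with `z` inserted.
      comparable⇒∈ : ∀ z → (∀ w → w ∈ X → w ⊑ z ⊎ z ⊑ w) → z ∈ X
      comparable⇒∈ z cmp = maximal M (insert z) chain (λ x x∈X → Equivalence.from (T-∨ {y = ⌊ x ≈? z ⌋}) (inj₁ x∈X)) z
                             (Equivalence.from (T-∨ {x = member X z}) (inj₂ (fromWitness ≈-refl)))
        where
        split : ∀ {x} → x ∈ insert z → x ∈ X ⊎ x ≈ z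
        split {x} x∈ with Equivalence.to (T-∨ {x = member X x}) x∈
        ... | inj₁ x∈X = inj₁ x∈X
        ... | inj₂ x≈z = inj₂ (toWitness x≈z)
        viaz : ∀ {x w} → x ≈ z → w ⊑ z ⊎ z ⊑ w → w ⊑ x ⊎ x ⊑ w
        viaz x≈z (inj₁ w⊑z) = inj₁ (⊑-trans w⊑z (⊑-reflexive (≈-sym x≈z)))
        viaz x≈z (inj₂ z⊑w) = inj₂ (⊑-trans (⊑-reflexive x≈z) z⊑w)
        chain : IsChain (insert z)
        chain x y x∈ y∈ with split x∈ | split y∈
        ... | inj₁ x∈X | inj₁ y∈X = isChain M x y x∈X y∈X
        ... | inj₁ x∈X | inj₂ y≈z = viaz y≈z (cmp x x∈X)
        ... | inj₂ x≈z | inj₁ y∈X = swap (viaz x≈z (cmp y y∈X))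
        ... | inj₂ x≈z | inj₂ y≈z = inj₁ (⊑-reflexive (≈-trans x≈z (≈-sym y≈z)))

      Next : A → Set
      Next x = ∃ λ i → cover x i ∈ X × rank (cover x i) ≡ suc (rank x)

      next? : ∀ x → Dec (Next x)
      next? x = any-I? (λ i → T? _ ×-dec (_ ≟ _))

      -- If no candidate lies in X, then by induction on k no element of X has
      -- rank in (rank x, k]: the first one y would let us interpolate a candidate
      -- comparable with all of X.
      no-gap : ∀ {x} → x ∈ X → ¬ Next x → ∀ k {y} → y ∈ X → rank y ≤ k → rank y ≤ rank x
      no-gap x∈X ¬next zero y∈X y≤0 = ≤-trans y≤0 z≤n
      no-gap {x} x∈X ¬next (suc k) {y} y∈X y≤1+k with m≤n⇒m<n∨m≡n y≤1+k | rank y ≤? rank x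
      ... | inj₁ y<1+k | _ = no-gap x∈X ¬next k y∈X (s≤s⁻¹ y<1+k)
      ... | inj₂ _ | yes y≤x = y≤x
      ... | inj₂ y≡1+k | no y≰x = contradiction (i , z∈X , rank-z) ¬next
        where
        x<y = ≰⇒> y≰x
        found = interpolate x y (comparable-rank (isChain M x y x∈X y∈X) (<⇒≤ x<y)) x<y
        i = proj₁ found
        z = cover x i
        x⊑z = proj₁ (proj₂ found)
        z⊑y = proj₁ (proj₂ (proj₂ found))
        rank-z = proj₂ (proj₂ (proj₂ found))
        z∈X : z ∈ X
        z∈X = comparable⇒∈ z λ w w∈X → cmp w w∈X (rank w ≤? k)
          where
          cmp : ∀ w → w ∈ X → Dec (rank w ≤ k) → w ⊑ z ⊎ z ⊑ w
          cmp w w∈X (yes w≤k) = inj₁ (⊑-trans (comparable-rank (isChain M w x w∈X x∈X) (no-gap x∈X ¬next k w∈X w≤k)) x⊑z)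
          cmp w w∈X (no w≰k)  = inj₂ (⊑-trans z⊑y (comparable-rank (isChain M y w y∈X w∈X) (≤-trans (≤-reflexive y≡1+k) (≰⇒> w≰k))))

      bot∈ : bot ∈ X
      bot∈ = comparable⇒∈ bot (λ w _ → inj₂ (bot-min w))

      top∈ : top ∈ X
      top∈ = comparable⇒∈ top (λ w _ → inj₁ (top-max w))

      -- As `Next x` is decidable, it suffices to refute its negation: without a successor, `no-gap`
      -- would bound the rank of `top`, which lies in `X`, by the rank of `x`.
      next : ∀ {x} → x ∈ X → rank x < height → Next x
      next {x} x∈X x<h = decidable-stable (next? x) λ ¬next →
        contradiction (no-gap x∈X ¬next height top∈ ≤-refl) (<⇒≱ x<h)

      climb : ∀ k → ∃ λ x → x ∈ X × (k ≤ height → rank x ≡ k)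
      climb zero = bot , bot∈ , λ _ → rank-bot
      climb (suc k) = let x , x∈X , rank-x = climb k in go x x∈X rank-x (suc k ≤? height)
        where
        go : ∀ x → x ∈ X → (k ≤ height → rank x ≡ k) → Dec (k < height) →
             ∃ λ x → x ∈ X × (k < height → rank x ≡ suc k)
        -- Past the top the climb stands still; the claim about the rank is then vacuous.
        go x x∈X rank-x (no k≮h) = x , x∈X , λ k<h → contradiction k<h k≮h
        go x x∈X rank-x (yes k<h) =
          let eq = rank-x (<⇒≤ k<h)
              i , z∈X , rank-z = next x∈X (≤-trans (≤-reflexive (cong suc eq)) k<h)
          in cover x i , z∈X , λ _ → trans rank-z (cong suc eq)

      chainPath : GradedPath
      chainPath .at k = proj₁ (climb k)
      chainPath .rank-at {k} = proj₂ (proj₂ (climb k))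
      chainPath .step {k} k<h with climb k | climb (suc k)
      ... | x , x∈X , rx | y , y∈X , ry = comparable-rank (isChain M x y x∈X y∈X)
        (subst (_≤ rank y) (sym (rx (<⇒≤ k<h))) (subst (k ≤_) (sym (ry k<h)) (n≤1+n k)))

      path-chainPath : ∀ x → member (pathSubset chainPath) x ≡ member X x
      path-chainPath x = trans (isYes≗does (x ≈? proj₁ y)) (does-⇔ (mk⇔ f g) (x ≈? proj₁ y) (T? (member X x)))
        where
        y : ∃ λ y → y ∈ X × (rank x ≤ height → rank y ≡ rank x)
        y = climb (rank x)
        f : x ≈ proj₁ y → x ∈ X
        f e = ∈-resp X (≈-sym e) (proj₁ (proj₂ y))
        g : x ∈ X → x ≈ proj₁ y
        g x∈X = chain-≈ X (isChain M) x∈X (proj₁ (proj₂ y)) (sym (proj₂ (proj₂ y) (rank≤height x)))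

    maximalChains-size : ∀ {k} → HasSize gradedPaths k → HasSize maximalChains k
    maximalChains-size = HasSize-resp {S = maximalChains} {T = gradedPaths} (Symmetry.inverse (mkInverse gradedPaths maximalChains pathChain
      (λ {p} {q} e x → ⌊⌋-⇔ (mk⇔ (λ f → ≈-trans f (e (rank≤height x))) (λ f → ≈-trans f (≈-sym (e (rank≤height x)))))
                             (x ≈? at p (rank x)) (x ≈? at q (rank x)))
      (λ {p} {q} e → pathChain-injective {p} {q} e) chainPath path-chainPath))
      where import Function.Construct.Symmetry as Symmetry

-- Inversion sets indexed by values, and the weak order as their inclusion.

module Inversions where

  open import Defs
  open import Data.Bool.Base using (if_then_else_)
  open import Data.Fin.Base using (Fin; zero; suc; toℕ; _<_)
  open import Data.Fin.Permutation using (Permutation′; _⟨$⟩ʳ_; _⟨$⟩ˡ_; _∘ₚ_; flip; inverseˡ; inverseʳ) renaming (_≈_ to _≈ₚ_)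
  open import Data.Fin.Properties using (_<?_; _≟_; any?; <-cmp; <-asym; <-irrefl; toℕ-injective; suc-injective)
  open import Data.List.Base using (_++_; cartesianProduct; filter; length; map; tabulate)
  open import Data.List.Properties using (filter-++; length-++; map-tabulate)
  open import Data.Nat.Base as ℕ using (ℕ; zero; suc; _+_; z≤n; s≤s; _≤_)
  import Data.Nat.Properties as ℕ
  open import Data.Product.Base using (_×_; _,_; proj₁; proj₂; ∃₂)
  open import Data.Sum.Base using (_⊎_; inj₁; inj₂)
  open import Function.Base using (_∘_; id)
  open import Function.Bundles using (_⇔_; mk⇔)
  open import Relation.Binary.Core using (Rel)
  open import Relation.Binary.Definitions using (Decidable; tri<; tri≈; tri>)
  open import Relation.Binary.PropositionalEquality using (_≡_; _≢_; refl; sym; trans; cong; cong₂; subst₂; module ≡-Reasoning)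
  open import Relation.Nullary.Decidable using (Dec; yes; no; does; does-⇔; _×-dec_; _⊎-dec_; ¬?; dec-true; dec-false)
  open import Relation.Nullary.Negation using (¬_; contradiction)
  open import Relation.Unary using (Pred)
  import Relation.Unary as U
  open import Algebra.Properties.CommutativeMonoid.Sum ℕ.+-0-commutativeMonoid using (sum; sum-cong-≗; ∑-distrib-+; ∑-comm; sum-permute)
  open import Level using (0ℓ)

  ι : ∀ {P : Set} → Dec P → ℕ
  ι P? = if does P? then 1 else 0

  ι-yes : ∀ {P : Set} (P? : Dec P) → P → ι P? ≡ 1
  ι-yes P? p = cong (if_then 1 else 0) (dec-true P? p)

  ι-no : ∀ {P : Set} (P? : Dec P) → ¬ P → ι P? ≡ 0
  ι-no P? ¬p = cong (if_then 1 else 0) (dec-false P? ¬p)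

  ι-⇔ : ∀ {P Q : Set} → P ⇔ Q → (P? : Dec P) (Q? : Dec Q) → ι P? ≡ ι Q?
  ι-⇔ P⇔Q P? Q? = cong (if_then 1 else 0) (does-⇔ P⇔Q P? Q?)

  ι-mono : ∀ {P Q : Set} → (P → Q) → (P? : Dec P) (Q? : Dec Q) → ι P? ≤ ι Q?
  ι-mono f (no ¬p) Q? = z≤n
  ι-mono f (yes p) Q? = ℕ.≤-reflexive (sym (ι-yes Q? (f p)))

  ι-reflects : ∀ {P Q : Set} (P? : Dec P) (Q? : Dec Q) → ι P? ≡ ι Q? → Q → P
  ι-reflects (yes p) Q? eq q = p
  ι-reflects (no ¬p) Q? eq q = contradiction (trans eq (ι-yes Q? q)) λ ()

  sum-mono : ∀ {n} {f g : Fin n → ℕ} → (∀ i → f i ≤ g i) → sum f ≤ sum g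
  sum-mono {zero}  f≤g = z≤n
  sum-mono {suc n} f≤g = ℕ.+-mono-≤ (f≤g zero) (sum-mono (f≤g ∘ suc))

  -- Neither the head nor the tail can make up for a deficit of the other. This is what turns equal
  -- counts into equal relations, and equal lengths into inclusions.
  sum-mono-≡ : ∀ {n} {f g : Fin n → ℕ} → (∀ i → f i ≤ g i) → sum f ≡ sum g → ∀ i → f i ≡ g i
  sum-mono-≡ {suc n} {f} {g} f≤g eq = λ { zero → head≡ ; (suc i) → sum-mono-≡ (f≤g ∘ suc) tail≡ i }
    where
    head≡ : f zero ≡ g zero
    head≡ = ℕ.≤-antisym (f≤g zero) (ℕ.+-cancelʳ-≤ (sum (g ∘ suc)) _ _
              (ℕ.≤-trans (ℕ.≤-reflexive (sym eq)) (ℕ.+-monoʳ-≤ (f zero) (sum-mono (f≤g ∘ suc)))))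
    tail≡ : sum (f ∘ suc) ≡ sum (g ∘ suc)
    tail≡ = ℕ.+-cancelˡ-≡ (f zero) _ _ (trans eq (cong (_+ sum (g ∘ suc)) (sym head≡)))

  sum-zero : ∀ {n} {f : Fin n → ℕ} → (∀ i → f i ≡ 0) → sum f ≡ 0
  sum-zero {zero}  f≡0 = refl
  sum-zero {suc n} f≡0 = cong₂ _+_ (f≡0 zero) (sum-zero (f≡0 ∘ suc))

  sum-single : ∀ {n} {f : Fin n → ℕ} i → (∀ j → j ≢ i → f j ≡ 0) → sum f ≡ f i
  sum-single {f = f} zero f≡0 = trans (cong (f zero +_) (sum-zero (λ j → f≡0 (suc j) λ ()))) (ℕ.+-identityʳ _)
  sum-single (suc i) f≡0 = cong₂ _+_ (f≡0 zero λ ()) (sum-single i (λ j j≢i → f≡0 (suc j) (j≢i ∘ suc-injective)))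

  sum-< : ∀ {n} (i : Fin n) → sum {n} (λ j → ι (j <? i)) ≡ toℕ i
  sum-< {n} zero = sum-zero {n} (λ j → ι-no (j <? zero {n}) λ ())
  sum-< {suc n} (suc i) = cong₂ _+_ (ι-yes (zero {n} <? suc i) (s≤s z≤n)) (trans shift (sum-< i))
    where
    shift : sum {n} (λ j → ι (suc j <? suc i)) ≡ sum {n} (λ j → ι (j <? i))
    shift = sum-cong-≗ {n} λ j → ι-⇔ (mk⇔ ℕ.s≤s⁻¹ s≤s) (suc j <? suc i) (j <? i)

  module _ {n : ℕ} where

    opaque
      count₂ : {R : Rel (Fin n) 0ℓ} → Decidable R → ℕ
      count₂ R? = sum λ a → sum λ b → ι (R? a b)

      count₂-def : {R : Rel (Fin n) 0ℓ} (R? : Decidable R) → count₂ R? ≡ sum (λ a → sum (λ b → ι (R? a b)))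
      count₂-def R? = refl

    module _ {P Q : Rel (Fin n) 0ℓ} (P? : Decidable P) (Q? : Decidable Q) where

      opaque
        unfolding count₂

        count₂-⇔ : (∀ a b → P a b ⇔ Q a b) → count₂ P? ≡ count₂ Q?
        count₂-⇔ P⇔Q = sum-cong-≗ {n} λ a → sum-cong-≗ {n} λ b → ι-⇔ (P⇔Q a b) (P? a b) (Q? a b)

      module _ (P⊆Q : ∀ {a b} → P a b → Q a b) where

        opaque
          unfolding count₂

          count₂-mono : count₂ P? ≤ count₂ Q?
          count₂-mono = sum-mono {n} λ a → sum-mono {n} λ b → ι-mono P⊆Q (P? a b) (Q? a b)

          count₂-≡⇒⊇ : count₂ P? ≡ count₂ Q? → ∀ {a b} → Q a b → P a b
          count₂-≡⇒⊇ eq {a} {b} = ι-reflects (P? a b) (Q? a b)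
            (sum-mono-≡ (λ b → ι-mono P⊆Q (P? a b) (Q? a b))
              (sum-mono-≡ (λ a → sum-mono {n} λ b → ι-mono P⊆Q (P? a b) (Q? a b)) eq a) b)

        -- Found by exhaustive search: if it failed, `P` and `Q` would coincide and have equal
        -- counts.
        count₂-<⇒∃ : count₂ P? ℕ.< count₂ Q? → ∃₂ λ a b → Q a b × ¬ P a b
        count₂-<⇒∃ P<Q with any? (λ a → any? (λ b → Q? a b ×-dec ¬? (P? a b)))
        ... | yes found = found
        ... | no none = contradiction (count₂-⇔ λ a b → mk⇔ P⊆Q (back a b)) (ℕ.<⇒≢ P<Q)
          where
          back : ∀ a b → Q a b → P a b
          back a b q with P? a b
          ... | yes p = p
          ... | no ¬p = contradiction (a , b , q , ¬p) none

        count₂-∃⇒< : ∀ {a b} → Q a b → ¬ P a b → count₂ P? ℕ.< count₂ Q?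
        count₂-∃⇒< q ¬p = ℕ.≤∧≢⇒< count₂-mono λ eq → ¬p (count₂-≡⇒⊇ eq q)

    module _ {P : Rel (Fin n) 0ℓ} (P? : Decidable P) (x y : Fin n) where

      Insert : Rel (Fin n) 0ℓ
      Insert a b = P a b ⊎ (a ≡ x × b ≡ y)

      insert? : Decidable Insert
      insert? a b = P? a b ⊎-dec ((a ≟ x) ×-dec (b ≟ y))

      opaque
        unfolding count₂

        count₂-insert : ¬ P x y → count₂ insert? ≡ suc (count₂ P?)
        count₂-insert ¬p = begin
          count₂ insert?                                    ≡⟨ sum-cong-≗ {n} (λ a → sum-cong-≗ {n} (λ b → split a b)) ⟩
          sum (λ a → sum (λ b → ι (s? a b) + ι (P? a b)))   ≡⟨ sum-cong-≗ {n} (λ a → ∑-distrib-+ {n} (λ b → ι (s? a b)) (λ b → ι (P? a b))) ⟩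
          sum (λ a → sum (λ b → ι (s? a b)) + sum (λ b → ι (P? a b)))   ≡⟨ ∑-distrib-+ {n} _ _ ⟩
          count₂ s? + count₂ P?                             ≡⟨ cong (_+ count₂ P?) one ⟩
          suc (count₂ P?)                                   ∎
          where
          open ≡-Reasoning
          s? : Decidable (λ a b → a ≡ x × b ≡ y)
          s? a b = (a ≟ x) ×-dec (b ≟ y)
          split : ∀ a b → ι (insert? a b) ≡ ι (s? a b) + ι (P? a b)
          split a b = go (s? a b)
            where
            go : Dec (a ≡ x × b ≡ y) → ι (insert? a b) ≡ ι (s? a b) + ι (P? a b)
            go (yes (refl , refl)) = trans (ι-yes (insert? x y) (inj₂ (refl , refl)))
              (sym (cong₂ _+_ (ι-yes (s? x y) (refl , refl)) (ι-no (P? x y) ¬p)))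
            go (no ¬s) = trans (ι-⇔ (mk⇔ (λ { (inj₁ p) → p ; (inj₂ s) → contradiction s ¬s }) inj₁) (insert? a b) (P? a b))
              (cong (_+ ι (P? a b)) (sym (ι-no (s? a b) ¬s)))
          one : count₂ s? ≡ 1
          one = trans (sum-single x (λ a a≢x → sum-zero (λ b → ι-no (s? a b) (a≢x ∘ proj₁))))
               (trans (sum-single y (λ b b≢y → ι-no (s? x b) (b≢y ∘ proj₂))) (ι-yes (s? x y) (refl , refl)))

    -- Inserting `(x , y)` into `P` already exhausts the size of `Q`, so any other pair of `Q` lies
    -- in `P`. It identifies the one box that a step of a path adds.
    count₂-suc-unique : ∀ {P Q : Rel (Fin n) 0ℓ} (P? : Decidable P) (Q? : Decidable Q) → (∀ {a b} → P a b → Q a b) →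
                        count₂ Q? ≡ suc (count₂ P?) → ∀ {a b x y} → Q a b → ¬ P a b → Q x y → ¬ P x y → a ≡ x × b ≡ y
    count₂-suc-unique {P} {Q} P? Q? P⊆Q eq {x = x} {y} q ¬p q′ ¬p′
      with count₂-≡⇒⊇ (insert? P? x y) Q? (λ { (inj₁ p) → P⊆Q p ; (inj₂ (refl , refl)) → q′ })
             (trans (count₂-insert P? x y ¬p′) (sym eq)) q
    ... | inj₁ p = contradiction p ¬p
    ... | inj₂ s = s

  private
    length-filter-tabulate : ∀ {A : Set} {P : Pred A 0ℓ} (P? : U.Decidable P) {n} (f : Fin n → A) →
                             length (filter P? (tabulate f)) ≡ sum (λ i → ι (P? (f i)))
    length-filter-tabulate P? {zero} f = refl
    length-filter-tabulate P? {suc n} f with P? (f zero)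
    ... | yes _ = cong suc (length-filter-tabulate P? (f ∘ suc))
    ... | no _  = length-filter-tabulate P? (f ∘ suc)

    length-filter-product : ∀ {A B : Set} {P : Pred (A × B) 0ℓ} (P? : U.Decidable P) {m n} (f : Fin m → A) (g : Fin n → B) →
                            length (filter P? (cartesianProduct (tabulate f) (tabulate g))) ≡ sum (λ i → sum (λ j → ι (P? (f i , g j))))
    length-filter-product P? {zero} f g = refl
    length-filter-product P? {suc m} {n} f g = begin
      length (filter P? (map (f zero ,_) (tabulate g) ++ cartesianProduct (tabulate (f ∘ suc)) (tabulate g)))
        ≡⟨ cong length (filter-++ P? (map (f zero ,_) (tabulate g)) _) ⟩
      length (filter P? (map (f zero ,_) (tabulate g)) ++ filter P? (cartesianProduct (tabulate (f ∘ suc)) (tabulate g)))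
        ≡⟨ length-++ (filter P? (map (f zero ,_) (tabulate g))) ⟩
      length (filter P? (map (f zero ,_) (tabulate g))) + length (filter P? (cartesianProduct (tabulate (f ∘ suc)) (tabulate g)))
        ≡⟨ cong₂ _+_ (trans (cong (length ∘ filter P?) (map-tabulate g (f zero ,_))) (length-filter-tabulate P? {n} (λ j → f zero , g j)))
                     (length-filter-product P? (f ∘ suc) g) ⟩
      _ ∎
      where open ≡-Reasoning

  module _ {n : ℕ} where

    pos : Permutation′ n → Fin n → Fin n
    pos π = π ⟨$⟩ˡ_

    pos-injective : ∀ π {a b} → pos π a ≡ pos π b → a ≡ b
    pos-injective π eq = trans (sym (inverseʳ π)) (trans (cong (π ⟨$⟩ʳ_) eq) (inverseʳ π))

    -- Inversions are indexed by values here, by positions in Defs.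
    Inv : Permutation′ n → Rel (Fin n) 0ℓ
    Inv π a b = a < b × pos π b < pos π a

    inv? : ∀ π → Decidable (Inv π)
    inv? π a b = (a <? b) ×-dec (pos π b <? pos π a)

    pos-dichotomy : ∀ π {a b} → a ≢ b → pos π a < pos π b ⊎ pos π b < pos π a
    pos-dichotomy π {a} {b} a≢b with <-cmp (pos π a) (pos π b)
    ... | tri< lt _ _ = inj₁ lt
    ... | tri≈ _ eq _ = contradiction (pos-injective π eq) a≢b
    ... | tri> _ _ gt = inj₂ gt

    reindex : ∀ (π : Permutation′ n) (f : Fin n → Fin n → ℕ) →
              sum (λ i → sum (λ j → f i j)) ≡ sum (λ a → sum (λ b → f (pos π a) (pos π b)))
    reindex π f = trans (sum-permute (λ i → sum (f i)) (flip π))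
                        (sum-cong-≗ {n} (λ a → sum-permute (f (pos π a)) (flip π)))

    ℓ-positions : ∀ π → ℓ π ≡ sum (λ i → sum (λ j → ι (inversion? π (i , j))))
    ℓ-positions π = length-filter-product (inversion? π) {n} {n} id id

    opaque
      unfolding count₂

      -- An inversion at positions i < j has its larger value at i. Replacing positions by values
      -- thus exchanges the roles of the two indices, which the interchange of sums undoes.
      ℓ≡count : ∀ π → ℓ π ≡ count₂ (inv? π)
      ℓ≡count π = begin
        ℓ π                                                                       ≡⟨ ℓ-positions π ⟩
        sum (λ i → sum (λ j → ι (inversion? π (i , j))))                          ≡⟨ reindex π (λ i j → ι (inversion? π (i , j))) ⟩
        sum (λ b → sum (λ a → ι (inversion? π (pos π b , pos π a))))              ≡⟨ ∑-comm {n} {n} _ ⟩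
        sum (λ a → sum (λ b → ι (inversion? π (pos π b , pos π a))))
          ≡⟨ sum-cong-≗ {n} (λ a → sum-cong-≗ {n} (λ b → ι-⇔ (mk⇔ (λ (p , q) → subst₂ _<_ (inverseʳ π) (inverseʳ π) q , p)
                                                                 (λ (p , q) → q , subst₂ _<_ (sym (inverseʳ π)) (sym (inverseʳ π)) p))
                                                            (inversion? π (pos π b , pos π a)) (inv? π a b))) ⟩
        count₂ (inv? π) ∎
        where open ≡-Reasoning

    module _ (π τ : Permutation′ n) where
      private
        -- `τ` has `a` before `b` and `π` has them the other way round, whichever value is larger;
        -- `up` and `down` split these pairs according to that.
        Diff : Rel (Fin n) 0ℓ
        Diff a b = pos τ a < pos τ b × pos π b < pos π a

        diff? : Decidable Diff
        diff? a b = (pos τ a <? pos τ b) ×-dec (pos π b <? pos π a)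

        up down : Fin n → Fin n → ℕ
        up a b = ι ((a <? b) ×-dec diff? a b)
        down a b = ι ((a <? b) ×-dec diff? b a)

        -- With positions relabelled by `τ`, an inversion of π⁻¹τ is a pair of values that `π` and
        -- `τ` order differently. Both orientations are then collected at the pair with `a < b`.
        ℓ-quotient : ℓ (τ ∘ₚ flip π) ≡ sum (λ a → sum (λ b → up a b + down a b))
        ℓ-quotient = begin
          ℓ (τ ∘ₚ flip π)                                            ≡⟨ ℓ-positions (τ ∘ₚ flip π) ⟩
          sum (λ i → sum (λ j → ι (inversion? (τ ∘ₚ flip π) (i , j))))  ≡⟨ reindex τ (λ i j → ι (inversion? (τ ∘ₚ flip π) (i , j))) ⟩
          sum (λ a → sum (λ b → ι (inversion? (τ ∘ₚ flip π) (pos τ a , pos τ b))))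
            ≡⟨ sum-cong-≗ {n} (λ a → sum-cong-≗ {n} (λ b → ι-⇔ (mk⇔ (λ (p , q) → p , subst₂ _<_ (cong (pos π) (inverseʳ τ)) (cong (pos π) (inverseʳ τ)) q)
                                                                   (λ (p , q) → p , subst₂ _<_ (cong (pos π) (sym (inverseʳ τ))) (cong (pos π) (sym (inverseʳ τ))) q))
                                                              (inversion? (τ ∘ₚ flip π) (pos τ a , pos τ b)) (diff? a b))) ⟩
          sum (λ a → sum (λ b → ι (diff? a b)))                      ≡⟨ sum-cong-≗ {n} (λ a → sum-cong-≗ {n} (λ b → split a b)) ⟩
          sum (λ a → sum (λ b → up a b + down b a))                  ≡⟨ sum-cong-≗ {n} (λ a → ∑-distrib-+ {n} (up a) (λ b → down b a)) ⟩
          sum (λ a → sum (up a) + sum (λ b → down b a))              ≡⟨ ∑-distrib-+ {n} (λ a → sum (up a)) (λ a → sum (λ b → down b a)) ⟩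
          sum (λ a → sum (up a)) + sum (λ a → sum (λ b → down b a))  ≡⟨ cong (sum (λ a → sum (up a)) +_) (∑-comm {n} {n} (λ a b → down b a)) ⟩
          sum (λ a → sum (up a)) + sum (λ a → sum (down a))          ≡⟨ ∑-distrib-+ {n} (λ a → sum (up a)) (λ a → sum (down a)) ⟨
          sum (λ a → sum (up a) + sum (down a))                      ≡⟨ sum-cong-≗ {n} (λ a → ∑-distrib-+ {n} (up a) (down a)) ⟨
          sum (λ a → sum (λ b → up a b + down a b)) ∎
          where
          open ≡-Reasoning
          split : ∀ a b → ι (diff? a b) ≡ up a b + down b a
          split a b with <-cmp a b
          ... | tri< a<b _ b≮a = trans (ι-⇔ (mk⇔ (a<b ,_) proj₂) (diff? a b) ((a <? b) ×-dec diff? a b))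
                                       (sym (trans (cong (up a b +_) (ι-no ((b <? a) ×-dec diff? a b) (b≮a ∘ proj₁))) (ℕ.+-identityʳ _)))
          ... | tri> a≮b _ b<a = trans (ι-⇔ (mk⇔ (b<a ,_) proj₂) (diff? a b) ((b <? a) ×-dec diff? a b))
                                       (sym (cong (_+ down b a) (ι-no ((a <? b) ×-dec diff? a b) (a≮b ∘ proj₁))))
          ... | tri≈ a≮b refl _ = trans (ι-no (diff? a a) (<-irrefl refl ∘ proj₁))
                                        (sym (cong₂ _+_ (ι-no ((a <? a) ×-dec diff? a a) (a≮b ∘ proj₁)) (ι-no ((a <? a) ×-dec diff? a a) (a≮b ∘ proj₁))))

        lhs rhs : Fin n → Fin n → ℕ
        lhs a b = ι (inv? π a b) + (up a b + down a b)
        rhs a b = ι (inv? τ a b)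

        -- For a < b, the left side is [π inverts ab] + [π and τ disagree on ab] and
        -- the right side is [τ inverts ab].
        pointwise : ∀ a b → (¬ (Inv π a b → Inv τ a b) × lhs a b ≡ 2 + rhs a b) ⊎ ((Inv π a b → Inv τ a b) × lhs a b ≡ rhs a b)
        pointwise a b = go (a <? b)
          where
          Cases : Set
          Cases = (¬ (Inv π a b → Inv τ a b) × lhs a b ≡ 2 + rhs a b) ⊎ ((Inv π a b → Inv τ a b) × lhs a b ≡ rhs a b)
          inside : a < b → pos π a < pos π b ⊎ pos π b < pos π a → pos τ a < pos τ b ⊎ pos τ b < pos τ a → Cases
          inside a<b (inj₁ p) (inj₁ t) = inj₂ ((λ (_ , p′) → contradiction p′ (<-asym p)) ,
                cong₂ _+_ (ι-no (inv? π a b) (<-asym p ∘ proj₂))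
                (trans (cong₂ _+_ (ι-no ((a <? b) ×-dec diff? a b) (<-asym p ∘ proj₂ ∘ proj₂))
                                  (ι-no ((a <? b) ×-dec diff? b a) (<-asym t ∘ proj₁ ∘ proj₂)))
                       (sym (ι-no (inv? τ a b) (<-asym t ∘ proj₂)))))
          inside a<b (inj₁ p) (inj₂ t) = inj₂ ((λ (_ , p′) → contradiction p′ (<-asym p)) ,
                cong₂ _+_ (ι-no (inv? π a b) (<-asym p ∘ proj₂))
                (trans (cong₂ _+_ (ι-no ((a <? b) ×-dec diff? a b) (<-asym p ∘ proj₂ ∘ proj₂))
                                  (ι-yes ((a <? b) ×-dec diff? b a) (a<b , t , p)))
                       (sym (ι-yes (inv? τ a b) (a<b , t)))))
          inside a<b (inj₂ p) (inj₁ t) = inj₁ ((λ f → <-asym t (proj₂ (f (a<b , p)))) ,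
                trans (cong₂ _+_ (ι-yes (inv? π a b) (a<b , p))
                         (cong₂ _+_ (ι-yes ((a <? b) ×-dec diff? a b) (a<b , t , p))
                                    (ι-no ((a <? b) ×-dec diff? b a) (<-asym t ∘ proj₁ ∘ proj₂))))
                      (cong (2 +_) (sym (ι-no (inv? τ a b) (<-asym t ∘ proj₂)))))
          inside a<b (inj₂ p) (inj₂ t) = inj₂ ((λ _ → a<b , t) ,
                trans (cong₂ _+_ (ι-yes (inv? π a b) (a<b , p))
                         (cong₂ _+_ (ι-no ((a <? b) ×-dec diff? a b) (<-asym t ∘ proj₁ ∘ proj₂))
                                    (ι-no ((a <? b) ×-dec diff? b a) (<-asym p ∘ proj₂ ∘ proj₂))))
                      (sym (ι-yes (inv? τ a b) (a<b , t))))
          go : Dec (a < b) → Cases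
          go (yes a<b) = inside a<b (pos-dichotomy π (ℕ.<⇒≢ a<b ∘ cong toℕ)) (pos-dichotomy τ (ℕ.<⇒≢ a<b ∘ cong toℕ))
          go (no a≮b) = inj₂ ((λ (a<b , _) → contradiction a<b a≮b) ,
            trans (cong₂ _+_ (ι-no (inv? π a b) (a≮b ∘ proj₁))
                    (cong₂ _+_ (ι-no ((a <? b) ×-dec diff? a b) (a≮b ∘ proj₁)) (ι-no ((a <? b) ×-dec diff? b a) (a≮b ∘ proj₁))))
                  (sym (ι-no (inv? τ a b) (a≮b ∘ proj₁))))

        rhs≤lhs : ∀ a b → rhs a b ≤ lhs a b
        rhs≤lhs a b with pointwise a b
        ... | inj₁ (_ , eq) = ℕ.≤-trans (ℕ.m≤n+m _ 2) (ℕ.≤-reflexive (sym eq))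
        ... | inj₂ (_ , eq) = ℕ.≤-reflexive (sym eq)

        sum-lhs : ℓ π + ℓ (τ ∘ₚ flip π) ≡ sum (λ a → sum (lhs a))
        sum-lhs = begin
          ℓ π + ℓ (τ ∘ₚ flip π)   ≡⟨ cong₂ _+_ (trans (ℓ≡count π) (count₂-def (inv? π))) ℓ-quotient ⟩
          sum (λ a → sum (λ b → ι (inv? π a b))) + sum (λ a → sum (λ b → up a b + down a b))   ≡⟨ ∑-distrib-+ {n} _ _ ⟨
          sum (λ a → sum (λ b → ι (inv? π a b)) + sum (λ b → up a b + down a b))   ≡⟨ sum-cong-≗ {n} (λ a → ∑-distrib-+ {n} (λ b → ι (inv? π a b)) (λ b → up a b + down a b)) ⟨
          sum (λ a → sum (lhs a)) ∎
          where open ≡-Reasoning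

      -- The two sides of the length equation are the totals of `lhs` and `rhs`. As `rhs` never
      -- exceeds `lhs`, equal totals force equality at every pair, whereas a pair inverted by `π`
      -- alone would leave an excess of 2.
      ≤ᵂ⇒⊆ : π ≤ᵂ τ → ∀ {a b} → Inv π a b → Inv τ a b
      ≤ᵂ⇒⊆ π≤τ {a} {b} with pointwise a b
      ... | inj₂ (imp , _) = imp
      ... | inj₁ (_ , eq) = contradiction (trans (sym eq) (sym (sum-mono-≡ (rhs≤lhs a) (sum-mono-≡ (λ a → sum-mono {n} (rhs≤lhs a)) total a) b))) (ℕ.m+1+n≢m _ ∘ trans (ℕ.+-comm (rhs a b) 2))
        where
        total : sum (λ a → sum (rhs a)) ≡ sum (λ a → sum (lhs a))
        total = trans (sym (trans (ℓ≡count τ) (count₂-def (inv? τ)))) (trans (sym π≤τ) sum-lhs)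

      ⊆⇒≤ᵂ : (∀ {a b} → Inv π a b → Inv τ a b) → π ≤ᵂ τ
      ⊆⇒≤ᵂ π⊆τ = trans sum-lhs (trans (sum-cong-≗ {n} (λ a → sum-cong-≗ {n} (λ b → eq a b))) (sym (trans (ℓ≡count τ) (count₂-def (inv? τ)))))
        where
        eq : ∀ a b → lhs a b ≡ rhs a b
        eq a b with pointwise a b
        ... | inj₁ (¬imp , _) = contradiction π⊆τ ¬imp
        ... | inj₂ (_ , eq) = eq

    pos≡count : ∀ (π : Permutation′ n) a → toℕ (pos π a) ≡ sum {n} (λ x → ι (pos π x <? pos π a))
    pos≡count π a = trans (sym (sum-< (pos π a))) (sum-permute {n} {n} (λ i → ι (i <? pos π a)) (flip π))

    -- The inversions tell which of any two values comes first, and the position of a value is the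
    -- number of values before it.
    Inv-injective : ∀ {π τ} → (∀ {a b} → Inv π a b → Inv τ a b) → (∀ {a b} → Inv τ a b → Inv π a b) → π ≈ₚ τ
    Inv-injective {π} {τ} f g i = trans (sym (inverseʳ τ)) (trans (cong (τ ⟨$⟩ʳ_) (trans (sym (pos≡ (π ⟨$⟩ʳ i))) (inverseˡ π))) refl)
      where
      order : ∀ {π τ} → (∀ {a b} → Inv π a b → Inv τ a b) → (∀ {a b} → Inv τ a b → Inv π a b) →
              ∀ {x a} → pos π x < pos π a → pos τ x < pos τ a
      order {π} {τ} f g {x} {a} lt with <-cmp x a
      ... | tri≈ _ refl _ = contradiction lt (<-irrefl refl)
      ... | tri> _ _ a<x = proj₂ (f (a<x , lt))
      ... | tri< x<a x≢a _ with pos-dichotomy τ x≢a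
      ...   | inj₁ lt′ = lt′
      ...   | inj₂ gt = contradiction (proj₂ (g (x<a , gt))) (<-asym lt)
      pos≡ : ∀ a → pos π a ≡ pos τ a
      pos≡ a = toℕ-injective (trans (pos≡count π a) (trans (sum-cong-≗ {n} (λ x →
                 ι-⇔ (mk⇔ (order {π} {τ} f g) (order {τ} {π} g f)) (pos π x <? pos π a) (pos τ x <? pos τ a))) (sym (pos≡count τ a))))

-- Prefix and suffix unimodality as ideals and filters of boxes.

module UnimodalPermutations where

  open import Defs
  open import Data.Fin.Base using (Fin; zero; suc; toℕ; fromℕ<; opposite; _<_; _≤_)
  open import Data.Fin.Permutation using (Permutation′; permutation; reverse; _⟨$⟩ʳ_; _∘ₚ_; flip; inverseˡ; inverseʳ) renaming (_≈_ to _≈ₚ_)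
  open import Data.Fin.Properties using (_<?_; _≤?_; _≟_; any?; <-cmp; <-asym; <-irrefl; toℕ-injective; toℕ<n; toℕ-fromℕ<; opposite-prop; opposite-involutive; punchOut-injective; injective⇒≤)
  open import Data.Nat.Base as ℕ using (ℕ; zero; suc; z≤n; s≤s)
  import Data.Nat.Properties as ℕ
  open import Data.Product.Base using (_×_; _,_; proj₁; proj₂; ∃; ∃₂)
  open import Data.Sum.Base using (_⊎_; inj₁; inj₂; [_,_]′)
  open import Function.Base using (_∘_)
  open import Function.Bundles using (mk⇔)
  open import Function.Definitions using (Injective)
  open import Relation.Binary.Core using (Rel)
  open import Relation.Binary.Definitions using (Decidable; tri<; tri≈; tri>)
  open import Relation.Binary.PropositionalEquality using (_≡_; _≢_; refl; sym; trans; cong; subst; subst₂; module ≡-Reasoning)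
  open import Relation.Nullary.Decidable using (yes; no; _×-dec_; _⊎-dec_; ¬?)
  open import Relation.Nullary.Negation using (¬_; contradiction)
  open import Relation.Unary using (Pred)
  import Relation.Unary as U
  open import Algebra.Properties.CommutativeMonoid.Sum ℕ.+-0-commutativeMonoid using (sum; sum-cong-≗; ∑-comm; sum-permute)
  open import Level using (0ℓ)
  open Inversions

  opposite-mono : ∀ {n} {a b : Fin n} → a ≤ b → opposite b ≤ opposite a
  opposite-mono {n} {a} {b} a≤b = subst₂ ℕ._≤_ (sym (opposite-prop b)) (sym (opposite-prop a)) (ℕ.∸-monoʳ-≤ n (s≤s a≤b))

  opposite-anti : ∀ {n} {a b : Fin n} → a < b → opposite b < opposite a
  opposite-anti {n} {a} {b} a<b = subst₂ ℕ._<_ (sym (opposite-prop b)) (sym (opposite-prop a)) (ℕ.∸-monoʳ-< (s≤s a<b) (toℕ<n b))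

  opposite-anti⁻ : ∀ {n} {a b : Fin n} → opposite b < opposite a → a < b
  opposite-anti⁻ {a = a} {b} lt = subst₂ _<_ (opposite-involutive a) (opposite-involutive b) (opposite-anti lt)

  least : ∀ {n} {S : Pred (Fin n) 0ℓ} → U.Decidable S → ∃ S → ∃ λ a → S a × (∀ b → S b → a ≤ b)
  least {suc n} S? (x , Sx) with S? zero
  ... | yes S0 = zero , S0 , λ _ _ → z≤n
  least {suc n} S? (zero  , Sx) | no ¬S0 = contradiction Sx ¬S0
  least {suc n} S? (suc x , Sx) | no ¬S0 = let a , Sa , min = least (S? ∘ suc) (x , Sx)
    in suc a , Sa , λ { zero S0 → contradiction S0 ¬S0 ; (suc b) Sb → s≤s (min b Sb) }

  module _ {n : ℕ} {S : Pred (Fin n) 0ℓ} (S? : U.Decidable S) where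

    greatest : ∃ S → ∃ λ b → S b × (∀ a → S a → a ≤ b)
    greatest (x , Sx) = let b , Sb , min = least (S? ∘ opposite) (opposite x , subst S (sym (opposite-involutive x)) Sx)
      in opposite b , Sb , λ a Sa → subst (_≤ opposite b) (opposite-involutive a)
           (opposite-mono (min (opposite a) (subst S (sym (opposite-involutive a)) Sa)))

    convex⇒interval : ∃ S → (∀ {a b c} → S a → S c → a < b → b < c → S b) → IsInterval S
    convex⇒interval ∃S convex = a , b , (λ Sv → min _ Sv , max _ Sv) , between
      where
      a = proj₁ (least S? ∃S)
      Sa = proj₁ (proj₂ (least S? ∃S))
      min = proj₂ (proj₂ (least S? ∃S))
      b = proj₁ (greatest ∃S)
      Sb = proj₁ (proj₂ (greatest ∃S))
      max = proj₂ (proj₂ (greatest ∃S))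
      between : ∀ {v} → a ≤ v × v ≤ b → S v
      between {v} (a≤v , v≤b) with ℕ.m≤n⇒m<n∨m≡n a≤v | ℕ.m≤n⇒m<n∨m≡n v≤b
      ... | inj₂ eq | _ = subst S (toℕ-injective eq) Sa
      ... | inj₁ _ | inj₂ eq = subst S (toℕ-injective (sym eq)) Sb
      ... | inj₁ a<v | inj₁ v<b = convex Sa Sb a<v v<b

  interval-convex : ∀ {n} {S : Pred (Fin n) 0ℓ} → IsInterval S → ∀ {a b c} → S a → S c → a < b → b < c → S b
  interval-convex (x , y , S⊆ , ⊆S) Sa Sc a<b b<c =
    ⊆S (ℕ.≤-trans (proj₁ (S⊆ Sa)) (ℕ.<⇒≤ a<b) , ℕ.≤-trans (ℕ.<⇒≤ b<c) (proj₂ (S⊆ Sc)))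

  module _ {n : ℕ} where

    Ideal Filter : Rel (Fin n) 0ℓ → Set
    Ideal  R = ∀ {a b x y} → R a b → x ≤ a → y ≤ b → x < y → R x y
    Filter R = ∀ {a b x y} → R a b → a ≤ x → b ≤ y → x < y → R x y

    module _ (π : Permutation′ n) where

      private
        prefix⇒ : ∀ {j v} → PrefixSet π j v → pos π v ≤ j
        prefix⇒ {j} (i , i≤j , refl) = subst (_≤ j) (sym (inverseˡ π)) i≤j

        prefix⇐ : ∀ {j v} → pos π v ≤ j → PrefixSet π j v
        prefix⇐ {v = v} le = pos π v , le , inverseʳ π

        suffix⇒ : ∀ {j v} → SuffixSet π j v → j ≤ pos π v
        suffix⇒ {j} (i , j≤i , refl) = subst (j ≤_) (sym (inverseˡ π)) j≤i

        suffix⇐ : ∀ {j v} → j ≤ pos π v → SuffixSet π j v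
        suffix⇐ {v = v} le = pos π v , le , inverseʳ π

        prefix? : ∀ j → U.Decidable (PrefixSet π j)
        prefix? j v = any? λ i → (i ≤? j) ×-dec (π ⟨$⟩ʳ i ≟ v)

        suffix? : ∀ j → U.Decidable (SuffixSet π j)
        suffix? j v = any? λ i → (j ≤? i) ×-dec (π ⟨$⟩ʳ i ≟ v)

        <⇒≢′ : ∀ {a b : Fin n} → a < b → a ≢ b
        <⇒≢′ a<b refl = <-irrefl refl a<b

      -- No value can stand after both a smaller and a larger one. If moving an inversion up its
      -- column or left along its row gave a pair that is not inverted, such a value would appear.
      prefixes⇒ideal : (∀ j → IsInterval (PrefixSet π j)) → Ideal (Inv π)
      prefixes⇒ideal int {a} {b} {x} {y} = ideal {a} {b} {x} {y}
        where
        -- The prefix that ends at the later of `a` and `c` contains these two but would miss `b`.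
        middle-not-last : ∀ {a b c} → a < b → b < c → pos π a < pos π b → ¬ pos π c < pos π b
        middle-not-last {a} {b} {c} a<b b<c pa<pb pc<pb with ℕ.≤-total (toℕ (pos π a)) (toℕ (pos π c))
        ... | inj₁ a≤c = ℕ.<⇒≱ pc<pb (prefix⇒ (interval-convex (int (pos π c)) (prefix⇐ a≤c) (prefix⇐ ℕ.≤-refl) a<b b<c))
        ... | inj₂ c≤a = ℕ.<⇒≱ pa<pb (prefix⇒ (interval-convex (int (pos π a)) (prefix⇐ ℕ.≤-refl) (prefix⇐ c≤a) a<b b<c))
        lower-row : ∀ {a b x} → Inv π a b → x ≤ a → Inv π x b
        lower-row {a} {b} {x} (a<b , pb<pa) x≤a with ℕ.m≤n⇒m<n∨m≡n x≤a
        ... | inj₂ eq = subst (λ z → Inv π z b) (toℕ-injective (sym eq)) (a<b , pb<pa)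
        ... | inj₁ x<a with pos-dichotomy π (<⇒≢′ (ℕ.<-trans x<a a<b))
        ...   | inj₁ px<pb = contradiction pb<pa (middle-not-last x<a a<b (ℕ.<-trans px<pb pb<pa))
        ...   | inj₂ pb<px = ℕ.<-trans x<a a<b , pb<px
        ideal : Ideal (Inv π)
        ideal {a} {b} {x} {y} ab x≤a y≤b x<y with lower-row ab x≤a | ℕ.m≤n⇒m<n∨m≡n y≤b
        ... | xb | inj₂ eq = subst (Inv π x) (toℕ-injective (sym eq)) xb
        ... | (_ , pb<px) | inj₁ y<b with pos-dichotomy π (<⇒≢′ x<y)
        ...   | inj₁ px<py = contradiction (ℕ.<-trans pb<px px<py) (middle-not-last x<y y<b px<py)
        ...   | inj₂ py<px = x<y , py<px

      suffixes⇒filter : (∀ j → IsInterval (SuffixSet π j)) → Filter (Inv π)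
      suffixes⇒filter int {a} {b} {x} {y} = filter {a} {b} {x} {y}
        where
        -- The suffix that starts at the earlier of `a` and `c` contains these two but would miss
        -- `b`.
        middle-not-first : ∀ {a b c} → a < b → b < c → pos π b < pos π a → ¬ pos π b < pos π c
        middle-not-first {a} {b} {c} a<b b<c pb<pa pb<pc with ℕ.≤-total (toℕ (pos π a)) (toℕ (pos π c))
        ... | inj₁ a≤c = ℕ.<⇒≱ pb<pa (suffix⇒ (interval-convex (int (pos π a)) (suffix⇐ ℕ.≤-refl) (suffix⇐ a≤c) a<b b<c))
        ... | inj₂ c≤a = ℕ.<⇒≱ pb<pc (suffix⇒ (interval-convex (int (pos π c)) (suffix⇐ c≤a) (suffix⇐ ℕ.≤-refl) a<b b<c))
        raise-column : ∀ {a b y} → Inv π a b → b ≤ y → Inv π a y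
        raise-column {a} {b} {y} (a<b , pb<pa) b≤y with ℕ.m≤n⇒m<n∨m≡n b≤y
        ... | inj₂ eq = subst (Inv π a) (toℕ-injective eq) (a<b , pb<pa)
        ... | inj₁ b<y with pos-dichotomy π (<⇒≢′ (ℕ.<-trans a<b b<y))
        ...   | inj₁ pa<py = contradiction (ℕ.<-trans pb<pa pa<py) (middle-not-first a<b b<y pb<pa)
        ...   | inj₂ py<pa = ℕ.<-trans a<b b<y , py<pa
        filter : Filter (Inv π)
        filter {a} {b} {x} {y} ab a≤x b≤y x<y with raise-column ab b≤y | ℕ.m≤n⇒m<n∨m≡n a≤x
        ... | ay | inj₂ eq = subst (λ z → Inv π z y) (toℕ-injective eq) ay
        ... | (_ , py<pa) | inj₁ a<x with pos-dichotomy π (<⇒≢′ x<y)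
        ...   | inj₁ px<py = contradiction px<py (middle-not-first a<x x<y (ℕ.<-trans px<py py<pa))
        ...   | inj₂ py<px = x<y , py<px

      -- If a prefix had `a` and `c` but not `b` between them, then `c` would precede `b`; the ideal
      -- would pass from the inversion `(b , c)` to `(a , b)` and put `b` before `a`.
      ideal⇒prefixes : Ideal (Inv π) → ∀ j → IsInterval (PrefixSet π j)
      ideal⇒prefixes ideal j = convex⇒interval (prefix? j) (π ⟨$⟩ʳ j , j , ℕ.≤-refl , refl) convex
        where
        convex : ∀ {a b c} → PrefixSet π j a → PrefixSet π j c → a < b → b < c → PrefixSet π j b
        convex {a} {b} {c} Sa Sc a<b b<c with pos π b ≤? j
        ... | yes pb≤j = prefix⇐ pb≤j
        ... | no pb≰j = contradiction (proj₂ (ideal (b<c , above Sc) (ℕ.<⇒≤ a<b) (ℕ.<⇒≤ b<c) a<b)) (<-asym (above Sa))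
          where
          above : ∀ {v} → PrefixSet π j v → pos π v < pos π b
          above Sv = ℕ.≤-<-trans (prefix⇒ Sv) (ℕ.≰⇒> pb≰j)

      -- Dually, a missing `b` would precede `a`; the filter would pass from the inversion `(a , b)`
      -- to `(b , c)` and put `c` before `b`.
      filter⇒suffixes : Filter (Inv π) → ∀ j → IsInterval (SuffixSet π j)
      filter⇒suffixes filter j = convex⇒interval (suffix? j) (π ⟨$⟩ʳ j , j , ℕ.≤-refl , refl) convex
        where
        convex : ∀ {a b c} → SuffixSet π j a → SuffixSet π j c → a < b → b < c → SuffixSet π j b
        convex {a} {b} {c} Sa Sc a<b b<c with j ≤? pos π b
        ... | yes j≤pb = suffix⇐ j≤pb
        ... | no j≰pb = contradiction (proj₂ (filter (a<b , below Sa) (ℕ.<⇒≤ a<b) (ℕ.<⇒≤ b<c) b<c)) (<-asym (below Sc))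
          where
          below : ∀ {v} → SuffixSet π j v → pos π b < pos π v
          below Sv = ℕ.<-≤-trans (ℕ.≰⇒> j≰pb) (suffix⇒ Sv)

      unimodal⇒ : Unimodal π → Ideal (Inv π) ⊎ Filter (Inv π)
      unimodal⇒ (inj₁ u) = inj₁ (prefixes⇒ideal u)
      unimodal⇒ (inj₂ u) = inj₂ (suffixes⇒filter u)

      unimodal⇐ : Ideal (Inv π) ⊎ Filter (Inv π) → Unimodal π
      unimodal⇐ (inj₁ i) = inj₁ (ideal⇒prefixes i)
      unimodal⇐ (inj₂ f) = inj₂ (filter⇒suffixes f)

    opaque
      -- On boxes this is the reflection of Δₙ in its antidiagonal, `(a , b)` to
      -- `(opposite b , opposite a)`, which reverses the coordinatewise order.
      conj : Permutation′ n → Permutation′ n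
      conj π = reverse ∘ₚ π ∘ₚ reverse

      Inv-conj : ∀ π {a b} → Inv π (opposite b) (opposite a) → Inv (conj π) a b
      Inv-conj π (p , q) = opposite-anti⁻ p , opposite-anti q

      Inv-conj⁻ : ∀ π {a b} → Inv (conj π) a b → Inv π (opposite b) (opposite a)
      Inv-conj⁻ π (p , q) = opposite-anti p , opposite-anti⁻ q

      conj-ideal : ∀ π → Ideal (Inv π) → Filter (Inv (conj π))
      conj-ideal π ideal ab a≤x b≤y x<y =
        Inv-conj π (ideal (Inv-conj⁻ π ab) (opposite-mono b≤y) (opposite-mono a≤x) (opposite-anti x<y))

      conj-filter : ∀ π → Filter (Inv π) → Ideal (Inv (conj π))
      conj-filter π filter ab x≤a y≤b x<y =
        Inv-conj π (filter (Inv-conj⁻ π ab) (opposite-mono y≤b) (opposite-mono x≤a) (opposite-anti x<y))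

      conj-involutive : ∀ π → conj (conj π) ≈ₚ π
      conj-involutive π i = trans (opposite-involutive _) (cong (π ⟨$⟩ʳ_) (opposite-involutive i))

      opaque
        unfolding count₂
        ℓ-conj : ∀ π → ℓ (conj π) ≡ ℓ π
        ℓ-conj π = begin
          ℓ (conj π)                ≡⟨ ℓ≡count (conj π) ⟩
          count₂ (inv? (conj π))    ≡⟨ count₂-⇔ (inv? (conj π)) (λ a b → inv? π (opposite b) (opposite a)) (λ a b → mk⇔ (Inv-conj⁻ π) (Inv-conj π)) ⟩
          sum (λ a → sum (λ b → ι (inv? π (opposite b) (opposite a))))   ≡⟨ sum-cong-≗ {n} (λ a → sum-permute {n} {n} (λ b → ι (inv? π b (opposite a))) reverse) ⟨
          sum (λ a → sum (λ b → ι (inv? π b (opposite a))))   ≡⟨ sum-permute {n} {n} (λ a → sum {n} (λ b → ι (inv? π b a))) reverse ⟨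
          sum (λ a → sum (λ b → ι (inv? π b a)))   ≡⟨ ∑-comm {n} {n} (λ b a → ι (inv? π b a)) ⟨
          count₂ (inv? π)           ≡⟨ ℓ≡count π ⟨
          ℓ π                       ∎
          where open ≡-Reasoning

    injective⇒permutation : (f : Fin n → Fin n) → Injective _≡_ _≡_ f → ∃ λ (ρ : Permutation′ n) → ∀ i → ρ ⟨$⟩ʳ i ≡ f i
    injective⇒permutation f inj = permutation f (proj₁ ∘ preimage f inj) (proj₂ ∘ preimage f inj) (λ i → inj (proj₂ (preimage f inj (f i)))) , λ _ → refl
      where
      preimage : ∀ {m} (f : Fin m → Fin m) → Injective _≡_ _≡_ f → ∀ j → ∃ λ i → f i ≡ j
      preimage {suc m} f inj j with any? (λ i → f i ≟ j)
      ... | yes found = found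
      -- Pigeonhole: with the missed value punched out, `f` would embed `Fin (suc m)` into `Fin m`.
      ... | no none = contradiction (injective⇒≤ (λ {i} {k} → inj ∘ punchOut-injective (missed i) (missed k))) ℕ.1+n≰n
        where
        missed : ∀ i → j ≢ f i
        missed i eq = none (i , sym eq)

    -- Each value is sent to the number of values before it. This count increases strictly along the
    -- order, so it is injective and gives a permutation.
    module TotalOrder {_◁_ : Rel (Fin n) 0ℓ} (_◁?_ : Decidable _◁_)
      (irrefl : ∀ {a} → ¬ a ◁ a) (◁-trans : ∀ {a b c} → a ◁ b → b ◁ c → a ◁ c)
      (total : ∀ {a b} → a ≢ b → a ◁ b ⊎ b ◁ a) where

      private
        height : Fin n → ℕ
        height a = sum {n} λ x → ι (x ◁? a)

        mono : ∀ {a b} → a ◁ b → height a ℕ.< height b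
        mono {a} {b} a◁b = ℕ.≤∧≢⇒< (sum-mono {n} le) λ eq →
          irrefl (ι-reflects (a ◁? a) (a ◁? b) (sum-mono-≡ le eq a) a◁b)
          where
          le : ∀ x → ι (x ◁? a) ℕ.≤ ι (x ◁? b)
          le x = ι-mono (λ x◁a → ◁-trans x◁a a◁b) (x ◁? a) (x ◁? b)

        height-injective : ∀ {a b} → height a ≡ height b → a ≡ b
        height-injective {a} {b} eq with a ≟ b
        ... | yes a≡b = a≡b
        ... | no a≢b = contradiction eq ([ (λ a◁b → ℕ.<⇒≢ (mono a◁b)) , (λ b◁a → ℕ.<⇒≢ (mono b◁a) ∘ sym) ]′ (total a≢b))

        height<n : ∀ a → height a ℕ.< n
        height<n a = subst (height a ℕ.<_) (trans (sum-cong-≗ {n} (λ _ → refl)) all)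
          (ℕ.≤∧≢⇒< (sum-mono {n} le) λ eq → contradiction (trans (sym (ι-no (a ◁? a) irrefl)) (sum-mono-≡ le eq a)) λ ())
          where
          le : ∀ x → ι (x ◁? a) ℕ.≤ 1
          le x with x ◁? a
          ... | yes _ = ℕ.≤-refl
          ... | no _ = z≤n
          all : sum {n} (λ _ → 1) ≡ n
          all = go n
            where
            go : ∀ n → sum {n} (λ _ → 1) ≡ n
            go zero = refl
            go (suc n) = cong suc (go n)

        ρ : ∃ λ (ρ : Permutation′ n) → ∀ a → ρ ⟨$⟩ʳ a ≡ fromℕ< (height<n a)
        ρ = injective⇒permutation (λ a → fromℕ< (height<n a)) λ {a} {b} eq →
          height-injective (trans (sym (toℕ-fromℕ< (height<n a))) (trans (cong toℕ eq) (toℕ-fromℕ< (height<n b))))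

        toℕ-ρ : ∀ a → toℕ (proj₁ ρ ⟨$⟩ʳ a) ≡ height a
        toℕ-ρ a = trans (cong toℕ (proj₂ ρ a)) (toℕ-fromℕ< (height<n a))

      arrangement : Permutation′ n
      arrangement = flip (proj₁ ρ)

      ◁⇒pos : ∀ {a b} → a ◁ b → pos arrangement a < pos arrangement b
      ◁⇒pos {a} {b} a◁b = subst₂ ℕ._<_ (sym (toℕ-ρ a)) (sym (toℕ-ρ b)) (mono a◁b)

      pos⇒◁ : ∀ {a b} → pos arrangement a < pos arrangement b → a ◁ b
      pos⇒◁ {a} {b} lt with a ≟ b
      ... | yes refl = contradiction lt (<-irrefl refl)
      ... | no a≢b with total a≢b
      ...   | inj₁ a◁b = a◁b
      ...   | inj₂ b◁a = contradiction (◁⇒pos b◁a) (<-asym lt)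

    module _ {R : Rel (Fin n) 0ℓ} (R? : Decidable R) where

      -- Closing downwards lets every candidate box yield a permutation, even one whose insertion
      -- spoils the ideal; `Next` screens such candidates by membership and rank.
      Below : Rel (Fin n) 0ℓ
      Below a b = ∃₂ λ x y → a ≤ x × b ≤ y × R x y

      below? : Decidable Below
      below? a b = any? λ x → any? λ y → (a ≤? x) ×-dec ((b ≤? y) ×-dec R? x y)

      private
        lower : ∀ {a b x y} → Below a b → x ≤ a → y ≤ b → Below x y
        lower (x , y , a≤x , b≤y , r) x≤a y≤b = x , y , ℕ.≤-trans x≤a a≤x , ℕ.≤-trans y≤b b≤y , r

        -- The intended order of appearance: values keep their natural order except for the pairs in
        -- the closure.
        _◁_ : Rel (Fin n) 0ℓ
        a ◁ b = (a < b × ¬ Below a b) ⊎ (b < a × Below b a)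

        _◁?_ : Decidable _◁_
        a ◁? b = ((a <? b) ×-dec ¬? (below? a b)) ⊎-dec ((b <? a) ×-dec below? b a)

        irrefl : ∀ {a} → ¬ a ◁ a
        irrefl (inj₁ (a<a , _)) = <-irrefl refl a<a
        irrefl (inj₂ (a<a , _)) = <-irrefl refl a<a

        -- For values u < v < w the boxes (u , v), (u , w), (v , w) increase in Δₙ, so membership in
        -- a down-closed set can only be lost along them. A cycle would need (u , w) to differ from
        -- both of the others.
        ◁-trans : ∀ {a b c} → a ◁ b → b ◁ c → a ◁ c
        ◁-trans (inj₁ (a<b , ¬ab)) (inj₁ (b<c , ¬bc)) = inj₁ (ℕ.<-trans a<b b<c , λ ac → ¬ab (lower ac ℕ.≤-refl (ℕ.<⇒≤ b<c)))
        ◁-trans (inj₂ (b<a , ba)) (inj₂ (c<b , cb)) = inj₂ (ℕ.<-trans c<b b<a , lower ba (ℕ.<⇒≤ c<b) ℕ.≤-refl)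
        ◁-trans {a} {b} {c} (inj₁ (a<b , ¬ab)) (inj₂ (c<b , cb)) with <-cmp a c
        ... | tri< a<c _ _ = contradiction (lower cb (ℕ.<⇒≤ a<c) ℕ.≤-refl) ¬ab
        ... | tri≈ _ refl _ = contradiction cb ¬ab
        ... | tri> _ _ c<a = inj₂ (c<a , lower cb ℕ.≤-refl (ℕ.<⇒≤ a<b))
        ◁-trans {a} {b} {c} (inj₂ (b<a , ba)) (inj₁ (b<c , ¬bc)) with <-cmp a c
        ... | tri< a<c _ _ = inj₁ (a<c , λ ac → ¬bc (lower ac (ℕ.<⇒≤ b<a) ℕ.≤-refl))
        ... | tri≈ _ refl _ = contradiction ba ¬bc
        ... | tri> _ _ c<a = contradiction (lower ba ℕ.≤-refl (ℕ.<⇒≤ c<a)) ¬bc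

        total : ∀ {a b} → a ≢ b → a ◁ b ⊎ b ◁ a
        total {a} {b} a≢b with <-cmp a b
        ... | tri≈ _ a≡b _ = contradiction a≡b a≢b
        ... | tri< a<b _ _ with below? a b
        ...   | yes ab = inj₂ (inj₂ (a<b , ab))
        ...   | no ¬ab = inj₁ (inj₁ (a<b , ¬ab))
        total {a} {b} a≢b | tri> _ _ b<a with below? b a
        ...   | yes ba = inj₁ (inj₂ (b<a , ba))
        ...   | no ¬ba = inj₂ (inj₁ (b<a , ¬ba))

        open TotalOrder _◁?_ irrefl ◁-trans total

      opaque
        -- R need not be an ideal: the inversions are its down-closure.
        fromIdeal : Permutation′ n
        fromIdeal = arrangement

        Inv-fromIdeal⇒Below : ∀ {a b} → Inv fromIdeal a b → Below a b
        Inv-fromIdeal⇒Below (a<b , lt) with pos⇒◁ lt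
        ... | inj₁ (b<a , _) = contradiction a<b (<-asym b<a)
        ... | inj₂ (_ , ab) = ab

        Below⇒Inv-fromIdeal : ∀ {a b} → a < b → Below a b → Inv fromIdeal a b
        Below⇒Inv-fromIdeal a<b ab = a<b , ◁⇒pos (inj₂ (a<b , ab))

        fromIdeal-ideal : Ideal (Inv fromIdeal)
        fromIdeal-ideal ab x≤a y≤b x<y = Below⇒Inv-fromIdeal x<y (lower (Inv-fromIdeal⇒Below ab) x≤a y≤b)

        Inv-fromIdeal⇐ : ∀ {a b} → a < b → R a b → Inv fromIdeal a b
        Inv-fromIdeal⇐ a<b r = Below⇒Inv-fromIdeal a<b (_ , _ , ℕ.≤-refl , ℕ.≤-refl , r)

        Inv-fromIdeal⇒ : Ideal R → ∀ {a b} → Inv fromIdeal a b → R a b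
        Inv-fromIdeal⇒ ideal inv@(a<b , _) with Inv-fromIdeal⇒Below inv
        ... | x , y , a≤x , b≤y , r = ideal r a≤x b≤y a<b

-- The weak order on unimodal permutations as a graded poset.

module UnimodalWeakOrder where

  open import Defs
  open import Data.Fin.Base using (Fin; zero; suc; toℕ; _<_; _≤_)
  open import Data.Fin.Permutation using (Permutation′; reverse; _⟨$⟩ʳ_; inverseˡ; inverseʳ) renaming (_≈_ to _≈ₚ_; id to idₚ)
  open import Data.Fin.Properties using (_≟_; any?; all?; <-asym; toℕ-injective)
  open import Data.Nat.Base as ℕ using (ℕ; zero; suc; z≤n; s≤s)
  import Data.Nat.Properties as ℕ
  open import Data.Product.Base using (_×_; _,_; proj₁; ∃; ∃₂)
  open import Data.Sum.Base using (_⊎_; inj₁; inj₂)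
  open import Function.Base using (_∘_)
  open import Function.Bundles using (mk⇔)
  open import Relation.Binary.Core using (Rel)
  open import Relation.Binary.Definitions using (Decidable)
  open import Relation.Binary.Structures using (IsEquivalence)
  open import Relation.Binary.PropositionalEquality using (_≡_; refl; sym; trans; cong; subst; subst₂)
  open import Relation.Nullary.Decidable using (Dec; yes; no; _×-dec_; ¬?; map′)
  open import Relation.Nullary.Negation using (¬_; contradiction)
  open import Relation.Unary using (Pred)
  import Relation.Unary as U
  open import Level using (0ℓ)
  open GradedPosets
  open Inversions
  open UnimodalPermutations

  module _ {n : ℕ} where

    Invᵁ : 𝒰 n → Rel (Fin n) 0ℓ
    Invᵁ x = Inv (perm x)

    invᵁ? : ∀ x → Decidable (Invᵁ x)
    invᵁ? x = inv? (perm x)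

    opaque
      rankᵁ : 𝒰 n → ℕ
      rankᵁ x = ℓ (perm x)

      rankᵁ≡count : ∀ x → rankᵁ x ≡ count₂ (invᵁ? x)
      rankᵁ≡count x = ℓ≡count (perm x)

      rankᵁ-mono : ∀ (x y : 𝒰 n) → x ≤ᵁ y → rankᵁ x ℕ.≤ rankᵁ y
      rankᵁ-mono x y p = subst (rankᵁ x ℕ.≤_) p (ℕ.m≤m+n _ _)

    ≤ᵁ⇒⊆ : ∀ {x y : 𝒰 n} → x ≤ᵁ y → ∀ {a b} → Invᵁ x a b → Invᵁ y a b
    ≤ᵁ⇒⊆ {x} {y} = ≤ᵂ⇒⊆ (perm x) (perm y)

    ⊆⇒≤ᵁ : ∀ {x y : 𝒰 n} → (∀ {a b} → Invᵁ x a b → Invᵁ y a b) → x ≤ᵁ y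
    ⊆⇒≤ᵁ {x} {y} = ⊆⇒≤ᵂ (perm x) (perm y)

    fromIdealᵁ : {R : Rel (Fin n) 0ℓ} → Decidable R → 𝒰 n
    fromIdealᵁ R? .perm = fromIdeal R?
    fromIdealᵁ R? .unimodal = unimodal⇐ (fromIdeal R?) (inj₁ λ {a} {b} → fromIdeal-ideal R? {a} {b})

    conjᵁ : 𝒰 n → 𝒰 n
    conjᵁ x .perm = conj (perm x)
    conjᵁ x .unimodal with unimodal⇒ (perm x) (unimodal x)
    ... | inj₁ i = unimodal⇐ (conj (perm x)) (inj₂ λ {a} {b} → conj-ideal (perm x) i {a} {b})
    ... | inj₂ f = unimodal⇐ (conj (perm x)) (inj₁ λ {a} {b} → conj-filter (perm x) f {a} {b})

    ≈ᵁ-isEquivalence : IsEquivalence (_≈ᵁ_ {n})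
    ≈ᵁ-isEquivalence = record
      { refl = λ _ → refl ; sym = λ e i → sym (e i) ; trans = λ e f i → trans (e i) (f i) }

    _≈ᵁ?_ : Decidable (_≈ᵁ_ {n})
    x ≈ᵁ? y = all? λ i → perm x ⟨$⟩ʳ i ≟ perm y ⟨$⟩ʳ i

    Inv-resp : ∀ {π τ : Permutation′ n} → π ≈ₚ τ → ∀ {a b} → Inv π a b → Inv τ a b
    Inv-resp {π} {τ} π≈τ (a<b , lt) = a<b , subst₂ _<_ (pos≡ _) (pos≡ _) lt
      where
      pos≡ : ∀ v → pos π v ≡ pos τ v
      pos≡ v = trans (sym (inverseˡ τ)) (cong (pos τ) (trans (sym (π≈τ (pos π v))) (inverseʳ π)))

    ≤ᵁ-reflexive : ∀ (x y : 𝒰 n) → x ≈ᵁ y → x ≤ᵁ y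
    ≤ᵁ-reflexive x y x≈y = ⊆⇒≤ᵁ {x} {y} (Inv-resp {perm x} {perm y} x≈y)

    ≤ᵁ-trans : ∀ (x y z : 𝒰 n) → x ≤ᵁ y → y ≤ᵁ z → x ≤ᵁ z
    ≤ᵁ-trans x y z p q = ⊆⇒≤ᵁ {x} {z} (≤ᵁ⇒⊆ {y} {z} q ∘ ≤ᵁ⇒⊆ {x} {y} p)

    rankᵁ-≈ : ∀ (x y : 𝒰 n) → x ≤ᵁ y → rankᵁ x ≡ rankᵁ y → x ≈ᵁ y
    rankᵁ-≈ x y p eq = Inv-injective {π = perm x} {perm y} (≤ᵁ⇒⊆ {x} {y} p)
      (count₂-≡⇒⊇ (invᵁ? x) (invᵁ? y) (≤ᵁ⇒⊆ {x} {y} p) (trans (sym (rankᵁ≡count x)) (trans eq (rankᵁ≡count y))))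

    ⊥ᵁ ⊤ᵁ : 𝒰 n
    ⊥ᵁ .perm = idₚ
    ⊥ᵁ .unimodal = unimodal⇐ idₚ (inj₁ λ (p , q) → contradiction p (<-asym q))
    ⊤ᵁ .perm = reverse
    ⊤ᵁ .unimodal = unimodal⇐ reverse (inj₁ λ _ _ _ x<y → x<y , opposite-anti x<y)

    ⊥ᵁ-min : ∀ x → ⊥ᵁ ≤ᵁ x
    ⊥ᵁ-min x = ⊆⇒≤ᵁ {⊥ᵁ} {x} λ (p , q) → contradiction p (<-asym q)

    ⊤ᵁ-max : ∀ x → x ≤ᵁ ⊤ᵁ
    ⊤ᵁ-max x = ⊆⇒≤ᵁ {x} {⊤ᵁ} λ (p , q) → p , opposite-anti p

    rank-⊥ᵁ : rankᵁ ⊥ᵁ ≡ 0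
    rank-⊥ᵁ = trans (rankᵁ≡count ⊥ᵁ) (trans (count₂-def (invᵁ? ⊥ᵁ))
      (sum-zero {n} λ a → sum-zero {n} λ b → ι-no (invᵁ? ⊥ᵁ a b) λ (p , q) → <-asym p q))

    opaque
      unfolding rankᵁ

      rankᵁ-conj : ∀ x → rankᵁ (conjᵁ x) ≡ rankᵁ x
      rankᵁ-conj x = ℓ-conj (perm x)

    -- A side and a box: on side `zero` the box is added to the inversions directly, on the other
    -- side after conjugation.
    Index : Set
    Index = Fin 2 × Fin n × Fin n

    any-index? : ∀ {P : Pred Index 0ℓ} → U.Decidable P → Dec (∃ P)
    any-index? P? = map′ (λ (s , a , b , p) → (s , a , b) , p) (λ ((s , a , b) , p) → s , a , b , p)
                         (any? λ s → any? λ a → any? λ b → P? (s , a , b))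

    private
      coverLeft : 𝒰 n → Fin n → Fin n → 𝒰 n
      coverLeft x a b = fromIdealᵁ (insert? (invᵁ? x) a b)

    coverᵁ : 𝒰 n → Index → 𝒰 n
    coverᵁ x (zero  , a , b) = coverLeft x a b
    coverᵁ x (suc _ , a , b) = conjᵁ (coverLeft (conjᵁ x) a b)

    Between : 𝒰 n → 𝒰 n → 𝒰 n → Set
    Between x z y = x ≤ᵁ z × z ≤ᵁ y × rankᵁ z ≡ suc (rankᵁ x)

    -- Conjugation permutes the boxes, so it preserves inclusion of inversion sets although it
    -- reverses the order of the boxes themselves.
    conj-anti : ∀ {x y : 𝒰 n} → x ≤ᵁ y → conjᵁ x ≤ᵁ conjᵁ y
    conj-anti {x} {y} p = ⊆⇒≤ᵁ {conjᵁ x} {conjᵁ y} λ i → Inv-conj (perm y) (≤ᵁ⇒⊆ {x} {y} p (Inv-conj⁻ (perm x) i))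

    -- Lexicographic minimality, row first. The lexicographic order extends the coordinatewise one,
    -- so the pair is minimal in Δₙ too.
    minimal-pair : ∀ {R : Rel (Fin n) 0ℓ} → Decidable R → ∃₂ R →
                   ∃₂ λ a b → R a b × (∀ {u v} → R u v → a ≤ u) × (∀ {v} → R a v → b ≤ v)
    minimal-pair R? found =
      let a , row , a-min = least (λ a → any? (R? a)) found
          b , ab , b-min = least (R? a) row
      in a , b , ab , (λ {u} {v} uv → a-min u (v , uv)) , λ {v} → b-min v

    module _ {x y : 𝒰 n} (ideal-x : Ideal (Invᵁ x)) (ideal-y : Ideal (Invᵁ y)) (x⊆y : ∀ {a b} → Invᵁ x a b → Invᵁ y a b)
             {a b : Fin n} (ab∈y : Invᵁ y a b) (ab∉x : ¬ Invᵁ x a b)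
             (a-min : ∀ {u v} → Invᵁ y u v × ¬ Invᵁ x u v → a ≤ u) (b-min : ∀ {v} → Invᵁ y a v × ¬ Invᵁ x a v → b ≤ v) where
      private
        z : 𝒰 n
        z = coverLeft x a b

        old : ∀ {u v} → Invᵁ y u v → u < a ⊎ (u ≡ a × v < b) → Invᵁ x u v
        old {u} {v} uv small with invᵁ? x u v
        ... | yes uv∈x = uv∈x
        old {u} {v} uv (inj₁ u<a) | no uv∉x = contradiction (a-min (uv , uv∉x)) (ℕ.<⇒≱ u<a)
        old {u} {v} uv (inj₂ (refl , v<b)) | no uv∉x = contradiction (b-min (uv , uv∉x)) (ℕ.<⇒≱ v<b)

        -- A box weakly above and to the left of `(a , b)`, other than `(a , b)` itself, lies in `y`
        -- because `y` is an ideal, and precedes `(a , b)` lexicographically; hence it is already in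
        -- `x`.
        insert-ideal : Ideal (Insert (invᵁ? x) a b)
        insert-ideal (inj₁ uv) u′≤u v′≤v u′<v′ = inj₁ (ideal-x uv u′≤u v′≤v u′<v′)
        insert-ideal {x = u′} {y = v′} (inj₂ (refl , refl)) u′≤a v′≤b u′<v′
          with ℕ.m≤n⇒m<n∨m≡n u′≤a | ℕ.m≤n⇒m<n∨m≡n v′≤b
        ... | inj₁ u′<a | _ = inj₁ (old (ideal-y ab∈y u′≤a v′≤b u′<v′) (inj₁ u′<a))
        ... | inj₂ u′≡a | inj₁ v′<b = inj₁ (old (ideal-y ab∈y u′≤a v′≤b u′<v′) (inj₂ (toℕ-injective u′≡a , v′<b)))
        ... | inj₂ u′≡a | inj₂ v′≡b = inj₂ (toℕ-injective u′≡a , toℕ-injective v′≡b)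

        z⇒ : ∀ {u v} → Invᵁ z u v → Insert (invᵁ? x) a b u v
        z⇒ = Inv-fromIdeal⇒ (insert? (invᵁ? x) a b) insert-ideal

        z⇐ : ∀ {u v} → Insert (invᵁ? x) a b u v → Invᵁ z u v
        z⇐ (inj₁ uv) = Inv-fromIdeal⇐ (insert? (invᵁ? x) a b) (proj₁ uv) (inj₁ uv)
        z⇐ (inj₂ (refl , refl)) = Inv-fromIdeal⇐ (insert? (invᵁ? x) a b) (proj₁ ab∈y) (inj₂ (refl , refl))

        insert⊆y : ∀ {u v} → Insert (invᵁ? x) a b u v → Invᵁ y u v
        insert⊆y (inj₁ uv) = x⊆y uv
        insert⊆y (inj₂ (refl , refl)) = ab∈y

        rank-z : rankᵁ z ≡ suc (rankᵁ x)
        rank-z = trans (rankᵁ≡count z) (trans (count₂-⇔ (invᵁ? z) (insert? (invᵁ? x) a b) (λ u v → mk⇔ z⇒ z⇐))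
                   (trans (count₂-insert (invᵁ? x) a b ab∉x) (cong suc (sym (rankᵁ≡count x)))))

      coverLeft-between : Between x (coverLeft x a b) y
      coverLeft-between = ⊆⇒≤ᵁ {x} {z} (λ uv → z⇐ (inj₁ uv)) , ⊆⇒≤ᵁ {z} {y} (λ uv → insert⊆y (z⇒ uv)) , rank-z

    interpolate-ideal : ∀ {x y : 𝒰 n} → Ideal (Invᵁ x) → Ideal (Invᵁ y) → x ≤ᵁ y → rankᵁ x ℕ.< rankᵁ y →
                        ∃₂ λ a b → Between x (coverLeft x a b) y
    interpolate-ideal {x} {y} ideal-x ideal-y x≤y lt =
      let x⊆y = ≤ᵁ⇒⊆ {x} {y} x≤y
          a , b , (ab∈y , ab∉x) , a-min , b-min = minimal-pair {λ a b → Invᵁ y a b × ¬ Invᵁ x a b} (λ a b → invᵁ? y a b ×-dec ¬? (invᵁ? x a b))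
            (count₂-<⇒∃ (invᵁ? x) (invᵁ? y) x⊆y (subst₂ ℕ._<_ (rankᵁ≡count x) (rankᵁ≡count y) lt))
      in a , b , coverLeft-between {x} {y} ideal-x ideal-y x⊆y ab∈y ab∉x a-min b-min

    ≈-conj² : ∀ x → x ≈ᵁ conjᵁ (conjᵁ x)
    ≈-conj² x i = sym (conj-involutive (perm x) i)

    conj²-≈ : ∀ x → conjᵁ (conjᵁ x) ≈ᵁ x
    conj²-≈ x = conj-involutive (perm x)

    conj-between : ∀ {x y z : 𝒰 n} → Between (conjᵁ x) z (conjᵁ y) → Between x (conjᵁ z) y
    conj-between {x} {y} {z} (x≤z , z≤y , rank-z) =
        ≤ᵁ-trans x (conjᵁ (conjᵁ x)) (conjᵁ z) (≤ᵁ-reflexive x (conjᵁ (conjᵁ x)) (≈-conj² x)) (conj-anti {conjᵁ x} {z} x≤z)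
      , ≤ᵁ-trans (conjᵁ z) (conjᵁ (conjᵁ y)) y (conj-anti {z} {conjᵁ y} z≤y) (≤ᵁ-reflexive (conjᵁ (conjᵁ y)) y (conj²-≈ y))
      , trans (rankᵁ-conj z) (trans rank-z (cong suc (rankᵁ-conj x)))

    interpolate-filter : ∀ {x y : 𝒰 n} → Filter (Invᵁ x) → Filter (Invᵁ y) → x ≤ᵁ y → rankᵁ x ℕ.< rankᵁ y →
                         ∃₂ λ a b → Between x (conjᵁ (coverLeft (conjᵁ x) a b)) y
    interpolate-filter {x} {y} filter-x filter-y x≤y lt =
      let a , b , between = interpolate-ideal {conjᵁ x} {conjᵁ y} (conj-filter (perm x) filter-x) (conj-filter (perm y) filter-y)
                              (conj-anti {x} {y} x≤y) (subst₂ ℕ._<_ (sym (rankᵁ-conj x)) (sym (rankᵁ-conj y)) lt)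
      in a , b , conj-between {x} {y} {coverLeft (conjᵁ x) a b} between

  -- n stays a variable here (with named corner values instead of literals), as
  -- otherwise ℓ unfolds over allFin.
  module WeakU {n : ℕ} (v₀ v₁ : Fin n) (toℕ-v₀ : toℕ v₀ ≡ 0) (toℕ-v₁ : toℕ v₁ ≡ 1) where

    private
      v₀-min : ∀ (a : Fin n) → v₀ ≤ a
      v₀-min a = subst (ℕ._≤ toℕ a) (sym toℕ-v₀) z≤n

      v₁-min : ∀ {a b : Fin n} → a < b → v₁ ≤ b
      v₁-min {a} {b} a<b = subst (ℕ._≤ toℕ b) (sym toℕ-v₁) (ℕ.≤-trans (s≤s z≤n) a<b)

      v₀<v₁ : v₀ < v₁
      v₀<v₁ = subst₂ ℕ._<_ (sym toℕ-v₀) (sym toℕ-v₁) (s≤s z≤n)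

    ideal-corner : ∀ {R : Rel (Fin n) 0ℓ} → Ideal R → ∀ {a b} → a < b → R a b → R v₀ v₁
    ideal-corner ideal {a} {b} a<b r = ideal r (v₀-min a) (v₁-min {a} a<b) v₀<v₁

    filter-corner : ∀ {R : Rel (Fin n) 0ℓ} → Filter R → R v₀ v₁ → ∀ {a b} → a < b → R a b
    filter-corner filter r {a} {b} a<b = filter r (v₀-min a) (v₁-min {a} a<b) a<b

    private
      -- `(v₀ , v₁)` is the least box. If `x` contains it, so does `y`, and a filter with the least
      -- box is everything; if not, the ideal of `x` is empty.
      ideal≤filter : ∀ {x y : 𝒰 n} → x ≤ᵁ y → Ideal (Invᵁ x) → Filter (Invᵁ y) → Filter (Invᵁ x) ⊎ Ideal (Invᵁ y)
      ideal≤filter {x} {y} x≤y ideal filter with invᵁ? x v₀ v₁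
      ... | yes corner = inj₂ λ {_} {_} {u} {v} _ _ _ u<v → filter-corner {Invᵁ y} filter (≤ᵁ⇒⊆ {x = x} {y} x≤y corner) u<v
      ... | no ¬corner = inj₁ λ uv _ _ _ → contradiction (ideal-corner {Invᵁ x} ideal (proj₁ uv) uv) ¬corner

    uniform : ∀ {x y : 𝒰 n} → x ≤ᵁ y → (Ideal (Invᵁ x) × Ideal (Invᵁ y)) ⊎ (Filter (Invᵁ x) × Filter (Invᵁ y))
    uniform {x} {y} x≤y = go (unimodal⇒ (perm x) (unimodal x)) (unimodal⇒ (perm y) (unimodal y))
      where
      back : ∀ z → Filter (Invᵁ (conjᵁ z)) → Ideal (Invᵁ z)
      back z f {a} {b} {u} {v} ab u≤a v≤b u<v = Inv-resp {π = conj (conj (perm z))} {perm z} (conj-involutive (perm z))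
        (conj-filter (conj (perm z)) f (Inv-resp {π = perm z} {conj (conj (perm z))} (λ i → sym (conj-involutive (perm z) i)) ab) u≤a v≤b u<v)
      back′ : ∀ z → Ideal (Invᵁ (conjᵁ z)) → Filter (Invᵁ z)
      back′ z f {a} {b} {u} {v} ab a≤u b≤v u<v = Inv-resp {π = conj (conj (perm z))} {perm z} (conj-involutive (perm z))
        (conj-ideal (conj (perm z)) f (Inv-resp {π = perm z} {conj (conj (perm z))} (λ i → sym (conj-involutive (perm z) i)) ab) a≤u b≤v u<v)
      go : Ideal (Invᵁ x) ⊎ Filter (Invᵁ x) → Ideal (Invᵁ y) ⊎ Filter (Invᵁ y) → (Ideal (Invᵁ x) × Ideal (Invᵁ y)) ⊎ (Filter (Invᵁ x) × Filter (Invᵁ y))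
      go (inj₁ i) (inj₁ j) = inj₁ (i , j)
      go (inj₂ f) (inj₂ g) = inj₂ (f , g)
      go (inj₁ i) (inj₂ g) with ideal≤filter {x} {y} x≤y i g
      ... | inj₁ f = inj₂ (f , g)
      ... | inj₂ j = inj₁ (i , j)
      -- Conjugation keeps `x ≤ᵁ y` while making `x` the ideal and `y` the filter, which reduces
      -- this to the previous case.
      go (inj₂ f) (inj₁ j) with ideal≤filter {conjᵁ x} {conjᵁ y} (conj-anti {x = x} {y} x≤y) (conj-filter (perm x) f) (conj-ideal (perm y) j)
      ... | inj₁ i = inj₁ (back x i , j)
      ... | inj₂ g = inj₂ (f , back′ y g)

    interpolateᵁ : ∀ (x y : 𝒰 n) → x ≤ᵁ y → rankᵁ x ℕ.< rankᵁ y → ∃ λ i → Between x (coverᵁ x i) y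
    interpolateᵁ x y x≤y lt with uniform {x} {y} x≤y
    ... | inj₁ (i , j) = let a , b , between = interpolate-ideal {x = x} {y} i j x≤y lt in (zero , a , b) , between
    ... | inj₂ (f , g) = let a , b , between = interpolate-filter {x = x} {y} f g x≤y lt in (suc zero , a , b) , between

    open GradedPoset (_≈ᵁ_ {n}) _≤ᵁ_ ≈ᵁ-isEquivalence _≈ᵁ?_ ≤ᵁ-reflexive ≤ᵁ-trans rankᵁ rankᵁ-mono rankᵁ-≈
      ⊥ᵁ ⊤ᵁ ⊥ᵁ-min ⊤ᵁ-max (rank-⊥ᵁ {n}) any-index? coverᵁ interpolateᵁ public

-- Tableaux on sets of pairs of natural numbers, with entries counted from 0.

module Tableaux where

  open import Defs
  open import Data.Fin.Base using (Fin; zero; suc; toℕ; fromℕ<; _<_; _≤_)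
  open import Data.Fin.Properties using (_<?_; toℕ-fromℕ<; fromℕ<-toℕ; toℕ<n)
  open import Data.Nat.Base as ℕ using (ℕ; zero; suc; z≤n)
  import Data.Nat.Properties as ℕ
  open import Data.Product.Base using (_×_; _,_; ∃₂)
  open import Data.Sum.Base using (inj₁; inj₂)
  open import Relation.Binary.Bundles using (Setoid)
  open import Relation.Binary.PropositionalEquality using (_≡_; refl; sym; trans; cong; cong₂; subst; subst₂)
  open import Relation.Nullary.Decidable using (Dec; yes; no)
  open import Relation.Nullary.Negation using (¬_; contradiction)
  open import Level using (0ℓ)

  -- e is only meaningful on the boxes in M, and only compared there.
  record Tableau (M : ℕ → ℕ → Set) (K : ℕ) : Set where
    field
      e     : ℕ → ℕ → ℕ
      bound : ∀ {i j} → M i j → e i j ℕ.< K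
      inj   : ∀ {i j k l} → M i j → M k l → e i j ≡ e k l → i ≡ k × j ≡ l
      surj  : ∀ {k} → k ℕ.< K → ∃₂ λ i j → M i j × e i j ≡ k
      row   : ∀ {i j k} → M i j → M i k → j ℕ.< k → e i j ℕ.< e i k
      col   : ∀ {i j k} → M i k → M j k → i ℕ.< j → e i k ℕ.< e j k

  open Tableau public

  tableaux : (ℕ → ℕ → Set) → ℕ → Setoid 0ℓ 0ℓ
  tableaux M K = record
    { Carrier = Tableau M K
    ; _≈_ = λ S T → ∀ {i j} → M i j → e S i j ≡ e T i j
    ; isEquivalence = record
      { refl = λ _ → refl ; sym = λ p m → sym (p m) ; trans = λ p q m → trans (p m) (q m) }
    }

  Triangle : ℕ → ℕ → ℕ → Set
  Triangle n i j = i ℕ.< j × j ℕ.< n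

  -- A strictly increasing sequence of naturals satisfies `k ≤ f k`; conversely, each step down from
  -- `f K ≤ K` loses at least one, which gives `f k ≤ k`.
  squeeze : ∀ (f : ℕ → ℕ) K → (∀ {k} → k ℕ.< K → f k ℕ.< f (suc k)) → f K ℕ.≤ K → ∀ {k} → k ℕ.≤ K → f k ≡ k
  squeeze f K inc f≤ k≤K = ℕ.≤-antisym (upper K k≤K f≤ inc) (lower _ k≤K)
    where
    lower : ∀ k → k ℕ.≤ K → k ℕ.≤ f k
    lower zero _ = z≤n
    lower (suc k) k<K = ℕ.≤-<-trans (lower k (ℕ.<⇒≤ k<K)) (inc k<K)
    upper : ∀ K {k} → k ℕ.≤ K → f K ℕ.≤ K → (∀ {k} → k ℕ.< K → f k ℕ.< f (suc k)) → f k ℕ.≤ k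
    upper K {k} k≤K f≤ inc with ℕ.m≤n⇒m<n∨m≡n k≤K
    ... | inj₂ refl = f≤
    upper (suc K) k≤K f≤ inc | inj₁ k<1+K =
      upper K (ℕ.s≤s⁻¹ k<1+K) (ℕ.s≤s⁻¹ (ℕ.≤-trans (inc ℕ.≤-refl) f≤)) (λ k<K → inc (ℕ.m<n⇒m<1+n k<K))

  -- The last k < K with ¬ P k, or 0 if there is none.
  module _ {P : ℕ → Set} (P? : ∀ k → Dec (P k)) where

    threshold : ℕ → ℕ
    threshold zero = zero
    threshold (suc k) with P? k
    ... | yes _ = threshold k
    ... | no _  = k

    threshold-spec : ∀ K → ¬ P 0 → P K → threshold K ℕ.< K × ¬ P (threshold K) × P (suc (threshold K))
    threshold-spec zero ¬P0 PK = contradiction PK ¬P0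
    threshold-spec (suc K) ¬P0 PK with P? K
    ... | yes PK′ = let lt , ¬p , p = threshold-spec K ¬P0 PK′ in ℕ.m<n⇒m<1+n lt , ¬p , p
    ... | no ¬PK′ = ℕ.≤-refl , ¬PK′ , PK

  module _ {n : ℕ} where

    extend : (Fin n → Fin n → ℕ) → ℕ → ℕ → ℕ
    extend f i j with i ℕ.<? n | j ℕ.<? n
    ... | yes i<n | yes j<n = f (fromℕ< i<n) (fromℕ< j<n)
    ... | _ | _ = 0

    extend-toℕ : ∀ f a b → extend f (toℕ a) (toℕ b) ≡ f a b
    extend-toℕ f a b with toℕ a ℕ.<? n | toℕ b ℕ.<? n
    ... | yes a<n | yes b<n = cong₂ f (fromℕ<-toℕ a a<n) (fromℕ<-toℕ b b<n)
    ... | no a≮n | _ = contradiction (toℕ<n a) a≮n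
    ... | yes _ | no b≮n = contradiction (toℕ<n b) b≮n

    -- The view through which a pair of numbers in the triangle is read as a pair of values.
    data Fins : ℕ → ℕ → Set where
      fins : ∀ {a b : Fin n} → a < b → Fins (toℕ a) (toℕ b)

    triangle-fins : ∀ {i j} → Triangle n i j → Fins i j
    triangle-fins (i<j , j<n) = subst₂ Fins (toℕ-fromℕ< i<n) (toℕ-fromℕ< j<n)
      (fins (subst₂ ℕ._<_ (sym (toℕ-fromℕ< i<n)) (sym (toℕ-fromℕ< j<n)) i<j))
      where i<n = ℕ.<-trans i<j j<n

    module _ {K : ℕ} (f : Fin n → Fin n → ℕ)
      (f-bound : ∀ {a b} → a < b → f a b ℕ.< K)
      (f-inj   : ∀ {a b c d} → a < b → c < d → f a b ≡ f c d → a ≡ c × b ≡ d)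
      (f-surj  : ∀ {k} → k ℕ.< K → ∃₂ λ a b → a < b × f a b ≡ k)
      (f-row   : ∀ {a b c} → a < b → a < c → b < c → f a b ℕ.< f a c)
      (f-col   : ∀ {a b c} → a < c → b < c → a < b → f a c ℕ.< f b c) where

      fromFins : Tableau (Triangle n) K
      fromFins .e = extend f
      fromFins .bound m with triangle-fins m
      ... | fins {a} {b} a<b = subst (ℕ._< K) (sym (extend-toℕ f a b)) (f-bound a<b)
      fromFins .inj m m′ eq with triangle-fins m | triangle-fins m′
      ... | fins {a} {b} a<b | fins {c} {d} c<d =
        let p , q = f-inj a<b c<d (trans (sym (extend-toℕ f a b)) (trans eq (extend-toℕ f c d))) in cong toℕ p , cong toℕ q
      fromFins .surj k<K = let a , b , a<b , eq = f-surj k<K in toℕ a , toℕ b , (a<b , toℕ<n b) , trans (extend-toℕ f a b) eq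
      fromFins .row {i} {j} {k} (i<j , j<n) (i<k , k<n) j<k = subst₃ (i<j) (i<k) j<k
        where
        i<n = ℕ.<-trans i<j j<n
        a = fromℕ< i<n
        b = fromℕ< j<n
        c = fromℕ< k<n
        ai = toℕ-fromℕ< i<n
        bj = toℕ-fromℕ< j<n
        ck = toℕ-fromℕ< k<n
        subst₃ : i ℕ.< j → i ℕ.< k → j ℕ.< k → extend f i j ℕ.< extend f i k
        subst₃ p q r = subst₂ ℕ._<_ (trans (sym (extend-toℕ f a b)) (cong₂ (extend f) ai bj)) (trans (sym (extend-toℕ f a c)) (cong₂ (extend f) ai ck))
          (f-row (subst₂ ℕ._<_ (sym ai) (sym bj) p) (subst₂ ℕ._<_ (sym ai) (sym ck) q) (subst₂ ℕ._<_ (sym bj) (sym ck) r))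
      fromFins .col {i} {j} {k} (i<k , k<n) (j<k , _) i<j =
        subst₂ ℕ._<_ (trans (sym (extend-toℕ f a c)) (cong₂ (extend f) ai ck)) (trans (sym (extend-toℕ f b c)) (cong₂ (extend f) bj ck))
          (f-col (subst₂ ℕ._<_ (sym ai) (sym ck) i<k) (subst₂ ℕ._<_ (sym bj) (sym ck) j<k) (subst₂ ℕ._<_ (sym ai) (sym bj) i<j))
        where
        i<n = ℕ.<-trans i<k k<n
        j<n = ℕ.<-trans j<k k<n
        a = fromℕ< i<n
        b = fromℕ< j<n
        c = fromℕ< k<n
        ai = toℕ-fromℕ< i<n
        bj = toℕ-fromℕ< j<n
        ck = toℕ-fromℕ< k<n

-- Paths through ideals as tableaux, and the two sides of the poset.

module ChainsAndTableaux where

  open import Defs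
  open import Data.Fin.Base using (Fin; zero; suc; toℕ; opposite; _<_; _≤_)
  open import Data.Fin.Properties using (_<?_; <-asym; <-irrefl; toℕ<n; opposite-involutive)
  open import Data.Nat.Base as ℕ using (ℕ; zero; suc; z≤n; s≤s)
  import Data.Nat.Properties as ℕ
  open import Data.Product.Base using (_×_; _,_; proj₁; proj₂; ∃; ∃₂)
  open import Data.Sum.Base using (_⊎_; inj₁; inj₂)
  open import Function.Base using (id)
  open import Function.Bundles using (mk⇔; Inverse)
  open import Relation.Binary.Bundles using (Setoid)
  import Relation.Binary.Construct.On as On
  open import Relation.Binary.Core using (Rel)
  open import Relation.Binary.Definitions using (Decidable)
  open import Relation.Binary.PropositionalEquality using (_≡_; _≢_; refl; sym; trans; cong; subst; subst₂)
  open import Relation.Nullary.Decidable using (Dec; yes; no; _×-dec_)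
  open import Relation.Nullary.Negation using (¬_; contradiction)
  open import Level using (0ℓ)
  open Cardinality
  open Inversions
  open UnimodalPermutations
  open UnimodalWeakOrder

  open GradedPosets
  open Tableaux

  module ChainCount {n : ℕ} (v₀ v₁ : Fin n) (toℕ-v₀ : toℕ v₀ ≡ 0) (toℕ-v₁ : toℕ v₁ ≡ 1) (opposite-v₁≢v₀ : opposite v₁ ≢ v₀) where

    open WeakU v₀ v₁ toℕ-v₀ toℕ-v₁

    private
      K : ℕ
      K = height

      v₀<v₁ : v₀ < v₁
      v₀<v₁ = subst₂ ℕ._<_ (sym toℕ-v₀) (sym toℕ-v₁) (s≤s z≤n)

      count-⊥ : count₂ (invᵁ? {n} ⊥ᵁ) ≡ 0
      count-⊥ = trans (sym (rankᵁ≡count ⊥ᵁ)) (rank-⊥ᵁ {n})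

      ¬Inv-⊥ : ∀ {a b : Fin n} → ¬ Invᵁ ⊥ᵁ a b
      ¬Inv-⊥ (p , q) = <-asym p q

      0<K : 0 ℕ.< K
      0<K = subst₂ ℕ._<_ count-⊥ (sym (rankᵁ≡count ⊤ᵁ))
              (count₂-∃⇒< (invᵁ? ⊥ᵁ) (invᵁ? ⊤ᵁ) (λ i → contradiction i ¬Inv-⊥) {v₀} {v₁} (v₀<v₁ , opposite-anti v₀<v₁) ¬Inv-⊥)

    module Path (p : GradedPath) where

      at-count : ∀ {k} → k ℕ.≤ K → count₂ (invᵁ? (at p k)) ≡ k
      at-count k≤K = trans (sym (rankᵁ≡count (at p _))) (rank-at p k≤K)

      at-⊆ : ∀ {j k} → j ℕ.≤ k → k ℕ.≤ K → ∀ {a b} → Invᵁ (at p j) a b → Invᵁ (at p k) a b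
      at-⊆ {j} {k} j≤k k≤K = ≤ᵁ⇒⊆ {x = at p j} {at p k} (at-mono p j≤k k≤K)

      at-empty : ∀ {a b} → ¬ Invᵁ (at p 0) a b
      at-empty i = ¬Inv-⊥ (count₂-≡⇒⊇ (invᵁ? ⊥ᵁ) (invᵁ? (at p 0)) (λ j → contradiction j ¬Inv-⊥) (trans count-⊥ (sym (at-count z≤n))) i)

      at-full : ∀ {a b} → a < b → Invᵁ (at p K) a b
      at-full a<b = count₂-≡⇒⊇ (invᵁ? (at p K)) (invᵁ? ⊤ᵁ) (≤ᵁ⇒⊆ {x = at p K} {⊤ᵁ} (⊤ᵁ-max (at p K)))
        (trans (at-count ℕ.≤-refl) (rankᵁ≡count ⊤ᵁ)) (a<b , opposite-anti a<b)

      -- The step, counted from 0, at which the box `(a , b)` joins the inversions; it becomes the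
      -- entry of that box.
      time : Fin n → Fin n → ℕ
      time a b = threshold (λ k → invᵁ? (at p k) a b) K

      time-spec : ∀ {a b} → a < b → time a b ℕ.< K × ¬ Invᵁ (at p (time a b)) a b × Invᵁ (at p (suc (time a b))) a b
      time-spec {a} {b} a<b = threshold-spec (λ k → invᵁ? (at p k) a b) K at-empty (at-full a<b)

      time<⇒ : ∀ {a b k} → a < b → k ℕ.≤ K → time a b ℕ.< k → Invᵁ (at p k) a b
      time<⇒ a<b k≤K t<k = at-⊆ t<k k≤K (proj₂ (proj₂ (time-spec a<b)))

      time<⇐ : ∀ {a b k} → k ℕ.≤ K → Invᵁ (at p k) a b → time a b ℕ.< k
      time<⇐ {a} {b} {k} k≤K i = ℕ.≰⇒> λ k≤t → proj₁ (proj₂ (time-spec (proj₁ i)))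
        (at-⊆ k≤t (ℕ.<⇒≤ (proj₁ (time-spec (proj₁ i)))) i)

      -- A step raises the number of inversions by exactly one, so a single box joins at it.
      time-unique : ∀ {a b c d} → a < b → c < d → time a b ≡ time c d → a ≡ c × b ≡ d
      time-unique {a} {b} {c} {d} a<b c<d eq with time-spec a<b | time-spec c<d
      ... | t<K , ¬i , i | _ , ¬j , j = count₂-suc-unique (invᵁ? (at p (time a b))) (invᵁ? (at p (suc (time a b)))) (at-⊆ (ℕ.n≤1+n _) t<K)
        (trans (at-count t<K) (cong suc (sym (at-count (ℕ.<⇒≤ t<K)))))
        i ¬i (subst (λ k → Invᵁ (at p (suc k)) c d) (sym eq) j) (subst (λ k → ¬ Invᵁ (at p k) c d) (sym eq) ¬j)

      time-surjective : ∀ {k} → k ℕ.< K → ∃₂ λ a b → a < b × time a b ≡ k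
      time-surjective {k} k<K with count₂-<⇒∃ (invᵁ? (at p k)) (invᵁ? (at p (suc k))) (at-⊆ (ℕ.n≤1+n k) k<K)
                                     (subst₂ ℕ._<_ (sym (at-count (ℕ.<⇒≤ k<K))) (sym (at-count k<K)) ℕ.≤-refl)
      ... | a , b , i , ¬i = a , b , proj₁ i , ℕ.≤-antisym (ℕ.s≤s⁻¹ (time<⇐ k<K i))
                               (ℕ.≮⇒≥ λ t<k → ¬i (time<⇒ (proj₁ i) (ℕ.<⇒≤ k<K) t<k))

      module Ideals (ideal : ∀ {k} → k ℕ.≤ K → Ideal (Invᵁ (at p k))) where

        -- The ideal reached once `(a , b)` has joined contains `(x , y)` too, so this box joined no
        -- later; being a different box, it did not join at the same step.
        time-mono : ∀ {a b x y} → a < b → x < y → x ≤ a → y ≤ b → ¬ (x ≡ a × y ≡ b) → time x y ℕ.< time a b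
        time-mono {a} {b} {x} {y} a<b x<y x≤a y≤b ≢ = ℕ.≤∧≢⇒<
          (ℕ.s≤s⁻¹ (time<⇐ (proj₁ (time-spec a<b)) (ideal (proj₁ (time-spec a<b)) (proj₂ (proj₂ (time-spec a<b))) x≤a y≤b x<y)))
          (λ eq → ≢ (time-unique x<y a<b eq))

        tableau : Tableau (Triangle n) K
        tableau = fromFins time (λ a<b → proj₁ (time-spec a<b)) time-unique time-surjective
          (λ a<b a<c b<c → time-mono a<c a<b ℕ.≤-refl (ℕ.<⇒≤ b<c) (λ { (_ , refl) → <-irrefl refl b<c }))
          (λ a<c b<c a<b → time-mono b<c a<c (ℕ.<⇒≤ a<b) ℕ.≤-refl (λ { (refl , _) → <-irrefl refl a<b }))

    module FromTableau (T : Tableau (Triangle n) K) where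

      Stage : ℕ → Rel (Fin n) 0ℓ
      Stage k a b = a < b × e T (toℕ a) (toℕ b) ℕ.< k

      stage? : ∀ k → Decidable (Stage k)
      stage? k a b = (a <? b) ×-dec (e T (toℕ a) (toℕ b) ℕ.<? k)

      stage-ideal : ∀ k → Ideal (Stage k)
      stage-ideal k {a} {b} {x} {y} (a<b , lt) x≤a y≤b x<y = x<y , ℕ.≤-<-trans (ℕ.≤-trans row≤ col≤) lt
        where
        x<b : x < b
        x<b = ℕ.<-≤-trans x<y y≤b
        row≤ : e T (toℕ x) (toℕ y) ℕ.≤ e T (toℕ x) (toℕ b)
        row≤ with ℕ.m≤n⇒m<n∨m≡n y≤b
        ... | inj₁ y<b = ℕ.<⇒≤ (row T (x<y , toℕ<n y) (x<b , toℕ<n b) y<b)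
        ... | inj₂ eq = ℕ.≤-reflexive (cong (e T (toℕ x)) eq)
        col≤ : e T (toℕ x) (toℕ b) ℕ.≤ e T (toℕ a) (toℕ b)
        col≤ with ℕ.m≤n⇒m<n∨m≡n x≤a
        ... | inj₁ x<a = ℕ.<⇒≤ (col T (x<b , toℕ<n b) (a<b , toℕ<n b) x<a)
        ... | inj₂ eq = ℕ.≤-reflexive (cong (λ i → e T i (toℕ b)) eq)

      stage : ℕ → 𝒰 n
      stage k = fromIdealᵁ (stage? k)

      stage⇒ : ∀ k {a b} → Invᵁ (stage k) a b → Stage k a b
      stage⇒ k = Inv-fromIdeal⇒ (stage? k) (stage-ideal k)

      stage⇐ : ∀ k {a b} → Stage k a b → Invᵁ (stage k) a b
      stage⇐ k s = Inv-fromIdeal⇐ (stage? k) (proj₁ s) s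

      stage-suc : ∀ k {a b} → Stage k a b → Stage (suc k) a b
      stage-suc k (a<b , lt) = a<b , ℕ.m<n⇒m<1+n lt

      -- Every number below `K` is the entry of some box, so the count grows at each step, and it
      -- ends at no more than the number `K` of all boxes. This leaves no slack.
      stage-count : ∀ {k} → k ℕ.≤ K → count₂ (stage? k) ≡ k
      stage-count = squeeze (λ k → count₂ (stage? k)) K inc
        (subst (count₂ (stage? K) ℕ.≤_) (sym (rankᵁ≡count ⊤ᵁ)) (count₂-mono (stage? K) (invᵁ? ⊤ᵁ) (λ (a<b , _) → a<b , opposite-anti a<b)))
        where
        inc : ∀ {k} → k ℕ.< K → count₂ (stage? k) ℕ.< count₂ (stage? (suc k))
        inc {k} k<K with surj T k<K
        ... | i , j , m , eq with triangle-fins m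
        ...   | fins {a} {b} a<b = count₂-∃⇒< (stage? k) (stage? (suc k)) (stage-suc k) {a} {b}
                  (a<b , ℕ.≤-reflexive (cong suc eq)) (λ (_ , lt) → ℕ.<⇒≢ lt eq)

      path : GradedPath
      path .at = stage
      path .rank-at {k} k≤K = trans (rankᵁ≡count (stage k))
        (trans (count₂-⇔ (invᵁ? (stage k)) (stage? k) (λ a b → mk⇔ (stage⇒ k) (stage⇐ k))) (stage-count k≤K))
      path .step {k} k<K = ⊆⇒≤ᵁ {x = stage k} {stage (suc k)} λ i → stage⇐ (suc k) (stage-suc k (stage⇒ k i))

      time≡e : ∀ {a b} → a < b → Path.time path a b ≡ e T (toℕ a) (toℕ b)
      time≡e {a} {b} a<b = ℕ.≤-antisym
        (ℕ.s≤s⁻¹ (Path.time<⇐ path e<K (stage⇐ _ (a<b , ℕ.≤-refl))))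
        (ℕ.s≤s⁻¹ (proj₂ (stage⇒ _ (proj₂ (proj₂ (Path.time-spec path a<b))))))
        where
        e<K : e T (toℕ a) (toℕ b) ℕ.< K
        e<K = bound T (a<b , toℕ<n b)

      corner∈stage : Invᵁ (stage 1) v₀ v₁
      corner∈stage with surj T 0<K
      ... | i , j , m , eq with triangle-fins m
      ...   | fins {a} {b} a<b = ideal-corner {R = Invᵁ (stage 1)} (fromIdeal-ideal (stage? 1)) a<b (stage⇐ 1 (a<b , ℕ.≤-reflexive (cong suc eq)))

    -- The first step adds the least box: these are the paths that run through ideals.
    leftPaths : Setoid 0ℓ 0ℓ
    leftPaths = On.setoid {B = ∃ λ p → Invᵁ (at p 1) v₀ v₁} gradedPaths proj₁

    -- From rank 1 on, every stage contains the least box, so a stage that is a filter is everything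
    -- and hence an ideal as well.
    left-ideal : (p : GradedPath) → Invᵁ (at p 1) v₀ v₁ → ∀ {k} → k ℕ.≤ K → Ideal (Invᵁ (at p k))
    left-ideal p corner {zero} _ i = contradiction i (Path.at-empty p)
    left-ideal p corner {suc k} k<K = go (unimodal⇒ (perm x) (unimodal x))
      where
      x = at p (suc k)
      go : Ideal (Invᵁ x) ⊎ Filter (Invᵁ x) → Ideal (Invᵁ x)
      go (inj₁ ideal) = ideal
      go (inj₂ filter) _ _ _ u<v = filter-corner {R = Invᵁ x} filter (Path.at-⊆ p {1} {suc k} (s≤s z≤n) k<K corner) u<v

    leftPaths↔tableaux : Inverse leftPaths (tableaux (Triangle n) K)
    leftPaths↔tableaux = mkInverse leftPaths (tableaux (Triangle n) K) to
      (λ {p} {q} eq m → to-cong p q eq m) (λ {p} {q} eq → to-inj p q eq) from to∘from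
      where
      to : (∃ λ p → Invᵁ (at p 1) v₀ v₁) → Tableau (Triangle n) K
      to (p , corner) = Path.Ideals.tableau p (left-ideal p corner)

      e-to : ∀ p {a b} → e (to p) (toℕ a) (toℕ b) ≡ Path.time (proj₁ p) a b
      e-to (p , _) = extend-toℕ (Path.time p) _ _

      to-cong : ∀ p q → (∀ {k} → k ℕ.≤ K → at (proj₁ p) k ≈ᵁ at (proj₁ q) k) → ∀ {i j} → Triangle n i j → e (to p) i j ≡ e (to q) i j
      to-cong pp@(p , _) qq@(q , _) eq m with triangle-fins m
      ... | fins {a} {b} a<b = trans (e-to pp) (trans (ℕ.≤-antisym (half q p λ k≤K i → sym (eq k≤K i)) (half p q eq)) (sym (e-to qq)))
        where
        half : ∀ p q → (∀ {k} → k ℕ.≤ K → at p k ≈ᵁ at q k) → Path.time q a b ℕ.≤ Path.time p a b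
        half p q eq = let t<K , _ , i = Path.time-spec p a<b
          in ℕ.s≤s⁻¹ (Path.time<⇐ q t<K (Inv-resp {π = perm (at p _)} {perm (at q _)} (eq t<K) i))

      to-inj : ∀ p q → (∀ {i j} → Triangle n i j → e (to p) i j ≡ e (to q) i j) → ∀ {k} → k ℕ.≤ K → at (proj₁ p) k ≈ᵁ at (proj₁ q) k
      to-inj pp@(p , _) qq@(q , _) eq {k} k≤K = Inv-injective {π = perm (at p k)} {perm (at q k)} (half p q time≡) (half q p (λ a<b → sym (time≡ a<b)))
        where
        time≡ : ∀ {a b} → a < b → Path.time p a b ≡ Path.time q a b
        time≡ {a} {b} a<b = trans (sym (e-to pp)) (trans (eq (a<b , toℕ<n b)) (e-to qq))
        half : ∀ p q → (∀ {a b} → a < b → Path.time p a b ≡ Path.time q a b) → ∀ {a b} → Invᵁ (at p k) a b → Invᵁ (at q k) a b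
        half p q time≡ i = Path.time<⇒ q (proj₁ i) k≤K (subst (ℕ._< k) (time≡ (proj₁ i)) (Path.time<⇐ p k≤K i))

      from : Tableau (Triangle n) K → ∃ λ p → Invᵁ (at p 1) v₀ v₁
      from T = FromTableau.path T , FromTableau.corner∈stage T

      to∘from : ∀ T {i j} → Triangle n i j → e (to (from T)) i j ≡ e T i j
      to∘from T m with triangle-fins m
      ... | fins a<b = trans (e-to (from T)) (FromTableau.time≡e T a<b)

    conjPath : GradedPath → GradedPath
    conjPath p .at k = conjᵁ (at p k)
    conjPath p .rank-at k≤K = trans (rankᵁ-conj (at p _)) (rank-at p k≤K)
    conjPath p .step {k} k<K = conj-anti {x = at p k} {at p (suc k)} (step p k<K)

    side : GradedPath → Fin 2
    side p with invᵁ? (at p 1) v₀ v₁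
    ... | yes _ = zero
    ... | no _  = suc zero

    side-zero : ∀ {p} → Invᵁ (at p 1) v₀ v₁ → side p ≡ zero
    side-zero {p} corner with invᵁ? (at p 1) v₀ v₁
    ... | yes _ = refl
    ... | no ¬corner = contradiction corner ¬corner

    side-one : ∀ {p} → ¬ Invᵁ (at p 1) v₀ v₁ → side p ≡ suc zero
    side-one {p} ¬corner with invᵁ? (at p 1) v₀ v₁
    ... | yes corner = contradiction corner ¬corner
    ... | no _ = refl

    side-zero⁻ : ∀ {p} → side p ≡ zero → Invᵁ (at p 1) v₀ v₁
    side-zero⁻ {p} eq with invᵁ? (at p 1) v₀ v₁
    ... | yes corner = corner

    side-one⁻ : ∀ {p} → side p ≡ suc zero → ¬ Invᵁ (at p 1) v₀ v₁
    side-one⁻ {p} eq with invᵁ? (at p 1) v₀ v₁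
    ... | no ¬corner = ¬corner

    side-cong : ∀ {p q} → (∀ {k} → k ℕ.≤ K → at p k ≈ᵁ at q k) → side p ≡ side q
    side-cong {p} {q} eq = go (invᵁ? (at q 1) v₀ v₁)
      where
      go : Dec (Invᵁ (at q 1) v₀ v₁) → side p ≡ side q
      go (yes c) = trans (side-zero {p} (Inv-resp {π = perm (at q 1)} {perm (at p 1)} (λ i → sym (eq 0<K i)) c)) (sym (side-zero {q} c))
      go (no ¬c) = trans (side-one {p} (λ c → ¬c (Inv-resp {π = perm (at p 1)} {perm (at q 1)} (eq 0<K) c))) (sym (side-one {q} ¬c))

    -- The stage of rank 1 has a single inversion. Were the conjugate path on the left too, this
    -- inversion would be both the least box and its mirror image, whose row is `opposite v₁`.
    conj-left⇒right : ∀ p → Invᵁ (at p 1) v₀ v₁ → ¬ Invᵁ (at (conjPath p) 1) v₀ v₁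
    conj-left⇒right p corner corner′ = opposite-v₁≢v₀ (proj₁ (count₂-suc-unique (invᵁ? ⊥ᵁ) (invᵁ? (at p 1)) (λ i → contradiction i ¬Inv-⊥)
      (trans (Path.at-count p 0<K) (cong suc (sym count-⊥))) (Inv-conj⁻ (perm (at p 1)) corner′) ¬Inv-⊥ corner ¬Inv-⊥))

    -- The stage of rank 1 is not empty, so as an ideal it would contain the least box. Hence it is
    -- a filter, and its conjugate is a nonempty ideal.
    conj-right⇒left : ∀ p → ¬ Invᵁ (at p 1) v₀ v₁ → Invᵁ (at (conjPath p) 1) v₀ v₁
    conj-right⇒left p ¬corner =
      let a , b , a<b , t≡0 = Path.time-surjective p 0<K
      in go (Path.time<⇒ p a<b 0<K (ℕ.≤-reflexive (cong suc t≡0))) (unimodal⇒ (perm x) (unimodal x))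
      where
      x = at p 1
      go : ∀ {a b} → Invᵁ x a b → Ideal (Invᵁ x) ⊎ Filter (Invᵁ x) → Inv (conj (perm x)) v₀ v₁
      go ab (inj₁ ideal) = contradiction (ideal-corner {R = Invᵁ x} ideal (proj₁ ab) ab) ¬corner
      go {a} {b} ab (inj₂ filter) = ideal-corner {R = Inv (conj (perm x))} (conj-filter (perm x) filter) (opposite-anti (proj₁ ab))
        (Inv-conj (perm x) (subst₂ (Invᵁ x) (sym (opposite-involutive a)) (sym (opposite-involutive b)) ab))

    conj²-path : ∀ p {k} → at (conjPath (conjPath p)) k ≈ᵁ at p k
    conj²-path p {k} = conj²-≈ (at p k)

    conjᵁ-cong : ∀ {x y : 𝒰 n} → x ≈ᵁ y → conjᵁ x ≈ᵁ conjᵁ y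
    conjᵁ-cong {x} {y} e = rankᵁ-≈ (conjᵁ x) (conjᵁ y) (conj-anti {x = x} {y} (≤ᵁ-reflexive x y e))
      (trans (rankᵁ-conj x) (trans (rank-resp {x} {y} e) (sym (rankᵁ-conj y))))

    leftFibre : Inverse (Fibre gradedPaths side zero) leftPaths
    leftFibre = mkInverse (Fibre gradedPaths side zero) leftPaths (λ (p , s) → p , side-zero⁻ {p} s) id id
      (λ (p , c) → p , side-zero {p} c) (λ _ _ _ → refl)

    rightFibre : Inverse (Fibre gradedPaths side (suc zero)) leftPaths
    rightFibre = mkInverse (Fibre gradedPaths side (suc zero)) leftPaths
      (λ (p , s) → conjPath p , conj-right⇒left p (side-one⁻ {p} s))
      (λ {(p , _)} {(q , _)} eq {k} k≤K → conjᵁ-cong {at p k} {at q k} (eq k≤K))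
      (λ {(p , _)} {(q , _)} eq {k} k≤K i → trans (sym (conj²-≈ (at p k) i)) (trans (conjᵁ-cong {conjᵁ (at p k)} {conjᵁ (at q k)} (eq k≤K) i) (conj²-≈ (at q k) i)))
      (λ (p , c) → conjPath p , side-one {conjPath p} (conj-left⇒right p c))
      (λ (p , _) _ → conj²-path p)

    weakChains-size : ∀ {t} → HasSize (tableaux (Triangle n) K) t → HasSize (maximalChainsWeakU n) (2 ℕ.* t)
    -- `2 * t` unfolds to the sum of the constant `t` over `Fin 2`, one fibre for each side.
    weakChains-size {t} size = maximalChains-size (fibres-size gradedPaths side (λ {p} {q} → side-cong {p} {q}) (λ _ → t) sizes)
      where
      left : HasSize leftPaths t
      left = HasSize-resp {S = leftPaths} {T = tableaux (Triangle n) K} leftPaths↔tableaux size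
      sizes : ∀ i → HasSize (Fibre gradedPaths side i) t
      sizes zero = HasSize-resp {S = Fibre gradedPaths side zero} {T = leftPaths} leftFibre left
      sizes (suc zero) = HasSize-resp {S = Fibre gradedPaths side (suc zero)} {T = leftPaths} rightFibre left

-- Counting tableaux of a shifted shape by removing the largest entry.

module StrictShapes where

  open import Defs
  open import Data.Bool.Base using (if_then_else_)
  open import Data.Fin.Base using (Fin; zero; suc; toℕ; fromℕ<)
  open import Data.Fin.Properties using (toℕ-injective; toℕ-fromℕ<; toℕ<n)
  open import Data.List.Base using (List; []; _∷_; length)
  open import Data.Nat.Base
  open import Data.Nat.ListAction using (sum)
  open import Data.Nat.Properties
  open import Data.Product.Base using (_×_; _,_; proj₁; proj₂)
  open import Data.Sum.Base using (inj₁; inj₂)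
  open import Data.Unit.Base using (⊤; tt)
  open import Function.Base using (_∘_)
  open import Function.Bundles using (Inverse)
  open import Relation.Binary.Bundles using (Setoid)
  open import Relation.Binary.PropositionalEquality using (_≡_; _≢_; refl; sym; trans; cong; cong₂; subst; subst₂; setoid)
  open import Relation.Nullary.Decidable using (Dec; yes; no; does; _×-dec_; dec-true; dec-false)
  open import Relation.Nullary.Negation using (¬_; contradiction)
  open import Algebra.Properties.CommutativeMonoid.Sum +-0-commutativeMonoid using () renaming (sum to Σ)
  open Cardinality
  open import Level using (0ℓ)
  open Tableaux

  -- A strict shape is the list of its row lengths; part is 0 beyond the last row.

  part : List ℕ → ℕ → ℕ
  part []       _       = 0
  part (x ∷ xs) zero    = x
  part (x ∷ xs) (suc i) = part xs i

  -- This makes every row positive as well: the last one is compared with `part [] 0`, which is 0.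
  Strict : List ℕ → Set
  Strict []       = ⊤
  Strict (x ∷ xs) = part xs 0 < x × Strict xs

  -- Row `i` begins just right of the diagonal, as in Δₙ.
  Shape : List ℕ → ℕ → ℕ → Set
  Shape xs i j = i < j × j ≤ i + part xs i

  -- A last row of length 1 is deleted rather than left with length 0, so that strict shapes stay
  -- strict.
  shorten : ℕ → List ℕ → List ℕ
  shorten _       []               = []
  shorten zero    (suc zero ∷ [])  = []
  shorten zero    (x ∷ xs)         = pred x ∷ xs
  shorten (suc i) (x ∷ xs)         = x ∷ shorten i xs

  -- The next row must be shorter by at least 2 for the rows to stay distinct; truncated subtraction
  -- lets a last row of length 1 qualify too.
  Corner : ℕ → List ℕ → Set
  Corner i xs = part xs (suc i) ≤ part xs i ∸ 2

  corner? : ∀ i xs → Dec (Corner i xs)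
  corner? i xs = part xs (suc i) ≤? part xs i ∸ 2

  -- The largest entry of a filling ends a row i that can be shortened.
  fillings : ℕ → List ℕ → ℕ
  fillings zero    xs = 1
  fillings (suc k) xs = Σ {length xs} λ i → if does (corner? (toℕ i) xs) then fillings k (shorten (toℕ i) xs) else 0

  part-length : ∀ xs i → 0 < part xs i → i < length xs
  part-length (x ∷ xs) zero    _ = s≤s z≤n
  part-length (x ∷ xs) (suc i) p = s≤s (part-length xs i p)

  strict-positive : ∀ xs → Strict xs → ∀ i → i < length xs → 0 < part xs i
  strict-positive (x ∷ xs) (y<x , _) zero _ = ≤-trans (s≤s z≤n) y<x
  strict-positive (x ∷ xs) (_ , s) (suc i) i< = strict-positive xs s i (s≤s⁻¹ i<)

  strict-step : ∀ xs → Strict xs → ∀ i → 0 < part xs i → part xs (suc i) < part xs i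
  strict-step (x ∷ xs) (y<x , _) zero _ = y<x
  strict-step (x ∷ xs) (_ , s) (suc i) p = strict-step xs s i p

  part-shorten-≡ : ∀ i xs → part (shorten i xs) i ≡ pred (part xs i)
  part-shorten-≡ i [] = refl
  part-shorten-≡ zero (zero ∷ xs) = refl
  part-shorten-≡ zero (suc zero ∷ []) = refl
  part-shorten-≡ zero (suc zero ∷ y ∷ xs) = refl
  part-shorten-≡ zero (suc (suc x) ∷ xs) = refl
  part-shorten-≡ (suc i) (x ∷ xs) = part-shorten-≡ i xs

  part-shorten-≢ : ∀ i xs {j} → j ≢ i → part (shorten i xs) j ≡ part xs j
  part-shorten-≢ i [] _ = refl
  part-shorten-≢ zero (x ∷ xs) {zero} j≢i = contradiction refl j≢i
  part-shorten-≢ zero (zero ∷ xs) {suc j} _ = refl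
  part-shorten-≢ zero (suc zero ∷ []) {suc j} _ = refl
  part-shorten-≢ zero (suc zero ∷ y ∷ xs) {suc j} _ = refl
  part-shorten-≢ zero (suc (suc x) ∷ xs) {suc j} _ = refl
  part-shorten-≢ (suc i) (x ∷ xs) {zero} _ = refl
  part-shorten-≢ (suc i) (x ∷ xs) {suc j} j≢i = part-shorten-≢ i xs (j≢i ∘ cong suc)

  part-shorten-≤ : ∀ i xs j → part (shorten i xs) j ≤ part xs j
  part-shorten-≤ i xs j with j ≟ i
  ... | yes refl = ≤-trans (≤-reflexive (part-shorten-≡ i xs)) pred[n]≤n
  ... | no j≢i = ≤-reflexive (part-shorten-≢ i xs j≢i)

  sum-shorten : ∀ i xs → 0 < part xs i → suc (sum (shorten i xs)) ≡ sum xs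
  sum-shorten zero (suc zero ∷ []) _ = refl
  sum-shorten zero (suc zero ∷ y ∷ xs) _ = refl
  sum-shorten zero (suc (suc x) ∷ xs) _ = refl
  sum-shorten (suc i) (x ∷ xs) p = trans (sym (+-suc x _)) (cong (x +_) (sum-shorten i xs p))

  strict-shorten : ∀ i xs → Strict xs → Corner i xs → Strict (shorten i xs)
  strict-shorten i [] s c = tt
  strict-shorten zero (zero ∷ xs) (() , s) c
  strict-shorten zero (suc zero ∷ []) s c = tt
  strict-shorten zero (suc zero ∷ zero ∷ xs) (_ , () , _) c
  strict-shorten zero (suc zero ∷ suc y ∷ xs) (s≤s () , _) c
  strict-shorten zero (suc (suc x) ∷ xs) (_ , s) c = s≤s c , s
  strict-shorten (suc i) (x ∷ xs) (y<x , s) c = ≤-<-trans (part-shorten-≤ i xs 0) y<x , strict-shorten i xs s c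

  strict-empty : ∀ xs → Strict xs → sum xs ≡ 0 → xs ≡ []
  strict-empty [] _ _ = refl
  strict-empty (suc x ∷ xs) _ ()

  module _ {xs : List ℕ} (strict : Strict xs) where

    -- One row further down, the start moves right by one and the length drops by at least one, so
    -- the end does not move right.
    part-antitone : ∀ {i j} → i ≤ j → 0 < part xs j → j + part xs j ≤ i + part xs i
    part-antitone {i} {zero} z≤n _ = ≤-refl
    part-antitone {i} {suc j} i≤1+j p with m≤n⇒m<n∨m≡n i≤1+j
    ... | inj₂ refl = ≤-refl
    ... | inj₁ i<1+j = ≤-trans
            (≤-trans (≤-reflexive (sym (+-suc j _))) (+-monoʳ-≤ j (strict-step xs strict j 0<pj)))
            (part-antitone (s≤s⁻¹ i<1+j) 0<pj)
      where
      prev-positive : ∀ xs → Strict xs → ∀ j → 0 < part xs (suc j) → 0 < part xs j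
      prev-positive xs s j p = strict-positive xs s j (<⇒≤ (part-length xs (suc j) p))
      0<pj : 0 < part xs j
      0<pj = prev-positive xs strict j p

    shape-positive : ∀ {i j} → Shape xs i j → 0 < part xs i
    shape-positive {i} (i<j , j≤) = +-cancelˡ-< i 0 _ (≤-<-trans (≤-reflexive (+-identityʳ i)) (<-≤-trans i<j j≤))

    shape-positive-part : ∀ {i j} → Shape xs i j → i < length xs
    shape-positive-part m = part-length xs _ (shape-positive m)

    module _ {i : ℕ} (0<p : 0 < part xs i) where

      end : ℕ
      end = i + part xs i

      end∈ : Shape xs i end
      end∈ = m<m+n i 0<p , ≤-refl

      shorten⇒ : ∀ {k l} → Shape (shorten i xs) k l → Shape xs k l × ¬ (k ≡ i × l ≡ end)
      shorten⇒ {k} {l} (k<l , l≤) = (k<l , ≤-trans l≤ (+-monoʳ-≤ k (part-shorten-≤ i xs k))) , λ { (refl , refl) →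
        <⇒≱ (+-monoʳ-< i (≤-<-trans (≤-reflexive (part-shorten-≡ i xs)) (≤-reflexive (suc-pred _ {{>-nonZero 0<p}})))) l≤ }

      shorten⇐ : ∀ {k l} → Shape xs k l → ¬ (k ≡ i × l ≡ end) → Shape (shorten i xs) k l
      shorten⇐ {k} {l} (k<l , l≤) ≢end with k ≟ i
      ... | no k≢i = k<l , ≤-trans l≤ (≤-reflexive (cong (k +_) (sym (part-shorten-≢ i xs k≢i))))
      ... | yes refl = k<l , s≤s⁻¹ (≤-trans (≤∧≢⇒< l≤ (λ l≡ → ≢end (refl , l≡)))
              (≤-reflexive (trans (cong (i +_) (sym (trans (cong suc (part-shorten-≡ i xs)) (suc-pred _ {{>-nonZero 0<p}})))) (+-suc i _))))

      -- The corner condition makes row `i + 1` end strictly to the left of `end`, and the rows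
      -- below it end no further right.
      corner-column : Corner i xs → ∀ {k} → i < k → ¬ Shape xs k end
      corner-column corner {k} i<k m = <⇒≱ (gap (part xs i) refl) (≤-trans (proj₂ m) (part-antitone i<k (shape-positive m)))
        where
        0<next : 0 < part xs (suc i)
        0<next = +-cancelˡ-< (suc i) 0 _ (≤-<-trans (≤-reflexive (+-identityʳ _))
          (≤-<-trans i<k (<-≤-trans (m<m+n k (shape-positive m)) (part-antitone i<k (shape-positive m)))))
        gap : ∀ p → p ≡ part xs i → suc i + part xs (suc i) < i + p
        gap zero eq = contradiction (subst (0 <_) (sym eq) 0<p) λ ()
        gap (suc zero) eq = contradiction (≤-trans 0<next (≤-trans corner (≤-reflexive (cong (_∸ 2) (sym eq))))) λ ()
        gap (suc (suc p)) eq = ≤-trans (s≤s (s≤s (+-monoʳ-≤ i (≤-trans corner (≤-reflexive (cong (_∸ 2) (sym eq)))))))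
          (≤-reflexive (sym (trans (+-suc i (suc p)) (cong suc (+-suc i p)))))

    module _ {k : ℕ} where

      module _ (T : Tableau (Shape xs) (suc k)) {i j : ℕ} (m : Shape xs i j) (last : e T i j ≡ k) where

        private
          maximal : ∀ {i′ j′} → Shape xs i′ j′ → ¬ e T i j < e T i′ j′
          maximal m′ lt = <⇒≱ lt (≤-trans (s≤s⁻¹ (bound T m′)) (≤-reflexive (sym last)))

        last-end : j ≡ i + part xs i
        last-end with m≤n⇒m<n∨m≡n (proj₂ m)
        ... | inj₂ j≡ = j≡
        ... | inj₁ j< = let m′ = m<n⇒m<1+n (proj₁ m) , j< in contradiction (row T m m′ (n<1+n j)) (maximal m′)

        -- Otherwise the box below the end of row `i` belongs to the shape and would carry an entry
        -- larger than the largest.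
        last-corner : Corner i xs
        last-corner = ≮⇒≥ λ lt → go (part xs i) refl lt
          where
          go : ∀ p → p ≡ part xs i → ¬ part xs i ∸ 2 < part xs (suc i)
          go zero eq _ = contradiction (subst (0 <_) (sym eq) (shape-positive m)) λ ()
          go (suc zero) eq lt = <⇒≱ (strict-step xs strict i (shape-positive m)) (≤-trans (≤-reflexive (sym eq)) (≤-trans (s≤s z≤n) lt))
          go (suc (suc p)) eq lt = maximal m′ (col T m m′ (n<1+n i))
            where
            j≡ : j ≡ suc (suc (i + p))
            j≡ = trans last-end (trans (cong (i +_) (sym eq)) (trans (+-suc i (suc p)) (cong suc (+-suc i p))))
            m′ : Shape xs (suc i) j
            m′ = subst (suc i <_) (sym j≡) (s≤s (s≤s (m≤m+n i p)))
               , subst (_≤ suc i + part xs (suc i)) (sym j≡) (s≤s (≤-trans (≤-reflexive (sym (+-suc i p)))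
                   (+-monoʳ-≤ i (subst (λ q → q ∸ 2 < part xs (suc i)) (sym eq) lt))))

      lastRow : Tableau (Shape xs) (suc k) → Fin (length xs)
      lastRow T = let i , j , m , _ = surj T (n<1+n k) in fromℕ< (shape-positive-part m)

      lastRow-≡ : ∀ T {i j} → Shape xs i j → e T i j ≡ k → toℕ (lastRow T) ≡ i
      lastRow-≡ T m last = let i , j , m′ , last′ = surj T (n<1+n k)
        in trans (toℕ-fromℕ< (shape-positive-part m′)) (proj₁ (inj T m′ m (trans last′ (sym last))))

      lastRow-end : ∀ T {i} → lastRow T ≡ i → (0 < part xs (toℕ i)) × e T (toℕ i) (toℕ i + part xs (toℕ i)) ≡ k × Corner (toℕ i) xs
      lastRow-end T {i} eq with surj T (n<1+n k)
      ... | i′ , j′ , m , last = subst (λ i → 0 < part xs i × e T i (i + part xs i) ≡ k × Corner i xs) i′≡i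
            (shape-positive m , trans (cong (e T i′) (sym (last-end T m last))) last , last-corner T m last)
        where
        i′≡i : i′ ≡ toℕ i
        i′≡i = trans (sym (toℕ-fromℕ< (shape-positive-part m))) (cong toℕ eq)

      lastRow-cong : ∀ {S T} → (∀ {i j} → Shape xs i j → e S i j ≡ e T i j) → lastRow S ≡ lastRow T
      lastRow-cong {S} {T} eq = let i , j , m , last = surj T (n<1+n k)
        in toℕ-injective (trans (lastRow-≡ S m (trans (eq m) last)) (sym (lastRow-≡ T m last)))

      module _ {i : ℕ} (0<p : 0 < part xs i) where

        private
          b = end 0<p

        restrict : (T : Tableau (Shape xs) (suc k)) → e T i b ≡ k → Tableau (Shape (shorten i xs)) k
        restrict T last .e = e T
        restrict T last .bound m = let m′ , ≢b = shorten⇒ 0<p m in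
          ≤∧≢⇒< (s≤s⁻¹ (bound T m′)) λ e≡k → ≢b (inj T m′ (end∈ 0<p) (trans e≡k (sym last)))
        restrict T last .inj m m′ = inj T (proj₁ (shorten⇒ 0<p m)) (proj₁ (shorten⇒ 0<p m′))
        restrict T last .surj {l} l<k = let i′ , j′ , m , e≡l = surj T (m<n⇒m<1+n l<k) in
          i′ , j′ , shorten⇐ 0<p m (λ (i≡ , j≡) → <⇒≢ l<k (trans (sym e≡l) (trans (cong₂ (e T) i≡ j≡) last))) , e≡l
        restrict T last .row m m′ = row T (proj₁ (shorten⇒ 0<p m)) (proj₁ (shorten⇒ 0<p m′))
        restrict T last .col m m′ = col T (proj₁ (shorten⇒ 0<p m)) (proj₁ (shorten⇒ 0<p m′))

        module _ (corner : Corner i xs) (T : Tableau (Shape (shorten i xs)) k) where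

          private
            b? : ∀ i′ j′ → Dec (i′ ≡ i × j′ ≡ b)
            b? i′ j′ = (i′ ≟ i) ×-dec (j′ ≟ b)

          extendEntry : ℕ → ℕ → ℕ
          extendEntry i′ j′ = if does (b? i′ j′) then k else e T i′ j′

          extend-b : extendEntry i b ≡ k
          extend-b = cong (if_then k else e T i b) (dec-true (b? i b) (refl , refl))

          extend-≢ : ∀ {i′ j′} → ¬ (i′ ≡ i × j′ ≡ b) → extendEntry i′ j′ ≡ e T i′ j′
          extend-≢ {i′} {j′} ¬b = cong (if_then k else e T i′ j′) (dec-false (b? i′ j′) ¬b)

          data View : ℕ → ℕ → Set where
            new : View i b
            old : ∀ {i′ j′} → Shape (shorten i xs) i′ j′ → extendEntry i′ j′ ≡ e T i′ j′ → View i′ j′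

          view : ∀ {i′ j′} → Shape xs i′ j′ → View i′ j′
          view {i′} {j′} m with b? i′ j′
          ... | yes (refl , refl) = new
          ... | no ¬b = old (shorten⇐ 0<p m ¬b) (extend-≢ ¬b)

          extended : Tableau (Shape xs) (suc k)
          extended .e = extendEntry
          extended .bound m with view m
          ... | new = s≤s (≤-reflexive extend-b)
          ... | old m′ eq = subst (_< suc k) (sym eq) (m<n⇒m<1+n (bound T m′))
          extended .inj m m′ eq with view m | view m′
          ... | new | new = refl , refl
          ... | new | old n′ q = contradiction (trans (sym q) (trans (sym eq) extend-b)) (<⇒≢ (bound T n′))
          ... | old n p | new = contradiction (trans (sym p) (trans eq extend-b)) (<⇒≢ (bound T n))
          ... | old n p | old n′ q = inj T n n′ (trans (sym p) (trans eq q))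
          extended .surj {l} l<1+k with m≤n⇒m<n∨m≡n (s≤s⁻¹ l<1+k)
          ... | inj₂ refl = i , b , end∈ 0<p , extend-b
          ... | inj₁ l<k = let i′ , j′ , m , eq = surj T l<k
                               m′ , ≢b = shorten⇒ 0<p m
                           in i′ , j′ , m′ , trans (extend-≢ ≢b) eq
          extended .row m m′ lt with view m | view m′
          ... | new | _ = contradiction (proj₂ m′) (<⇒≱ lt)
          ... | old n p | new = subst₂ _<_ (sym p) (sym extend-b) (bound T n)
          ... | old n p | old n′ q = subst₂ _<_ (sym p) (sym q) (row T n n′ lt)
          extended .col m m′ lt with view m | view m′
          ... | new | _ = contradiction m′ (corner-column 0<p corner lt)
          ... | old n p | new = subst₂ _<_ (sym p) (sym extend-b) (bound T n)
          ... | old n p | old n′ q = subst₂ _<_ (sym p) (sym q) (col T n n′ lt)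

      -- The box of the largest entry is deleted and put back. Two tableaux in the fibre both have
      -- `k` there, so they are determined by their entries elsewhere.
      fibre↔ : ∀ i → Corner (toℕ i) xs → Inverse (Fibre (tableaux (Shape xs) (suc k)) lastRow i) (tableaux (Shape (shorten (toℕ i) xs)) k)
      fibre↔ i corner = mkInverse (Fibre (tableaux (Shape xs) (suc k)) lastRow i) (tableaux (Shape (shorten (toℕ i) xs)) k)
        (λ (T , eq) → restrict 0<p T (proj₁ (proj₂ (lastRow-end T eq))))
        (λ eq m → eq (proj₁ (shorten⇒ 0<p m)))
        (λ {(S , p)} {(T , q)} → to-inj S T (proj₁ (proj₂ (lastRow-end S p))) (proj₁ (proj₂ (lastRow-end T q))))
        (λ T → extended 0<p corner T , toℕ-injective (lastRow-≡ (extended 0<p corner T) (end∈ 0<p) (extend-b 0<p corner T)))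
        (λ T m → extend-≢ 0<p corner T (proj₂ (shorten⇒ 0<p m)))
        where
        0<p : 0 < part xs (toℕ i)
        0<p = strict-positive xs strict (toℕ i) (toℕ<n i)
        to-inj : ∀ (S T : Tableau (Shape xs) (suc k)) → e S (toℕ i) (end 0<p) ≡ k → e T (toℕ i) (end 0<p) ≡ k →
                 (∀ {i′ j′} → Shape (shorten (toℕ i) xs) i′ j′ → e S i′ j′ ≡ e T i′ j′) →
                 ∀ {i′ j′} → Shape xs i′ j′ → e S i′ j′ ≡ e T i′ j′
        to-inj S T p q eq {i′} {j′} m with (i′ ≟ toℕ i) ×-dec (j′ ≟ end 0<p)
        ... | yes (refl , refl) = trans p (sym q)
        ... | no ¬b = eq (shorten⇐ 0<p m ¬b)

  tableaux-size : ∀ k xs → Strict xs → sum xs ≡ k → HasSize (tableaux (Shape xs) k) (fillings k xs)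
  tableaux-size zero xs s sum≡0 with strict-empty xs s sum≡0
  ... | refl = mkInverse (tableaux (Shape []) 0) (setoid (Fin 1)) (λ _ → zero) (λ _ → refl) (λ _ m → contradiction m ¬m)
                 (λ _ → empty) (λ { zero → refl })
    where
    ¬m : ∀ {i j} → ¬ Shape [] i j
    ¬m {i} (i<j , j≤i) = <⇒≱ i<j (≤-trans j≤i (≤-reflexive (+-identityʳ i)))
    empty : Tableau (Shape []) 0
    empty = record
      { e = λ _ _ → 0 ; bound = λ m → contradiction m ¬m ; inj = λ m _ _ → contradiction m ¬m ; surj = λ ()
      ; row = λ m _ _ → contradiction m ¬m ; col = λ m _ _ → contradiction m ¬m }
  tableaux-size (suc k) xs s sum≡ = fibres-size (tableaux (Shape xs) (suc k)) (lastRow s)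
    (λ {S} {T} → lastRow-cong s {S = S} {T}) _ sizes
    where
    rowFibre : Fin (length xs) → Setoid 0ℓ 0ℓ
    rowFibre = Fibre (tableaux (Shape xs) (suc k)) (lastRow s)
    size : Fin (length xs) → ℕ
    size i = if does (corner? (toℕ i) xs) then fillings k (shorten (toℕ i) xs) else 0
    sizes : ∀ i → HasSize (rowFibre i) (size i)
    sizes i = go (corner? (toℕ i) xs)
      where
      go : Dec (Corner (toℕ i) xs) → HasSize (rowFibre i) (size i)
      go (yes corner) = subst (HasSize (rowFibre i)) (cong (if_then fillings k (shorten (toℕ i) xs) else 0) (sym (dec-true (corner? (toℕ i) xs) corner)))
        (HasSize-resp {S = rowFibre i} {T = tableaux (Shape (shorten (toℕ i) xs)) k} (fibre↔ s i corner)
          (tableaux-size k (shorten (toℕ i) xs) (strict-shorten (toℕ i) xs s corner)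
            (suc-injective (trans (sum-shorten (toℕ i) xs (strict-positive xs s (toℕ i) (toℕ<n i))) sum≡))))
      -- A tableau in this fibre would have its largest entry in row `i`, and so make that row a
      -- corner.
      go (no ¬corner) = subst (HasSize (rowFibre i)) (cong (if_then fillings k (shorten (toℕ i) xs) else 0) (sym (dec-false (corner? (toℕ i) xs) ¬corner)))
        (empty-size (rowFibre i) λ (T , eq) → ¬corner (proj₂ (proj₂ (lastRow-end s T eq))))

-- Fields, and divided differences of products of linear factors.

module Fields where

  open import Algebra.Bundles using (CommutativeRing)
  open import Algebra.Core using (Op₁; Op₂)
  open import Algebra.Structures using (IsCommutativeRing)
  open import Data.Fin.Base using (Fin; zero; suc)
  open import Data.List.Base using (List; []; _∷_; length; lookup)
  open import Data.List.Relation.Unary.All as All using ([]; _∷_)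
  open import Data.List.Relation.Unary.AllPairs using ([]; _∷_)
  open import Data.Nat.Base as ℕ using (ℕ; zero; suc; s≤s)
  open import Data.Nat.ListAction using (sum)
  import Data.Nat.Properties as ℕ
  open import Data.Product.Base using (_×_; _,_; proj₂)
  open import Data.Unit.Base using (⊤)
  open import Relation.Binary.PropositionalEquality using (_≡_; _≢_; refl; sym; trans; cong; cong₂; module ≡-Reasoning)
  import Algebra.Properties.CommutativeMonoid.Sum as Sum
  import Algebra.Properties.Semiring.Sum as SemiringSum
  import Algebra.Properties.Group as GroupProperties
  import Algebra.Solver.Ring.NaturalCoefficients.Default as Solver

  -- inv is total; inv 0# is arbitrary.
  record Field : Set₁ where
    infixl 6 _+_
    infixl 7 _*_
    infix  8 -_
    field
      F                 : Set
      _+_ _*_           : Op₂ F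
      -_                : Op₁ F
      0# 1#             : F
      isCommutativeRing : IsCommutativeRing _≡_ _+_ _*_ -_ 0# 1#
      inv               : F → F
      inverseʳ          : ∀ {x} → x ≢ 0# → x * inv x ≡ 1#

    commutativeRing : CommutativeRing _ _
    commutativeRing = record { isCommutativeRing = isCommutativeRing }

    open CommutativeRing commutativeRing public using
      (_-_; +-identityʳ; +-identityˡ; *-identityˡ; *-identityʳ; *-comm; *-assoc; +-comm; +-assoc; zeroˡ; zeroʳ; distribˡ; distribʳ; -‿inverseʳ; -‿inverseˡ; ring; semiring; +-commutativeMonoid; +-group; commutativeSemiring)

  module FieldProperties (𝔽 : Field) where

    open Field 𝔽 public
    open Sum +-commutativeMonoid using (sum-cong-≗; ∑-distrib-+) renaming (sum to Σ) public
    open SemiringSum semiring using (*-distribˡ-sum) public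
    open GroupProperties +-group using (x∙y⁻¹≈ε⇒x≈y) public
    open Solver commutativeSemiring using (solve; _:=_; _:+_; _:*_)

    *-cancelˡ-0 : ∀ {x y} → x ≢ 0# → x * y ≡ 0# → y ≡ 0#
    *-cancelˡ-0 {x} {y} x≢0 xy≡0 = begin
      y                 ≡⟨ *-identityˡ y ⟨
      1# * y            ≡⟨ cong (_* y) (inverseʳ x≢0) ⟨
      (x * inv x) * y   ≡⟨ solve 3 (λ x i y → (x :* i) :* y := i :* (x :* y)) refl x (inv x) y ⟩
      inv x * (x * y)   ≡⟨ cong (inv x *_) xy≡0 ⟩
      inv x * 0#        ≡⟨ zeroʳ _ ⟩
      0#                ∎
      where open ≡-Reasoning

    x-x≡0 : ∀ {x y} → x ≡ y → x - y ≡ 0#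
    x-x≡0 {x} refl = -‿inverseʳ x

    ≢⇒x-y≢0 : ∀ {x y} → x ≢ y → x - y ≢ 0#
    ≢⇒x-y≢0 x≢y eq = x≢y (x∙y⁻¹≈ε⇒x≈y _ _ eq)

    sub-via : ∀ t a c → t - c ≡ (a - c) + (t - a)
    sub-via t a c = begin
      t - c                    ≡⟨ +-identityʳ _ ⟨
      (t - c) + 0#             ≡⟨ cong ((t - c) +_) (-‿inverseʳ a) ⟨
      (t - c) + (a - a)        ≡⟨ solve 4 (λ t c a a′ → (t :+ c) :+ (a :+ a′) := (a :+ c) :+ (t :+ a′)) refl t (- c) a (- a) ⟩
      (a - c) + (t - a)        ∎
      where open ≡-Reasoning

  -- Lagrange interpolation: lagrange p xs = Σᵢ p(aᵢ) ∏_{j≠i} 1/(aᵢ - aⱼ) is the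
  -- divided difference of p at the points a x, x ∈ xs.
  module Interpolation (𝔽 : Field) {A : Set} (a : A → Field.F 𝔽) where

    open FieldProperties 𝔽
    open Solver commutativeSemiring using (solve; _:=_; _:+_; _:*_)

    cofactor : A → List A → F
    cofactor x []       = 1#
    cofactor x (z ∷ zs) = inv (a x - a z) * cofactor x zs

    weight : (xs : List A) → Fin (length xs) → F
    weight (x ∷ xs) zero    = cofactor x xs
    weight (x ∷ xs) (suc i) = weight xs i * inv (a (lookup xs i) - a x)

    lagrange : (F → F) → List A → F
    lagrange p xs = Σ {length xs} λ i → p (a (lookup xs i)) * weight xs i

    Distinct : List A → Set
    Distinct []       = ⊤
    Distinct (x ∷ xs) = (∀ i → a (lookup xs i) ≢ a x) × Distinct xs

    private
      cancel : ∀ {d} p w → d ≢ 0# → (d * p) * (w * inv d) ≡ p * w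
      cancel {d} p w d≢0 = begin
        (d * p) * (w * inv d)   ≡⟨ solve 4 (λ d p w i → (d :* p) :* (w :* i) := (d :* i) :* (p :* w)) refl d p w (inv d) ⟩
        (d * inv d) * (p * w)   ≡⟨ cong (_* (p * w)) (inverseʳ d≢0) ⟩
        1# * (p * w)            ≡⟨ *-identityˡ _ ⟩
        p * w                   ∎
        where open ≡-Reasoning

      vanish : ∀ {d} p w → d ≡ 0# → (d * p) * w ≡ 0#
      vanish {d} p w refl = trans (cong (_* w) (zeroˡ p)) (zeroˡ w)

    -- The factor `t - a x` kills the term of `x` and cancels the factor of `x` in every other
    -- weight.
    lagrange-remove : ∀ p x xs → Distinct (x ∷ xs) → lagrange (λ t → (t - a x) * p t) (x ∷ xs) ≡ lagrange p xs
    lagrange-remove p x xs (x∉xs , _) = trans (cong₂ _+_ (vanish (p (a x)) _ (x-x≡0 refl))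
      (sum-cong-≗ {length xs} λ i → cancel (p (a (lookup xs i))) (weight xs i) (≢⇒x-y≢0 (x∉xs i)))) (+-identityˡ _)

    lagrange-remove₂ : ∀ p x y xs → Distinct (x ∷ y ∷ xs) → lagrange (λ t → (t - a y) * p t) (x ∷ y ∷ xs) ≡ lagrange p (x ∷ xs)
    lagrange-remove₂ p x y xs (x∉ , y∉ , _) = cong₂ _+_
      (trans (cong ((a x - a y) * p (a x) *_) (*-comm _ _)) (cancel (p (a x)) (cofactor x xs) (≢⇒x-y≢0 (λ eq → x∉ zero (sym eq)))))
      (trans (cong₂ _+_ (vanish (p (a y)) _ (x-x≡0 refl)) (sum-cong-≗ {length xs} term)) (+-identityˡ _))
      where
      term : ∀ i → ((a (lookup xs i) - a y) * p (a (lookup xs i))) * ((weight xs i * inv (a (lookup xs i) - a y)) * inv (a (lookup xs i) - a x))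
                 ≡ p (a (lookup xs i)) * (weight xs i * inv (a (lookup xs i) - a x))
      term i = trans (cong ((a (lookup xs i) - a y) * p (a (lookup xs i)) *_) (swap (weight xs i) _ _))
                     (cancel (p (a (lookup xs i))) _ (≢⇒x-y≢0 (y∉ i)))
        where
        swap : ∀ w u v → (w * u) * v ≡ (w * v) * u
        swap = solve 3 (λ w u v → (w :* u) :* v := (w :* v) :* u) refl

    lagrange-linear : ∀ p c d xs → lagrange (λ t → (t - c) * p t) xs ≡ (d - c) * lagrange p xs + lagrange (λ t → (t - d) * p t) xs
    lagrange-linear p c d xs = begin
      lagrange (λ t → (t - c) * p t) xs                 ≡⟨ sum-cong-≗ {length xs} (λ i → term (a (lookup xs i)) (weight xs i)) ⟩
      Σ {length xs} (λ i → (d - c) * (p (a (lookup xs i)) * weight xs i) + ((a (lookup xs i) - d) * p (a (lookup xs i))) * weight xs i)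
                                                         ≡⟨ ∑-distrib-+ {length xs} _ _ ⟩
      Σ {length xs} (λ i → (d - c) * (p (a (lookup xs i)) * weight xs i)) + lagrange (λ t → (t - d) * p t) xs
                                                         ≡⟨ cong (_+ lagrange (λ t → (t - d) * p t) xs) (*-distribˡ-sum {length xs} (d - c) _) ⟨
      (d - c) * lagrange p xs + lagrange (λ t → (t - d) * p t) xs ∎
      where
      open ≡-Reasoning
      term : ∀ t w → ((t - c) * p t) * w ≡ (d - c) * (p t * w) + ((t - d) * p t) * w
      term t w = trans (cong (λ s → (s * p t) * w) (sub-via t d c))
        (solve 4 (λ u v q w → ((u :+ v) :* q) :* w := u :* (q :* w) :+ (v :* q) :* w) refl (d - c) (t - d) (p t) w)

    -- The Leibniz rule for divided differences with a linear factor: split `t - c` as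
    -- `(a x - c) + (t - a x)`; the second summand removes the point `x`.
    lagrange-step : ∀ p c x xs → Distinct (x ∷ xs) →
                    lagrange (λ t → (t - c) * p t) (x ∷ xs) ≡ (a x - c) * lagrange p (x ∷ xs) + lagrange p xs
    lagrange-step p c x xs dist = trans (lagrange-linear p c (a x) (x ∷ xs)) (cong ((a x - c) * lagrange p (x ∷ xs) +_) (lagrange-remove p x xs dist))

    lagrange-one : ∀ x → lagrange (λ _ → 1#) (x ∷ []) ≡ 1#
    lagrange-one x = trans (+-identityʳ _) (*-identityˡ _)

    -- Computing the divided difference of `t - a y` in two ways shows that `(a x - a y) * L` is the
    -- divided difference of 1 at `x ∷ xs` minus that at `y ∷ xs`. These two agree: both are 1 if
    -- `xs` is empty, and both are 0 by induction otherwise.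
    lagrange-1 : ∀ x y xs → Distinct (x ∷ y ∷ xs) → lagrange (λ _ → 1#) (x ∷ y ∷ xs) ≡ 0#
    lagrange-1 x y xs dist@(x∉ , y∉ , dist-xs) = *-cancelˡ-0 (≢⇒x-y≢0 (λ eq → x∉ zero (sym eq))) (begin
      (a x - a y) * L                                   ≡⟨ +-identityʳ _ ⟨
      (a x - a y) * L + 0#                              ≡⟨ cong ((a x - a y) * L +_) (-‿inverseʳ L′) ⟨
      (a x - a y) * L + (L′ - L′)                       ≡⟨ +-assoc _ _ _ ⟨
      ((a x - a y) * L + L′) - L′                       ≡⟨ cong (_- L′) (lagrange-step (λ _ → 1#) (a y) x (y ∷ xs) dist) ⟨
      lagrange (λ t → (t - a y) * 1#) (x ∷ y ∷ xs) - L′ ≡⟨ cong (_- L′) (lagrange-remove₂ (λ _ → 1#) x y xs dist) ⟩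
      lagrange (λ _ → 1#) (x ∷ xs) - L′                 ≡⟨ x-x≡0 (same xs dist) ⟩
      0# ∎)
      where
      open ≡-Reasoning
      L = lagrange (λ _ → 1#) (x ∷ y ∷ xs)
      L′ = lagrange (λ _ → 1#) (y ∷ xs)
      same : ∀ xs → Distinct (x ∷ y ∷ xs) → lagrange (λ _ → 1#) (x ∷ xs) ≡ lagrange (λ _ → 1#) (y ∷ xs)
      same [] _ = trans (lagrange-one x) (sym (lagrange-one y))
      same (z ∷ zs) (x∉ , y∉ , dist) = trans (lagrange-1 x z zs ((λ i → x∉ (suc i)) , dist)) (sym (lagrange-1 y z zs (y∉ , dist)))

    module _ (b : A → F) where

      poly : List A → F → F
      poly []       t = 1#
      poly (z ∷ zs) t = (t - b z) * poly zs t

      total : List A → List A → F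
      total (x ∷ xs) (z ∷ zs) = (a x - b z) + total xs zs
      total _        _        = 0#

      -- Degree below n - 1 at n points. The step rule splits off a linear factor, and where it
      -- drops a point as well, the degree is still too small.
      lagrange-poly-0 : ∀ zs xs → Distinct xs → suc (length zs) ℕ.< length xs → lagrange (poly zs) xs ≡ 0#
      lagrange-poly-0 [] (x ∷ []) dist (s≤s ())
      lagrange-poly-0 [] (x ∷ y ∷ xs) dist lt = lagrange-1 x y xs dist
      lagrange-poly-0 (z ∷ zs) (x ∷ xs) dist lt = begin
        lagrange (poly (z ∷ zs)) (x ∷ xs)                                   ≡⟨ lagrange-step (poly zs) (b z) x xs dist ⟩
        (a x - b z) * lagrange (poly zs) (x ∷ xs) + lagrange (poly zs) xs    ≡⟨ cong₂ (λ u v → (a x - b z) * u + v)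
          (lagrange-poly-0 zs (x ∷ xs) dist (ℕ.<⇒≤ lt)) (lagrange-poly-0 zs xs (proj₂ dist) (ℕ.s≤s⁻¹ lt)) ⟩
        (a x - b z) * 0# + 0#                                                ≡⟨ trans (+-identityʳ _) (zeroʳ _) ⟩
        0# ∎
        where open ≡-Reasoning

      -- Degree n - 1 at n points: the leading coefficient. The first summand of the step rule has
      -- too small a degree and vanishes.
      lagrange-poly-1 : ∀ zs xs → Distinct xs → suc (length zs) ≡ length xs → lagrange (poly zs) xs ≡ 1#
      lagrange-poly-1 [] (x ∷ []) dist eq = lagrange-one x
      lagrange-poly-1 (z ∷ zs) (x ∷ xs) dist eq = begin
        lagrange (poly (z ∷ zs)) (x ∷ xs)                                   ≡⟨ lagrange-step (poly zs) (b z) x xs dist ⟩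
        (a x - b z) * lagrange (poly zs) (x ∷ xs) + lagrange (poly zs) xs    ≡⟨ cong₂ (λ u v → (a x - b z) * u + v)
          (lagrange-poly-0 zs (x ∷ xs) dist (ℕ.≤-reflexive eq)) (lagrange-poly-1 zs xs (proj₂ dist) (ℕ.suc-injective eq)) ⟩
        (a x - b z) * 0# + 1#                                                ≡⟨ trans (cong (_+ 1#) (zeroʳ _)) (+-identityˡ _) ⟩
        1# ∎
        where open ≡-Reasoning

      -- Degree n at n points. In the step rule, `a x - b z` is multiplied by a leading coefficient
      -- 1, and the other summand is again of this kind.
      lagrange-poly-total : ∀ zs xs → Distinct xs → length zs ≡ length xs → lagrange (poly zs) xs ≡ total xs zs
      lagrange-poly-total [] [] dist eq = refl
      lagrange-poly-total (z ∷ zs) (x ∷ xs) dist eq = begin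
        lagrange (poly (z ∷ zs)) (x ∷ xs)                                   ≡⟨ lagrange-step (poly zs) (b z) x xs dist ⟩
        (a x - b z) * lagrange (poly zs) (x ∷ xs) + lagrange (poly zs) xs    ≡⟨ cong₂ (λ u v → (a x - b z) * u + v)
          (lagrange-poly-1 zs (x ∷ xs) dist eq) (lagrange-poly-total zs xs (proj₂ dist) (ℕ.suc-injective eq)) ⟩
        (a x - b z) * 1# + total xs zs                                       ≡⟨ cong (_+ total xs zs) (*-identityʳ _) ⟩
        (a x - b z) + total xs zs ∎
        where open ≡-Reasoning

-- The product formula for shifted shapes, and its value at the staircase.

module ProductFormula where

  open import Data.Bool.Base using (if_then_else_)
  open import Data.Fin.Base using (Fin; zero; suc; toℕ)
  open import Data.List.Base using (List; []; _∷_; length; lookup)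
  open import Data.List.Relation.Unary.All as All using (All; []; _∷_)
  open import Data.List.Membership.Propositional.Properties using (∈-lookup)
  open import Data.Nat.Base as ℕ using (ℕ; zero; suc; pred; s≤s; z≤n; _!; NonZero)
  open import Data.Nat.ListAction using (sum)
  import Data.Nat.Properties as ℕ
  open import Data.Product.Base using (_×_; _,_; proj₁; proj₂)
  open import Data.Fin.Properties using (toℕ<n)
  open import Data.Unit.Base using (tt)
  open import Function.Base using (_∘_)
  open import Relation.Binary.PropositionalEquality using (_≡_; _≢_; refl; sym; trans; cong; cong₂; subst; module ≡-Reasoning)
  open import Relation.Nullary.Decidable using (Dec; yes; no; does; dec-true; dec-false)
  open import Relation.Nullary.Negation using (¬_; contradiction)
  import Algebra.Properties.Ring as RingProperties
  import Algebra.Solver.Ring.NaturalCoefficients.Default as Solver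
  open import Data.Nat.Tactic.RingSolver using (solve-∀)
  import Algebra.Properties.CommutativeMonoid.Sum ℕ.+-0-commutativeMonoid as ℕΣ
  open StrictShapes
  open Fields

  module ShapeFormula (𝔽 : Field) (ν : ℕ → Field.F 𝔽) (ν-0 : ν 0 ≡ Field.0# 𝔽) (ν-1 : ν 1 ≡ Field.1# 𝔽)
    (ν-+ : ∀ m n → ν (m ℕ.+ n) ≡ Field._+_ 𝔽 (ν m) (ν n)) (ν-* : ∀ m n → ν (m ℕ.* n) ≡ Field._*_ 𝔽 (ν m) (ν n))
    (ν-≢0 : ∀ n .{{_ : NonZero n}} → ν n ≢ Field.0# 𝔽) where

    open FieldProperties 𝔽
    open Solver commutativeSemiring using (solve; _:=_; _:+_; _:*_)
    open RingProperties ring using (-‿distribˡ-*; -‿distribʳ-*; -0#≈0#; -‿involutive)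

    frac : ℕ → ℕ → F
    frac m n = ν m * inv (ν n)

    private
      ν-inv : ∀ n .{{_ : NonZero n}} → ν n * inv (ν n) ≡ 1#
      ν-inv n = inverseʳ (ν-≢0 n)

      insert-unit : ∀ {x u} → u ≡ 1# → x ≡ x * u
      insert-unit {x} refl = sym (*-identityʳ x)

    frac-cross : ∀ {m n k l} .{{_ : NonZero n}} .{{_ : NonZero l}} → m ℕ.* l ≡ k ℕ.* n → frac m n ≡ frac k l
    frac-cross {m} {n} {k} {l} eq = begin
      ν m * inv (ν n)                        ≡⟨ insert-unit (ν-inv l) ⟩
      (ν m * inv (ν n)) * (ν l * inv (ν l))  ≡⟨ solve 4 (λ m n l l′ → (m :* n) :* (l :* l′) := (m :* l) :* (n :* l′)) refl (ν m) (inv (ν n)) (ν l) (inv (ν l)) ⟩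
      (ν m * ν l) * (inv (ν n) * inv (ν l))  ≡⟨ cong (_* (inv (ν n) * inv (ν l))) (trans (sym (ν-* m l)) (trans (cong ν eq) (ν-* k n))) ⟩
      (ν k * ν n) * (inv (ν n) * inv (ν l))  ≡⟨ solve 4 (λ k n n′ l′ → (k :* n) :* (n′ :* l′) := (k :* l′) :* (n :* n′)) refl (ν k) (ν n) (inv (ν n)) (inv (ν l)) ⟩
      (ν k * inv (ν l)) * (ν n * inv (ν n))  ≡⟨ insert-unit (ν-inv n) ⟨
      ν k * inv (ν l) ∎
      where open ≡-Reasoning

    ν-product : ∀ m n .{{_ : NonZero m}} .{{_ : NonZero n}} → (inv (ν m) * inv (ν n)) ≡ inv (ν (m ℕ.* n))
    ν-product m n = begin
      inv (ν m) * inv (ν n)                                            ≡⟨ insert-unit (inverseʳ (ν-≢0 (m ℕ.* n) {{ℕ.m*n≢0 m n}})) ⟩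
      (inv (ν m) * inv (ν n)) * (ν (m ℕ.* n) * inv (ν (m ℕ.* n)))      ≡⟨ cong (λ x → (inv (ν m) * inv (ν n)) * (x * inv (ν (m ℕ.* n)))) (ν-* m n) ⟩
      (inv (ν m) * inv (ν n)) * ((ν m * ν n) * inv (ν (m ℕ.* n)))
        ≡⟨ solve 5 (λ m m′ n n′ i → (m′ :* n′) :* ((m :* n) :* i) := i :* ((m :* m′) :* (n :* n′))) refl (ν m) (inv (ν m)) (ν n) (inv (ν n)) _ ⟩
      inv (ν (m ℕ.* n)) * ((ν m * inv (ν m)) * (ν n * inv (ν n)))      ≡⟨ cong (inv (ν (m ℕ.* n)) *_) (cong₂ _*_ (ν-inv m) (ν-inv n)) ⟩
      inv (ν (m ℕ.* n)) * (1# * 1#)                                    ≡⟨ trans (cong (inv (ν (m ℕ.* n)) *_) (*-identityˡ 1#)) (*-identityʳ _) ⟩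
      inv (ν (m ℕ.* n)) ∎
      where open ≡-Reasoning

    frac-* : ∀ m n k l .{{_ : NonZero n}} .{{_ : NonZero l}} → frac m n * frac k l ≡ frac (m ℕ.* k) (n ℕ.* l)
    frac-* m n k l = begin
      (ν m * inv (ν n)) * (ν k * inv (ν l))   ≡⟨ solve 4 (λ m n k l → (m :* n) :* (k :* l) := (m :* k) :* (n :* l)) refl (ν m) (inv (ν n)) (ν k) (inv (ν l)) ⟩
      (ν m * ν k) * (inv (ν n) * inv (ν l))   ≡⟨ cong₂ _*_ (sym (ν-* m k)) (ν-product n l) ⟩
      frac (m ℕ.* k) (n ℕ.* l) ∎
      where open ≡-Reasoning

    ν-frac : ∀ m → ν m ≡ frac m 1
    ν-frac m = insert-unit (trans (sym (*-identityˡ _)) (trans (cong (_* inv (ν 1)) (sym ν-1)) (ν-inv 1)))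

    ν-sub : ∀ {u w v} → u ≡ w ℕ.+ v → ν u - ν v ≡ ν w
    ν-sub {u} {w} {v} refl = trans (cong (_- ν v) (ν-+ w v)) (trans (+-assoc _ _ _) (trans (cong (ν w +_) (-‿inverseʳ (ν v))) (+-identityʳ _)))

    ν-sub⁻ : ∀ {u w v} → u ≡ w ℕ.+ v → ν v - ν u ≡ - ν w
    ν-sub⁻ {u} {w} {v} refl = begin
      ν v - ν (w ℕ.+ v)                  ≡⟨ +-identityˡ _ ⟨
      0# + (ν v - ν (w ℕ.+ v))           ≡⟨ cong (_+ (ν v - ν (w ℕ.+ v))) (-‿inverseˡ (ν w)) ⟨
      (- ν w + ν w) + (ν v - ν (w ℕ.+ v)) ≡⟨ solve 4 (λ a b c d → (a :+ b) :+ (c :+ d) := a :+ ((b :+ c) :+ d)) refl (- ν w) (ν w) (ν v) (- ν (w ℕ.+ v)) ⟩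
      - ν w + ((ν w + ν v) - ν (w ℕ.+ v)) ≡⟨ cong (- ν w +_) (x-x≡0 (sym (ν-+ w v))) ⟩
      - ν w + 0#                         ≡⟨ +-identityʳ _ ⟩
      - ν w ∎
      where open ≡-Reasoning

    neg-frac : ∀ m n .{{_ : NonZero n}} → (- ν m) * inv (- ν n) ≡ frac m n
    neg-frac m n = begin
      (- ν m) * i                        ≡⟨ insert-unit (ν-inv n) ⟩
      ((- ν m) * i) * (ν n * inv (ν n))  ≡⟨ solve 4 (λ m i n j → (m :* i) :* (n :* j) := (m :* n) :* (i :* j)) refl (- ν m) i (ν n) (inv (ν n)) ⟩
      ((- ν m) * ν n) * (i * inv (ν n))  ≡⟨ cong (_* (i * inv (ν n))) (trans (sym (-‿distribˡ-* (ν m) (ν n))) (-‿distribʳ-* (ν m) (ν n))) ⟩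
      (ν m * (- ν n)) * (i * inv (ν n))  ≡⟨ solve 4 (λ m n i j → (m :* n) :* (i :* j) := (m :* j) :* (n :* i)) refl (ν m) (- ν n) i (inv (ν n)) ⟩
      frac m n * ((- ν n) * i)           ≡⟨ insert-unit (inverseʳ -n≢0) ⟨
      frac m n ∎
      where
      open ≡-Reasoning
      i = inv (- ν n)
      -n≢0 : - ν n ≢ 0#
      -n≢0 eq = ν-≢0 n (trans (sym (-‿involutive (ν n))) (trans (cong -_ eq) -0#≈0#))

    -- With a x = x(x - 1) and b x = x(x + 1), lowering x to x - 1 multiplies
    -- (x - z)/(x + z) by (a x - b z)/(a x - a z).
    a b : ℕ → F
    a x = ν (x ℕ.* pred x)
    b x = ν (x ℕ.* suc x)

    open Interpolation 𝔽 a

    ratio : ℕ → ℕ → F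
    ratio x z = (a x - b z) * inv (a x - a z)

    ratios : ℕ → List ℕ → F
    ratios x []       = 1#
    ratios x (z ∷ zs) = ratio x z * ratios x zs

    cross : ℕ → ℕ → F
    cross x y = frac (x ℕ.∸ y) (x ℕ.+ y)

    crosses : ℕ → List ℕ → F
    crosses x []       = 1#
    crosses x (y ∷ ys) = cross x y * crosses x ys

    -- The claimed number of tableaux, divided by N!.
    density : List ℕ → F
    density []       = 1#
    density (x ∷ xs) = frac 1 (x !) * (crosses x xs * density xs)

    -- The factor by which `density` changes when row `i` is shortened: `ν x` comes from the
    -- factorial, the ratios from the crosses with all the other rows.
    drop : (xs : List ℕ) → Fin (length xs) → F
    drop (x ∷ xs) zero    = ν x * ratios x xs
    drop (x ∷ xs) (suc i) = drop xs i * ratio (lookup xs i) x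

    -- Pairs x > z > 0 with z = y + 1 and d = x - z - 1. In these parameters the differences of `a`
    -- and `b` are natural numbers, and the identities become polynomial ones without subtraction.
    data Gap : ℕ → ℕ → Set where
      gap : ∀ d y → Gap (suc (d ℕ.+ suc y)) (suc y)

    <⇒gap : ∀ {x y} → 0 ℕ.< y → y ℕ.< x → Gap x y
    <⇒gap {x} {suc y} _ y<x = subst (λ x → Gap x (suc y)) (trans (sym (ℕ.+-suc (x ℕ.∸ suc (suc y)) (suc y))) (ℕ.m∸n+n≡m y<x)) (gap (x ℕ.∸ suc (suc y)) y)

    private
      -- With x = d + y + 2 and z = y + 1, this and the next two are a x - a z = (x - z)(x + z - 1),
      -- a x - b z = (x - z - 1)(x + z) and b x - a z = (x - z + 1)(x + z).
      a-diff : ∀ d y → suc (d ℕ.+ suc y) ℕ.* (d ℕ.+ suc y) ≡ suc d ℕ.* (d ℕ.+ suc y ℕ.+ suc y) ℕ.+ suc y ℕ.* y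
      a-diff = solve-∀

      ab-diff : ∀ d y → suc (d ℕ.+ suc y) ℕ.* (d ℕ.+ suc y) ≡ d ℕ.* (suc (d ℕ.+ suc y) ℕ.+ suc y) ℕ.+ suc y ℕ.* suc (suc y)
      ab-diff = solve-∀

      ba-diff : ∀ d y → suc (d ℕ.+ suc y) ℕ.* suc (suc (d ℕ.+ suc y)) ≡ suc (suc d) ℕ.* (suc (d ℕ.+ suc y) ℕ.+ suc y) ℕ.+ suc y ℕ.* y
      ba-diff = solve-∀

    ratio-below : ∀ d y → ratio (suc (d ℕ.+ suc y)) (suc y) ≡ frac (d ℕ.* (suc (d ℕ.+ suc y) ℕ.+ suc y)) (suc d ℕ.* (d ℕ.+ suc y ℕ.+ suc y))
    ratio-below d y = cong₂ (λ u v → u * inv v) (ν-sub (ab-diff d y)) (ν-sub (a-diff d y))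

    private
      instance
        nonZero-sum : ∀ {m n} → NonZero (m ℕ.+ suc n)
        nonZero-sum {m} {n} = ℕ.>-nonZero (ℕ.≤-trans (s≤s z≤n) (ℕ.m≤n+m (suc n) m))

      nonZero-product : ∀ d y → NonZero (suc d ℕ.* (d ℕ.+ suc y ℕ.+ suc y))
      nonZero-product d y = ℕ.m*n≢0 (suc d) (d ℕ.+ suc y ℕ.+ suc y)

    -- Numerator and denominator are both negative here, and the signs cancel.
    ratio-above : ∀ d y → ratio (suc y) (suc (d ℕ.+ suc y)) ≡ frac (suc (suc d) ℕ.* (suc (d ℕ.+ suc y) ℕ.+ suc y)) (suc d ℕ.* (d ℕ.+ suc y ℕ.+ suc y))
    ratio-above d y = trans (cong₂ (λ u v → u * inv v) (ν-sub⁻ (ba-diff d y)) (ν-sub⁻ (a-diff d y)))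
      (neg-frac (suc (suc d) ℕ.* (suc (d ℕ.+ suc y) ℕ.+ suc y)) (suc d ℕ.* (d ℕ.+ suc y ℕ.+ suc y)) {{nonZero-product d y}})

    a-distinct : ∀ {x y} → 0 ℕ.< y → y ℕ.< x → a y ≢ a x
    a-distinct 0<y y<x eq with <⇒gap 0<y y<x
    ... | gap d y = ν-≢0 _ {{nonZero-product d y}} (trans (sym (ν-sub (a-diff d y))) (x-x≡0 (sym eq)))

    cross-pred : ∀ {x z} → 0 ℕ.< z → z ℕ.< x → cross (pred x) z ≡ cross x z * ratio x z
    cross-pred 0<z z<x with <⇒gap 0<z z<x
    ... | gap d z = sym (begin
        frac (suc (d ℕ.+ suc z) ℕ.∸ suc z) (suc (d ℕ.+ suc z) ℕ.+ suc z) * ratio (suc (d ℕ.+ suc z)) (suc z)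
          ≡⟨ cong₂ (λ m r → frac m (suc (d ℕ.+ suc z) ℕ.+ suc z) * r) (ℕ.m+n∸n≡m (suc d) (suc z)) (ratio-below d z) ⟩
        frac (suc d) (suc (d ℕ.+ suc z) ℕ.+ suc z) * frac (d ℕ.* (suc (d ℕ.+ suc z) ℕ.+ suc z)) (suc d ℕ.* (d ℕ.+ suc z ℕ.+ suc z))
          ≡⟨ frac-* (suc d) (suc (d ℕ.+ suc z) ℕ.+ suc z) _ _ {{_}} {{nonZero-product d z}} ⟩
        _ ≡⟨ frac-cross {n = (suc (d ℕ.+ suc z) ℕ.+ suc z) ℕ.* (suc d ℕ.* (d ℕ.+ suc z ℕ.+ suc z))} {k = d} {l = d ℕ.+ suc z ℕ.+ suc z}
               {{ℕ.m*n≢0 (suc (d ℕ.+ suc z) ℕ.+ suc z) _ {{_}} {{nonZero-product d z}}}} (eq d z) ⟩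
        frac d (d ℕ.+ suc z ℕ.+ suc z)
          ≡⟨ cong (λ m → frac m (d ℕ.+ suc z ℕ.+ suc z)) (ℕ.m+n∸n≡m d (suc z)) ⟨
        frac (d ℕ.+ suc z ℕ.∸ suc z) (d ℕ.+ suc z ℕ.+ suc z) ∎)
      where
      open ≡-Reasoning
      eq : ∀ d z → (suc d ℕ.* (d ℕ.* (suc (d ℕ.+ suc z) ℕ.+ suc z))) ℕ.* (d ℕ.+ suc z ℕ.+ suc z) ≡ d ℕ.* ((suc (d ℕ.+ suc z) ℕ.+ suc z) ℕ.* (suc d ℕ.* (d ℕ.+ suc z ℕ.+ suc z)))
      eq = solve-∀

    cross-predʳ : ∀ {x y} → 0 ℕ.< y → y ℕ.< x → cross x (pred y) ≡ cross x y * ratio y x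
    cross-predʳ 0<y y<x with <⇒gap 0<y y<x
    ... | gap d y = sym (begin
        frac (suc (d ℕ.+ suc y) ℕ.∸ suc y) (suc (d ℕ.+ suc y) ℕ.+ suc y) * ratio (suc y) (suc (d ℕ.+ suc y))
          ≡⟨ cong₂ (λ m r → frac m (suc (d ℕ.+ suc y) ℕ.+ suc y) * r) (ℕ.m+n∸n≡m (suc d) (suc y)) (ratio-above d y) ⟩
        frac (suc d) (suc (d ℕ.+ suc y) ℕ.+ suc y) * frac (suc (suc d) ℕ.* (suc (d ℕ.+ suc y) ℕ.+ suc y)) (suc d ℕ.* (d ℕ.+ suc y ℕ.+ suc y))
          ≡⟨ frac-* (suc d) (suc (d ℕ.+ suc y) ℕ.+ suc y) _ _ {{_}} {{nonZero-product d y}} ⟩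
        _ ≡⟨ frac-cross {n = (suc (d ℕ.+ suc y) ℕ.+ suc y) ℕ.* (suc d ℕ.* (d ℕ.+ suc y ℕ.+ suc y))} {k = suc (suc d)} {l = suc (d ℕ.+ suc y) ℕ.+ y}
               {{ℕ.m*n≢0 (suc (d ℕ.+ suc y) ℕ.+ suc y) _ {{_}} {{nonZero-product d y}}}} (eq d y) ⟩
        frac (suc (suc d)) (suc (d ℕ.+ suc y) ℕ.+ y)
          ≡⟨ cong (λ m → frac m (suc (d ℕ.+ suc y) ℕ.+ y)) (trans (cong (ℕ._∸ y) (cong suc (ℕ.+-suc d y))) (ℕ.m+n∸n≡m (suc (suc d)) y)) ⟨
        frac (suc (d ℕ.+ suc y) ℕ.∸ y) (suc (d ℕ.+ suc y) ℕ.+ y) ∎)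
      where
      open ≡-Reasoning
      eq : ∀ d y → (suc d ℕ.* (suc (suc d) ℕ.* (suc (d ℕ.+ suc y) ℕ.+ suc y))) ℕ.* (suc (d ℕ.+ suc y) ℕ.+ y) ≡ suc (suc d) ℕ.* ((suc (d ℕ.+ suc y) ℕ.+ suc y) ℕ.* (suc d ℕ.* (d ℕ.+ suc y ℕ.+ suc y)))
      eq = solve-∀

    private
      a-b : ∀ x → a x - b x ≡ (- ν 2) * ν x
      a-b x = trans (ν-sub⁻ (double x)) (trans (cong -_ (ν-* 2 x)) (-‿distribˡ-* (ν 2) (ν x)))
        where
        double : ∀ x → x ℕ.* suc x ≡ 2 ℕ.* x ℕ.+ x ℕ.* pred x
        double zero    = refl
        double (suc x) = eq x
          where
          eq : ∀ x → suc x ℕ.* suc (suc x) ≡ 2 ℕ.* suc x ℕ.+ suc x ℕ.* x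
          eq = solve-∀

      -2≢0 : - ν 2 ≢ 0#
      -2≢0 eq = ν-≢0 2 (trans (sym (-‿involutive (ν 2))) (trans (cong -_ eq) -0#≈0#))

    poly-cofactor : ∀ x zs → poly b zs (a x) * cofactor x zs ≡ ratios x zs
    poly-cofactor x [] = *-identityˡ 1#
    poly-cofactor x (z ∷ zs) = trans
      (solve 4 (λ d p i c → (d :* p) :* (i :* c) := (d :* i) :* (p :* c)) refl (a x - b z) (poly b zs (a x)) (inv (a x - a z)) (cofactor x zs))
      (cong (ratio x z *_) (poly-cofactor x zs))

    -- The polynomial has one factor more than the weight, the one that belongs to row `i` itself.
    -- It equals -2 times the row length; all other factors pair up into ratios.
    poly-weight : ∀ xs i → poly b xs (a (lookup xs i)) * weight xs i ≡ (- ν 2) * drop xs i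
    poly-weight (x ∷ xs) zero = begin
      ((a x - b x) * poly b xs (a x)) * cofactor x xs   ≡⟨ *-assoc _ _ _ ⟩
      (a x - b x) * (poly b xs (a x) * cofactor x xs)   ≡⟨ cong₂ _*_ (a-b x) (poly-cofactor x xs) ⟩
      ((- ν 2) * ν x) * ratios x xs                     ≡⟨ *-assoc _ _ _ ⟩
      (- ν 2) * (ν x * ratios x xs) ∎
      where open ≡-Reasoning
    poly-weight (x ∷ xs) (suc i) = begin
      ((t - b x) * poly b xs t) * (weight xs i * inv (t - a x))
        ≡⟨ solve 4 (λ d p w j → (d :* p) :* (w :* j) := (p :* w) :* (d :* j)) refl (t - b x) (poly b xs t) (weight xs i) (inv (t - a x)) ⟩
      (poly b xs t * weight xs i) * ratio (lookup xs i) x   ≡⟨ cong (_* ratio (lookup xs i) x) (poly-weight xs i) ⟩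
      ((- ν 2) * drop xs i) * ratio (lookup xs i) x         ≡⟨ *-assoc _ _ _ ⟩
      (- ν 2) * (drop xs i * ratio (lookup xs i) x) ∎
      where
      open ≡-Reasoning
      t = a (lookup xs i)

    total-self : ∀ xs → total b xs xs ≡ (- ν 2) * ν (sum xs)
    total-self [] = sym (trans (cong ((- ν 2) *_) ν-0) (zeroʳ _))
    total-self (x ∷ xs) = trans (cong₂ _+_ (a-b x) (total-self xs))
      (trans (sym (distribˡ (- ν 2) (ν x) (ν (sum xs)))) (cong ((- ν 2) *_) (sym (ν-+ x (sum xs)))))

    -- Both sides of the interpolation identity carry the factor -2 from `a-b`; cancelling it leaves
    -- the number of boxes.
    drop-sum : ∀ xs → Distinct xs → Σ {length xs} (drop xs) ≡ ν (sum xs)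
    drop-sum xs dist = *-cancelˡ -2≢0 (begin
      (- ν 2) * Σ {length xs} (drop xs)                  ≡⟨ *-distribˡ-sum {length xs} (- ν 2) (drop xs) ⟩
      Σ {length xs} (λ i → (- ν 2) * drop xs i)          ≡⟨ sum-cong-≗ {length xs} (poly-weight xs) ⟨
      lagrange (poly b xs) xs                            ≡⟨ lagrange-poly-total b xs xs dist refl ⟩
      total b xs xs                                      ≡⟨ total-self xs ⟩
      (- ν 2) * ν (sum xs) ∎)
      where
      open ≡-Reasoning
      *-cancelˡ : ∀ {c x y} → c ≢ 0# → c * x ≡ c * y → x ≡ y
      *-cancelˡ {c} {x} {y} c≢0 eq = trans (undo x) (trans (cong (inv c *_) eq) (sym (undo y)))
        where
        undo : ∀ x → x ≡ inv c * (c * x)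
        undo x = trans (sym (*-identityˡ x)) (trans (cong (_* x) (sym (trans (*-comm (inv c) c) (inverseʳ c≢0)))) (*-assoc (inv c) c x))

    Smaller : ℕ → List ℕ → Set
    Smaller x = All (λ y → 0 ℕ.< y × y ℕ.< x)

    smaller : ∀ x xs → Strict (x ∷ xs) → Smaller x xs
    smaller x [] _ = []
    smaller x (y ∷ ys) (y<x , s) = (ℕ.≤-<-trans z≤n (proj₁ s) , y<x) ∷ All.map (λ (0<z , z<y) → 0<z , ℕ.<-trans z<y y<x) (smaller y ys s)

    strict-distinct : ∀ xs → Strict xs → Distinct xs
    strict-distinct [] _ = tt
    strict-distinct (x ∷ xs) s = (λ i → let 0<y , y<x = All.lookup (smaller x xs s) (∈-lookup i) in a-distinct 0<y y<x) , strict-distinct xs (proj₂ s)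

    crosses-pred : ∀ x xs → Smaller x xs → crosses (pred x) xs ≡ crosses x xs * ratios x xs
    crosses-pred x [] _ = sym (*-identityˡ 1#)
    crosses-pred x (z ∷ zs) ((0<z , z<x) ∷ small) = trans (cong₂ _*_ (cross-pred 0<z z<x) (crosses-pred x zs small))
      (solve 4 (λ c r d s → (c :* r) :* (d :* s) := (c :* d) :* (r :* s)) refl (cross x z) (ratio x z) (crosses x zs) (ratios x zs))

    cross-0 : ∀ x .{{_ : NonZero x}} → cross x 0 ≡ 1#
    cross-0 x = trans (cong (frac x) (ℕ.+-identityʳ x)) (inverseʳ (ν-≢0 x))

    crosses-shorten : ∀ x xs → Smaller x xs → Strict xs → ∀ i → crosses x (shorten (toℕ i) xs) ≡ crosses x xs * ratio (lookup xs i) x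
    -- The deleted row may be treated as a row of length 0, since its cross with `x` is 1.
    crosses-shorten x (suc zero ∷ []) ((0<y , y<x) ∷ []) s zero = begin
      1#                                   ≡⟨ cross-0 x {{ℕ.>-nonZero (ℕ.<-trans 0<y y<x)}} ⟨
      cross x 0                            ≡⟨ cross-predʳ 0<y y<x ⟩
      cross x 1 * ratio 1 x                ≡⟨ cong (_* ratio 1 x) (*-identityʳ (cross x 1)) ⟨
      (cross x 1 * 1#) * ratio 1 x ∎
      where open ≡-Reasoning
    crosses-shorten x (suc zero ∷ zero ∷ ys) small (_ , () , _) zero
    crosses-shorten x (suc zero ∷ suc y ∷ ys) small (s≤s () , _) zero
    crosses-shorten x (suc (suc y) ∷ ys) ((0<y , y<x) ∷ _) s zero = trans (cong (_* crosses x ys) (cross-predʳ 0<y y<x))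
      (solve 3 (λ c r d → (c :* r) :* d := (c :* d) :* r) refl (cross x (suc (suc y))) (ratio (suc (suc y)) x) (crosses x ys))
    crosses-shorten x (y ∷ ys) (_ ∷ small) (_ , s) (suc i) =
      trans (cong (cross x y *_) (crosses-shorten x ys small s i)) (sym (*-assoc _ _ _))

    private
      frac-! : ∀ x → frac 1 (suc x !) * ν (suc x) ≡ frac 1 (x !)
      frac-! x = trans (cong (frac 1 (suc x !) *_) (ν-frac (suc x))) (trans (frac-* 1 (suc x !) (suc x) 1 {{ℕ._!≢0 (suc x)}})
        (frac-cross {n = suc x ! ℕ.* 1} {l = x !} {{ℕ.m*n≢0 (suc x !) 1 {{ℕ._!≢0 (suc x)}}}} {{ℕ._!≢0 x}} (eq x (x !))))
        where
        eq : ∀ x f → (1 ℕ.* suc x) ℕ.* f ≡ 1 ℕ.* ((f ℕ.+ x ℕ.* f) ℕ.* 1)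
        eq = solve-∀

    density-pred : ∀ x xs → Smaller (suc x) xs → frac 1 (x !) * (crosses x xs * density xs) ≡ density (suc x ∷ xs) * drop (suc x ∷ xs) zero
    density-pred x xs small = trans (cong₂ (λ u v → u * (v * density xs)) (sym (frac-! x)) (crosses-pred (suc x) xs small))
      (solve 5 (λ f n c r h → (f :* n) :* ((c :* r) :* h) := (f :* (c :* h)) :* (n :* r)) refl
        (frac 1 (suc x !)) (ν (suc x)) (crosses (suc x) xs) (ratios (suc x) xs) (density xs))

    density-corner : ∀ xs → Strict xs → ∀ i → Corner (toℕ i) xs → density (shorten (toℕ i) xs) ≡ density xs * drop xs i
    density-corner (suc zero ∷ []) s zero c = trans (sym unit) (density-pred 0 [] [])
      where
      unit : frac 1 1 * (1# * 1#) ≡ 1#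
      unit = trans (cong (frac 1 1 *_) (*-identityˡ 1#)) (trans (*-identityʳ _) (inverseʳ (ν-≢0 1)))
    density-corner (suc zero ∷ zero ∷ xs) (_ , () , _) zero c
    density-corner (suc zero ∷ suc y ∷ xs) (s≤s () , _) zero c
    density-corner (suc (suc x) ∷ xs) s zero c = density-pred (suc x) xs (smaller (suc (suc x)) xs s)
    density-corner (x ∷ xs) s (suc i) c = trans
      (cong₂ (λ u v → frac 1 (x !) * (u * v)) (crosses-shorten x xs (smaller x xs s) (proj₂ s) i) (density-corner xs (proj₂ s) i c))
      (solve 5 (λ f q r h d → f :* ((q :* r) :* (h :* d)) := (f :* (q :* h)) :* (d :* r)) refl
        (frac 1 (x !)) (crosses x xs) (ratio (lookup xs i) x) (density xs) (drop xs i))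

    -- If a row of a strict shape cannot be shortened, the next row is shorter by exactly 1, and the
    -- cross of the two has numerator 0 after the shortening. Hence the rows omitted by `fillings`
    -- may be included in the sum.
    density-non-corner : ∀ xs → Strict xs → ∀ i → ¬ Corner (toℕ i) xs → 0# ≡ density xs * drop xs i
    density-non-corner (suc zero ∷ []) s zero ¬c = contradiction z≤n ¬c
    density-non-corner (suc zero ∷ zero ∷ xs) (_ , () , _) zero ¬c
    density-non-corner (suc zero ∷ suc y ∷ xs) (s≤s () , _) zero ¬c
    density-non-corner (suc (suc x) ∷ []) s zero ¬c = contradiction z≤n ¬c
    density-non-corner (suc (suc x) ∷ y ∷ ys) s zero ¬c = begin
      0#                                                                       ≡⟨ zeroʳ _ ⟨
      frac 1 (suc x !) * 0#                                                    ≡⟨ cong (frac 1 (suc x !) *_) (trans (cong (_* density (y ∷ ys)) (trans (cong (_* crosses (suc x) ys) cross≡0) (zeroˡ _))) (zeroˡ _)) ⟨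
      frac 1 (suc x !) * (crosses (suc x) (y ∷ ys) * density (y ∷ ys))          ≡⟨ density-pred (suc x) (y ∷ ys) (smaller (suc (suc x)) (y ∷ ys) s) ⟩
      _ ∎
      where
      open ≡-Reasoning
      cross≡0 : cross (suc x) y ≡ 0#
      cross≡0 = trans (cong (λ m → frac m (suc x ℕ.+ y)) (ℕ.m≤n⇒m∸n≡0 (ℕ.≰⇒> ¬c))) (trans (cong (_* inv (ν (suc x ℕ.+ y))) ν-0) (zeroˡ _))
    density-non-corner (x ∷ xs) s (suc i) ¬c = begin
      0#                                                    ≡⟨ zeroˡ _ ⟨
      0# * (frac 1 (x !) * (crosses x xs * r))              ≡⟨ cong (_* (frac 1 (x !) * (crosses x xs * r))) (density-non-corner xs (proj₂ s) i ¬c) ⟩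
      (density xs * drop xs i) * (frac 1 (x !) * (crosses x xs * r))
        ≡⟨ solve 5 (λ f q r h d → (h :* d) :* (f :* (q :* r)) := (f :* (q :* h)) :* (d :* r)) refl (frac 1 (x !)) (crosses x xs) r (density xs) (drop xs i) ⟩
      density (x ∷ xs) * (drop xs i * r) ∎
      where
      open ≡-Reasoning
      r = ratio (lookup xs i) x

    ν-sum : ∀ {m} (f : Fin m → ℕ) → ν (ℕΣ.sum f) ≡ Σ (λ i → ν (f i))
    ν-sum {zero} f = ν-0
    ν-sum {suc m} f = trans (ν-+ (f zero) _) (cong (ν (f zero) +_) (ν-sum (f ∘ suc)))

    -- By induction row `i` contributes `ν (k !) * density xs * drop xs i`, with 0 on both sides at
    -- rows that are not corners; the drops add up to the number `suc k` of boxes.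
    fillings-formula : ∀ k xs → Strict xs → sum xs ≡ k → ν (fillings k xs) ≡ ν (k !) * density xs
    fillings-formula zero xs s eq with strict-empty xs s eq
    ... | refl = sym (*-identityʳ (ν 1))
    fillings-formula (suc k) xs s eq = begin
      ν (ℕΣ.sum {length xs} size)                                ≡⟨ ν-sum {length xs} size ⟩
      Σ {length xs} (λ i → ν (size i))                           ≡⟨ sum-cong-≗ {length xs} (λ i → term i (corner? (toℕ i) xs)) ⟩
      Σ {length xs} (λ i → (ν (k !) * density xs) * drop xs i)   ≡⟨ *-distribˡ-sum {length xs} (ν (k !) * density xs) (drop xs) ⟨
      (ν (k !) * density xs) * Σ {length xs} (drop xs)           ≡⟨ cong ((ν (k !) * density xs) *_) (trans (drop-sum xs (strict-distinct xs s)) (cong ν eq)) ⟩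
      (ν (k !) * density xs) * ν (suc k)                         ≡⟨ solve 3 (λ f h n → (f :* h) :* n := (n :* f) :* h) refl (ν (k !)) (density xs) (ν (suc k)) ⟩
      (ν (suc k) * ν (k !)) * density xs                         ≡⟨ cong (_* density xs) (ν-* (suc k) (k !)) ⟨
      ν (suc k !) * density xs ∎
      where
      open ≡-Reasoning
      size : Fin (length xs) → ℕ
      size i = if does (corner? (toℕ i) xs) then fillings k (shorten (toℕ i) xs) else 0
      term : ∀ i → Dec (Corner (toℕ i) xs) → ν (size i) ≡ (ν (k !) * density xs) * drop xs i
      term i (yes c) = begin
        ν (size i)                              ≡⟨ cong (λ b → ν (if b then fillings k (shorten (toℕ i) xs) else 0)) (dec-true (corner? (toℕ i) xs) c) ⟩
        ν (fillings k (shorten (toℕ i) xs))     ≡⟨ fillings-formula k (shorten (toℕ i) xs) (strict-shorten (toℕ i) xs s c)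
                                                     (ℕ.suc-injective (trans (sum-shorten (toℕ i) xs (strict-positive xs s (toℕ i) (toℕ<n i))) eq)) ⟩
        ν (k !) * density (shorten (toℕ i) xs)  ≡⟨ cong (ν (k !) *_) (density-corner xs s i c) ⟩
        ν (k !) * (density xs * drop xs i)      ≡⟨ *-assoc _ _ _ ⟨
        (ν (k !) * density xs) * drop xs i ∎
      term i (no ¬c) = begin
        ν (size i)                              ≡⟨ cong (λ b → ν (if b then fillings k (shorten (toℕ i) xs) else 0)) (dec-false (corner? (toℕ i) xs) ¬c) ⟩
        ν 0                                     ≡⟨ ν-0 ⟩
        0#                                      ≡⟨ zeroʳ _ ⟨
        ν (k !) * 0#                            ≡⟨ cong (ν (k !) *_) (density-non-corner xs s i ¬c) ⟩
        ν (k !) * (density xs * drop xs i)      ≡⟨ *-assoc _ _ _ ⟨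
        (ν (k !) * density xs) * drop xs i ∎

    staircase : ℕ → List ℕ
    staircase zero    = []
    staircase (suc m) = suc m ∷ staircase m

    -- The product of (x - y)/(x + y) over y = 1, ..., j for x = d + j + 1. With `d` free, the
    -- induction on `j` can hold x fixed: `d` grows as `j` falls.
    crosses-staircase : ∀ d j → crosses (suc (d ℕ.+ j)) (staircase j) ≡ frac ((d ℕ.+ j) ! ℕ.* suc (d ℕ.+ j) !) ((suc (d ℕ.+ j) ℕ.+ j) ! ℕ.* d !)
    crosses-staircase d zero rewrite ℕ.+-identityʳ d | ℕ.+-identityʳ d = sym (begin
      frac (d ! ℕ.* suc d !) (suc d ! ℕ.* d !)  ≡⟨ cong (λ m → frac m (suc d ! ℕ.* d !)) (ℕ.*-comm (d !) (suc d !)) ⟩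
      frac (suc d ! ℕ.* d !) (suc d ! ℕ.* d !)  ≡⟨ inverseʳ (ν-≢0 _ {{ℕ.m*n≢0 (suc d !) (d !) {{ℕ._!≢0 (suc d)}} {{ℕ._!≢0 d}}}}) ⟩
      1# ∎)
      where open ≡-Reasoning
    crosses-staircase d (suc j) = begin
      cross x (suc j) * crosses x (staircase j)
        ≡⟨ cong₂ _*_ (cong (λ m → frac m (x ℕ.+ suc j)) (ℕ.m+n∸n≡m (suc d) (suc j)))
             (trans (cong (λ y → crosses (suc y) (staircase j)) (ℕ.+-suc d j)) (crosses-staircase (suc d) j)) ⟩
      frac (suc d) (x ℕ.+ suc j) * frac ((suc d ℕ.+ j) ! ℕ.* suc (suc d ℕ.+ j) !) ((suc (suc d ℕ.+ j) ℕ.+ j) ! ℕ.* suc d !)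
        ≡⟨ cong (λ y → frac (suc d) (x ℕ.+ suc j) * frac (y ! ℕ.* suc y !) ((suc y ℕ.+ j) ! ℕ.* suc d !)) (sym (ℕ.+-suc d j)) ⟩
      frac (suc d) (x ℕ.+ suc j) * frac ((d ℕ.+ suc j) ! ℕ.* x !) ((x ℕ.+ j) ! ℕ.* suc d !)
        ≡⟨ frac-* (suc d) (x ℕ.+ suc j) _ _ {{_}} {{nz}} ⟩
      frac (suc d ℕ.* ((d ℕ.+ suc j) ! ℕ.* x !)) ((x ℕ.+ suc j) ℕ.* ((x ℕ.+ j) ! ℕ.* suc d !))
        ≡⟨ frac-cross {n = (x ℕ.+ suc j) ℕ.* ((x ℕ.+ j) ! ℕ.* suc d !)} {l = (x ℕ.+ suc j) ! ℕ.* d !} {{ℕ.m*n≢0 (x ℕ.+ suc j) _ {{_}} {{nz}}}}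
             {{ℕ.m*n≢0 ((x ℕ.+ suc j) !) (d !) {{ℕ._!≢0 (x ℕ.+ suc j)}} {{ℕ._!≢0 d}}}} eq ⟩
      frac ((d ℕ.+ suc j) ! ℕ.* x !) ((x ℕ.+ suc j) ! ℕ.* d !) ∎
      where
      open ≡-Reasoning
      x = suc (d ℕ.+ suc j)
      nz : NonZero ((x ℕ.+ j) ! ℕ.* suc d !)
      nz = ℕ.m*n≢0 ((x ℕ.+ j) !) (suc d !) {{ℕ._!≢0 (x ℕ.+ j)}} {{ℕ._!≢0 (suc d)}}
      arrange : ∀ s D f y F → (s ℕ.* f) ℕ.* ((y ℕ.* F) ℕ.* D) ≡ f ℕ.* (y ℕ.* (F ℕ.* (s ℕ.* D)))
      arrange = solve-∀
      eq : (suc d ℕ.* ((d ℕ.+ suc j) ! ℕ.* x !)) ℕ.* ((x ℕ.+ suc j) ! ℕ.* d !) ≡ ((d ℕ.+ suc j) ! ℕ.* x !) ℕ.* ((x ℕ.+ suc j) ℕ.* ((x ℕ.+ j) ! ℕ.* suc d !))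
      eq = trans (cong (λ f → (suc d ℕ.* ((d ℕ.+ suc j) ! ℕ.* x !)) ℕ.* (f ℕ.* d !)) top)
             (arrange (suc d) (d !) ((d ℕ.+ suc j) ! ℕ.* x !) (x ℕ.+ suc j) ((x ℕ.+ j) !))
        where
        top : (x ℕ.+ suc j) ! ≡ (x ℕ.+ suc j) ℕ.* (x ℕ.+ j) !
        top = cong (λ y → (x ℕ.+ suc j) ℕ.* y !) (ℕ.+-suc (d ℕ.+ suc j) j)

    -- At `d` = 0 the numerator of the crosses contains `suc m !`, which cancels the factorial of
    -- the new row and leaves a single factor of the product formula.
    density-staircase : ∀ m → density (staircase (suc m)) ≡ density (staircase m) * frac (m !) ((2 ℕ.* m ℕ.+ 1) !)
    density-staircase m = begin
      frac 1 (suc m !) * (crosses (suc m) (staircase m) * density (staircase m))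
        ≡⟨ solve 3 (λ f c h → f :* (c :* h) := h :* (f :* c)) refl (frac 1 (suc m !)) (crosses (suc m) (staircase m)) (density (staircase m)) ⟩
      density (staircase m) * (frac 1 (suc m !) * crosses (suc m) (staircase m))
        ≡⟨ cong (λ c → density (staircase m) * (frac 1 (suc m !) * c)) (crosses-staircase 0 m) ⟩
      density (staircase m) * (frac 1 (suc m !) * frac (m ! ℕ.* suc m !) ((suc m ℕ.+ m) ! ℕ.* 1))
        ≡⟨ cong (density (staircase m) *_) (trans (frac-* 1 (suc m !) _ _ {{ℕ._!≢0 (suc m)}} {{nz}})
             (frac-cross {n = suc m ! ℕ.* ((suc m ℕ.+ m) ! ℕ.* 1)} {l = (2 ℕ.* m ℕ.+ 1) !} {{ℕ.m*n≢0 (suc m !) _ {{ℕ._!≢0 (suc m)}} {{nz}}}} {{ℕ._!≢0 (2 ℕ.* m ℕ.+ 1)}}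
               (trans (cong (λ y → (1 ℕ.* (m ! ℕ.* suc m !)) ℕ.* y !) (index m)) (arrange (m !) (suc m !) ((suc m ℕ.+ m) !))))) ⟩
      density (staircase m) * frac (m !) ((2 ℕ.* m ℕ.+ 1) !) ∎
      where
      open ≡-Reasoning
      nz : NonZero ((suc m ℕ.+ m) ! ℕ.* 1)
      nz = ℕ.m*n≢0 ((suc m ℕ.+ m) !) 1 {{ℕ._!≢0 (suc m ℕ.+ m)}}
      index : ∀ m → 2 ℕ.* m ℕ.+ 1 ≡ suc m ℕ.+ m
      index = solve-∀
      arrange : ∀ f g h → (1 ℕ.* (f ℕ.* g)) ℕ.* h ≡ f ℕ.* (g ℕ.* (h ℕ.* 1))
      arrange = solve-∀

-- Standard Young tableaux with bijective fillings as tableaux on the triangle.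

module StandardTableaux where

  open import Defs
  open import Data.Fin.Base using (Fin; toℕ; fromℕ<; _<_)
  open import Data.Fin.Properties using (toℕ-injective; toℕ-fromℕ<; toℕ<n; _<?_)
  open import Data.Nat.Base as ℕ using (ℕ)
  import Data.Nat.Properties as ℕ
  open import Data.Nat.Combinatorics using (_C_)
  open import Data.Product.Base using (_×_; _,_; ∃; ∃₂)
  open import Function.Bundles using (mk⤖; Bijection; Inverse)
  open import Relation.Binary.PropositionalEquality using (_≡_; refl; sym; trans; cong; subst; subst₂)
  open import Relation.Nullary.Decidable using (yes; no; recompute)
  open import Relation.Nullary.Negation using (contradiction)
  open Cardinality
  open Tableaux

  module _ {n : ℕ} where

    module _ (T : SYT n) where
      private
        module T = SYT T

      value : Fin n → Fin n → ℕ
      value a b with a <? b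
      ... | yes a<b = toℕ (T.entry (box a b a<b))
      ... | no _    = 0

      value-entry : ∀ {a b} .(a<b : a < b) → value a b ≡ toℕ (T.entry (box a b a<b))
      value-entry {a} {b} a<b with a <? b
      ... | yes _ = refl
      ... | no a≮b = contradiction (recompute (a <? b) a<b) a≮b

      fromSYT : Tableau (Triangle n) (n C 2)
      fromSYT = fromFins value
        (λ a<b → subst (ℕ._< n C 2) (sym (value-entry a<b)) (toℕ<n _))
        (λ {a} {b} {c} {d} a<b c<d eq → let boxes = Bijection.injective T.filling {box a b a<b} {box c d c<d}
                                                      (toℕ-injective (trans (sym (value-entry a<b)) (trans eq (value-entry c<d))))
                                        in cong Box.row boxes , cong Box.col boxes)
        surjective
        (λ {a} {b} {c} a<b a<c b<c → subst₂ ℕ._<_ (sym (value-entry a<b)) (sym (value-entry a<c)) (T.row-increasing a<b a<c b<c))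
        (λ {a} {b} {c} a<c b<c a<b → subst₂ ℕ._<_ (sym (value-entry a<c)) (sym (value-entry b<c)) (T.col-increasing a<c b<c a<b))
        where
        surjective : ∀ {k} → k ℕ.< n C 2 → ∃₂ λ a b → a < b × value a b ≡ k
        surjective k< with Bijection.strictlySurjective T.filling (fromℕ< k<)
        ... | box a b a<b , eq = a , b , recompute (a <? b) a<b , trans (value-entry a<b) (trans (cong toℕ eq) (toℕ-fromℕ< k<))

      e-fromSYT : ∀ {a b} .(a<b : a < b) → e fromSYT (toℕ a) (toℕ b) ≡ toℕ (T.entry (box a b a<b))
      e-fromSYT {a} {b} a<b = trans (extend-toℕ value a b) (value-entry a<b)

    module _ (T : Tableau (Triangle n) (n C 2)) where
      private
        at : Box n → Fin (n C 2)
        at (box a b a<b) = fromℕ< (bound T {toℕ a} {toℕ b} (a<b , toℕ<n b))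

        toℕ-at : ∀ {a b} .(a<b : a < b) → toℕ (at (box a b a<b)) ≡ e T (toℕ a) (toℕ b)
        toℕ-at {a} {b} a<b = toℕ-fromℕ< (bound T {toℕ a} {toℕ b} (recompute (a <? b) a<b , toℕ<n b))

        box-≡ : ∀ {a b c d} .(p : a < b) .(q : c < d) → a ≡ c × b ≡ d → box {n} a b p ≡ box c d q
        box-≡ p q (refl , refl) = refl

        at-injective : ∀ {x y} → at x ≡ at y → x ≡ y
        at-injective {box a b p} {box c d q} eq =
          let i , j = inj T (recompute (a <? b) p , toℕ<n b) (recompute (c <? d) q , toℕ<n d) (trans (sym (toℕ-at p)) (trans (cong toℕ eq) (toℕ-at q)))
          in box-≡ p q (toℕ-injective i , toℕ-injective j)

        at-surjective : ∀ k → ∃ λ x → at x ≡ k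
        at-surjective k with surj T (toℕ<n k)
        ... | i , j , m , eq with triangle-fins m
        ...   | fins {a} {b} a<b = box a b a<b , toℕ-injective (trans (toℕ-at a<b) eq)

      toSYT : SYT n
      toSYT = record
        { filling = mk⤖ (at-injective , λ k → let x , eq = at-surjective k in x , λ { refl → eq })
        ; row-increasing = λ {i} {j} {k} i<j i<k j<k → subst₂ ℕ._<_ (sym (toℕ-at i<j)) (sym (toℕ-at i<k))
            (row T (recompute (i <? j) i<j , toℕ<n j) (recompute (i <? k) i<k , toℕ<n k) j<k)
        ; col-increasing = λ {i} {j} {k} i<k j<k i<j → subst₂ ℕ._<_ (sym (toℕ-at i<k)) (sym (toℕ-at j<k))
            (col T (recompute (i <? k) i<k , toℕ<n k) (recompute (j <? k) j<k , toℕ<n k) i<j)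
        }

      fromSYT-toSYT : ∀ {i j} → Triangle n i j → e (fromSYT toSYT) i j ≡ e T i j
      fromSYT-toSYT m with triangle-fins m
      ... | fins a<b = trans (e-fromSYT toSYT a<b) (toℕ-at a<b)

    SYT↔tableaux : Inverse (standardYoungTableaux n) (tableaux (Triangle n) (n C 2))
    SYT↔tableaux = mkInverse (standardYoungTableaux n) (tableaux (Triangle n) (n C 2)) fromSYT
      (λ {S} {T} eq m → cong′ S T eq m)
      (λ {S} {T} eq → λ { (box a b a<b) → toℕ-injective (trans (sym (e-fromSYT S a<b)) (trans (eq (recompute (a <? b) a<b , toℕ<n b)) (e-fromSYT T a<b))) })
      toSYT fromSYT-toSYT
      where
      cong′ : ∀ S T → (∀ x → SYT.entry S x ≡ SYT.entry T x) → ∀ {i j} → Triangle n i j → e (fromSYT S) i j ≡ e (fromSYT T) i j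
      cong′ S T eq m with triangle-fins m
      ... | fins {a} {b} a<b = trans (e-fromSYT S a<b) (trans (cong toℕ (eq (box a b a<b))) (sym (e-fromSYT T a<b)))

-- The height of the poset, the rational numbers, and the staircase as Δₙ.

open import Defs
import Algebra.Properties.CommutativeMonoid.Sum as Sum
open import Data.Fin.Base using (Fin; zero; suc; toℕ; fromℕ<; opposite)
open import Data.Fin.Properties using (toℕ-fromℕ<; opposite-prop; _<?_)
import Data.Integer.Base as ℤ
import Data.Integer.Properties as ℤ
open import Data.List.Base using ([]; _∷_; _∷ʳ_; foldr; map; upTo)
open import Data.List.Properties using (upTo-∷ʳ)
open import Data.Nat.Base as ℕ using (ℕ; zero; suc; _<_; _*_; _∸_; _!; z≤n; s≤s; NonZero)
import Data.Nat.Properties as ℕ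
open import Data.Nat.Combinatorics using (_C_; nC1≡n; nCk+nC[k+1]≡[n+1]C[k+1])
open import Data.Nat.ListAction using (sum)
open import Data.Product.Base using (_×_; _,_; proj₁; ∃₂)
open import Data.Rational.Base as ℚ using (ℚ; 0ℚ; 1ℚ; 1/_; fromℚᵘ)
import Data.Rational.Properties as ℚ
open import Data.Rational.Unnormalised.Base as ℚᵘ using (mkℚᵘ; *≡*)
import Data.Rational.Unnormalised.Properties as ℚᵘ
open import Data.Sum.Base using (inj₁; inj₂)
open import Data.Unit.Base using (tt)
open import Function.Base using (_∘_)
open import Function.Bundles using (mk⇔)
open import Relation.Binary.PropositionalEquality using (_≡_; _≢_; refl; sym; trans; cong; cong₂; subst; module ≡-Reasoning)
open import Relation.Nullary.Decidable using (yes; no)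
open import Relation.Nullary.Negation using (contradiction)
open Cardinality
open Inversions
open UnimodalPermutations
open UnimodalWeakOrder
open Tableaux
open ChainsAndTableaux
open StrictShapes
open Fields
open ProductFormula
open StandardTableaux

private
  module ℕΣ = Sum ℕ.+-0-commutativeMonoid

[n+1]C2 : ∀ n → suc n C 2 ≡ n ℕ.+ n C 2
[n+1]C2 n = trans (sym (nCk+nC[k+1]≡[n+1]C[k+1] n 1)) (cong (ℕ._+ n C 2) (nC1≡n n))

sum-toℕ : ∀ n → ℕΣ.sum {n} toℕ ≡ n C 2
sum-toℕ zero = refl
sum-toℕ (suc n) = trans (go n toℕ) (trans (cong (n ℕ.+_) (sum-toℕ n)) (sym ([n+1]C2 n)))
  where
  go : ∀ n (f : Fin n → ℕ) → ℕΣ.sum (suc ∘ f) ≡ n ℕ.+ ℕΣ.sum f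
  go zero f = refl
  go (suc n) f = cong suc (trans (cong (f zero ℕ.+_) (go n (f ∘ suc))) (swap (f zero) n _))
    where
    swap : ∀ a b c → a ℕ.+ (b ℕ.+ c) ≡ b ℕ.+ (a ℕ.+ c)
    swap a b c = trans (sym (ℕ.+-assoc a b c)) (trans (cong (ℕ._+ c) (ℕ.+-comm a b)) (ℕ.+-assoc b a c))

-- The longest element inverts every pair; sorted by the larger value `b`, there are `toℕ b` pairs
-- for each.
rank-⊤ᵁ : ∀ {n} → rankᵁ {n} ⊤ᵁ ≡ n C 2
rank-⊤ᵁ {n} = begin
  rankᵁ ⊤ᵁ                                                 ≡⟨ rankᵁ≡count ⊤ᵁ ⟩
  count₂ (invᵁ? ⊤ᵁ)                                        ≡⟨ count₂-⇔ (invᵁ? ⊤ᵁ) _<?_ (λ a b → mk⇔ proj₁ λ a<b → a<b , opposite-anti a<b) ⟩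
  count₂ {n} _<?_                                          ≡⟨ count₂-def _<?_ ⟩
  ℕΣ.sum {n} (λ a → ℕΣ.sum {n} (λ b → ι (a <? b)))         ≡⟨ ℕΣ.∑-comm {n} {n} (λ a b → ι (a <? b)) ⟩
  ℕΣ.sum {n} (λ b → ℕΣ.sum {n} (λ a → ι (a <? b)))         ≡⟨ ℕΣ.sum-cong-≗ {n} sum-< ⟩
  ℕΣ.sum {n} toℕ                                           ≡⟨ sum-toℕ n ⟩
  n C 2 ∎
  where open ≡-Reasoning

inverse : ℚ → ℚ
inverse p with p ℚ.≟ 0ℚ
... | yes _  = 0ℚ
... | no p≢0 = (1/ p) {{ℚ.≢-nonZero p≢0}}

inverse-inverseʳ : ∀ {p} → p ≢ 0ℚ → p ℚ.* inverse p ≡ 1ℚ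
inverse-inverseʳ {p} p≢0 with p ℚ.≟ 0ℚ
... | yes p≡0 = contradiction p≡0 p≢0
... | no p≢0′ = ℚ.*-inverseʳ p {{ℚ.≢-nonZero p≢0′}}

ℚ-field : Field
ℚ-field = record { isCommutativeRing = ℚ.+-*-isCommutativeRing ; inv = inverse ; inverseʳ = inverse-inverseʳ }

fromℚᵘ-+ : ∀ p q → fromℚᵘ (p ℚᵘ.+ q) ≡ fromℚᵘ p ℚ.+ fromℚᵘ q
fromℚᵘ-+ p q = ℚ.toℚᵘ-injective (ℚᵘ.≃-trans (ℚ.toℚᵘ-fromℚᵘ (p ℚᵘ.+ q)) (ℚᵘ.≃-sym (ℚᵘ.≃-trans (ℚ.toℚᵘ-homo-+ (fromℚᵘ p) (fromℚᵘ q))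
  (ℚᵘ.+-cong (ℚ.toℚᵘ-fromℚᵘ p) (ℚ.toℚᵘ-fromℚᵘ q)))))

fromℚᵘ-* : ∀ p q → fromℚᵘ (p ℚᵘ.* q) ≡ fromℚᵘ p ℚ.* fromℚᵘ q
fromℚᵘ-* p q = ℚ.toℚᵘ-injective (ℚᵘ.≃-trans (ℚ.toℚᵘ-fromℚᵘ (p ℚᵘ.* q)) (ℚᵘ.≃-sym (ℚᵘ.≃-trans (ℚ.toℚᵘ-homo-* (fromℚᵘ p) (fromℚᵘ q))
  (ℚᵘ.*-cong (ℚ.toℚᵘ-fromℚᵘ p) (ℚ.toℚᵘ-fromℚᵘ q)))))

fromℕ-+ : ∀ m n → fromℕ (m ℕ.+ n) ≡ fromℕ m ℚ.+ fromℕ n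
fromℕ-+ m n = trans (ℚ.fromℚᵘ-cong {mkℚᵘ (ℤ.+ (m ℕ.+ n)) 0} {mkℚᵘ (ℤ.+ m) 0 ℚᵘ.+ mkℚᵘ (ℤ.+ n) 0}
    (*≡* (cong (ℤ._* ℤ.1ℤ) (trans (ℤ.pos-+ m n) (sym (cong₂ ℤ._+_ (ℤ.*-identityʳ (ℤ.+ m)) (ℤ.*-identityʳ (ℤ.+ n))))))))
  (fromℚᵘ-+ (mkℚᵘ (ℤ.+ m) 0) (mkℚᵘ (ℤ.+ n) 0))

fromℕ-* : ∀ m n → fromℕ (m ℕ.* n) ≡ fromℕ m ℚ.* fromℕ n
fromℕ-* m n = trans (ℚ.fromℚᵘ-cong {mkℚᵘ (ℤ.+ (m ℕ.* n)) 0} {mkℚᵘ (ℤ.+ m) 0 ℚᵘ.* mkℚᵘ (ℤ.+ n) 0} (*≡* (cong (ℤ._* ℤ.1ℤ) (ℤ.pos-* m n))))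
  (fromℚᵘ-* (mkℚᵘ (ℤ.+ m) 0) (mkℚᵘ (ℤ.+ n) 0))

fromℕ-≢0 : ∀ n .{{_ : NonZero n}} → fromℕ n ≢ 0ℚ
fromℕ-≢0 (suc n) eq with ℚ.fromℚᵘ-injective {mkℚᵘ (ℤ.+ suc n) 0} {mkℚᵘ (ℤ.+ 0) 0} eq
... | *≡* ()

open FieldProperties ℚ-field using (inv)
open ShapeFormula ℚ-field fromℕ refl refl fromℕ-+ fromℕ-* fromℕ-≢0

-- Multiplying by `fromℕ q` clears the denominator. This is checked on unnormalised fractions, where
-- no common divisors intervene.
/≡frac : ∀ p q .{{_ : NonZero q}} → (ℤ.+ p) ℚ./ q ≡ frac p q
/≡frac p q@(suc d) = begin
  x                                        ≡⟨ ℚ.*-identityʳ x ⟨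
  x ℚ.* 1ℚ                                 ≡⟨ cong (x ℚ.*_) (inverse-inverseʳ (fromℕ-≢0 q)) ⟨
  x ℚ.* (fromℕ q ℚ.* inverse (fromℕ q))    ≡⟨ ℚ.*-assoc x (fromℕ q) (inverse (fromℕ q)) ⟨
  (x ℚ.* fromℕ q) ℚ.* inverse (fromℕ q)    ≡⟨ cong (ℚ._* inverse (fromℕ q)) clear ⟩
  fromℕ p ℚ.* inverse (fromℕ q) ∎
  where
  open ≡-Reasoning
  x = (ℤ.+ p) ℚ./ q
  clear : x ℚ.* fromℕ q ≡ fromℕ p
  clear = trans (sym (fromℚᵘ-* (mkℚᵘ (ℤ.+ p) d) (mkℚᵘ (ℤ.+ q) 0))) (ℚ.fromℚᵘ-cong {mkℚᵘ (ℤ.+ p) d ℚᵘ.* mkℚᵘ (ℤ.+ q) 0} {mkℚᵘ (ℤ.+ p) 0}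
    (*≡* (trans (ℤ.*-identityʳ _) (cong ((ℤ.+ p) ℤ.*_) (cong (ℤ.+_ ∘ suc) (sym (ℕ.*-identityʳ d)))))))

-- `density-staircase` adds the longest row, whose factor has the largest index, whereas the fold
-- exposes the factor of index 0.
∏-suc : ∀ m f → ∏[i< suc m ] f ≡ (∏[i< m ] f) ℚ.* f m
∏-suc m f = trans (cong (foldr ℚ._*_ 1ℚ ∘ map f) (sym (upTo-∷ʳ m))) (snoc (upTo m))
  where
  snoc : ∀ xs → foldr ℚ._*_ 1ℚ (map f (xs ∷ʳ m)) ≡ foldr ℚ._*_ 1ℚ (map f xs) ℚ.* f m
  snoc [] = ℚ.*-comm (f m) 1ℚ
  snoc (x ∷ xs) = trans (cong (f x ℚ.*_) (snoc xs)) (sym (ℚ.*-assoc (f x) _ (f m)))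

density≡∏ : ∀ m → density (staircase m) ≡ ∏[i< m ] factor
density≡∏ zero = refl
density≡∏ (suc m) = trans (density-staircase m) (trans
  (cong₂ ℚ._*_ (density≡∏ m) (sym (/≡frac (m !) ((2 ℕ.* m ℕ.+ 1) !) {{ℕ._!≢0 (2 ℕ.* m ℕ.+ 1)}})))
  (sym (∏-suc m factor)))

staircase-strict : ∀ m → Strict (staircase m)
staircase-strict zero = tt
staircase-strict (suc zero) = s≤s z≤n , tt
staircase-strict (suc (suc m)) = ℕ.≤-refl , staircase-strict (suc m)

sum-staircase : ∀ m → sum (staircase m) ≡ suc m C 2
sum-staircase zero = refl
sum-staircase (suc m) = trans (cong (suc m ℕ.+_) (sum-staircase m)) (sym ([n+1]C2 (suc m)))

part-staircase : ∀ m i → part (staircase m) i ≡ m ∸ i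
part-staircase zero i = sym (ℕ.0∸n≡0 i)
part-staircase (suc m) zero = refl
part-staircase (suc m) (suc i) = part-staircase m i

module _ {m i j : ℕ} where

  -- The triangle on `suc m` values has `m` nonempty rows, and row `i` ends in column i + (m - i) =
  -- m, the last one.
  staircase⇒triangle : Shape (staircase m) i j → Triangle (suc m) i j
  staircase⇒triangle (i<j , j≤) with ℕ.≤-total i m
  ... | inj₁ i≤m = i<j , s≤s (subst (j ℕ.≤_) (trans (cong (i ℕ.+_) (part-staircase m i)) (ℕ.m+[n∸m]≡n i≤m)) j≤)
  -- Beyond the last row `part` is 0, so there is no box.
  ... | inj₂ m≤i = contradiction (subst (j ℕ.≤_) (trans (cong (i ℕ.+_) (trans (part-staircase m i) (ℕ.m≤n⇒m∸n≡0 m≤i))) (ℕ.+-identityʳ i)) j≤) (ℕ.<⇒≱ i<j)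

  triangle⇒staircase : Triangle (suc m) i j → Shape (staircase m) i j
  triangle⇒staircase (i<j , j<1+m) = i<j , subst (j ℕ.≤_)
    (sym (trans (cong (i ℕ.+_) (part-staircase m i)) (ℕ.m+[n∸m]≡n (ℕ.≤-trans (ℕ.<⇒≤ i<j) (ℕ.s≤s⁻¹ j<1+m))))) (ℕ.s≤s⁻¹ j<1+m)

reshape : ∀ {M M′ : ℕ → ℕ → Set} {K} → (∀ {i j} → M i j → M′ i j) → (∀ {i j} → M′ i j → M i j) → Tableau M K → Tableau M′ K
reshape f g T = record
  { e = e T ; bound = bound T ∘ g ; inj = λ m m′ → inj T (g m) (g m′)
  ; surj = λ k<K → let i , j , m , eq = surj T k<K in i , j , f m , eq
  ; row = λ m m′ → row T (g m) (g m′) ; col = λ m m′ → col T (g m) (g m′) }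

triangle-size : ∀ m → HasSize (tableaux (Triangle (suc m)) (suc m C 2)) (fillings (suc m C 2) (staircase m))
triangle-size m = HasSize-resp {S = triangles} {T = stairs} (mkInverse triangles stairs (reshape triangle⇒staircase staircase⇒triangle)
    (λ eq s → eq (staircase⇒triangle s)) (λ eq t → eq (triangle⇒staircase t)) (reshape staircase⇒triangle triangle⇒staircase) (λ _ _ → refl))
  (tableaux-size (suc m C 2) (staircase m) (staircase-strict m) (sum-staircase m))
  where
  triangles = tableaux (Triangle (suc m)) (suc m C 2)
  stairs = tableaux (Shape (staircase m)) (suc m C 2)

chains-size : ∀ {n t} → 2 < n → HasSize (tableaux (Triangle n) (n C 2)) t → HasSize (maximalChainsWeakU n) (2 * t)
chains-size {n} {t} 2<n size = ChainCount.weakChains-size v₀ v₁ (toℕ-fromℕ< 0<n) (toℕ-fromℕ< 1<n) opposite-v₁≢v₀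
  (subst (λ K → HasSize (tableaux (Triangle n) K) t) (sym (rank-⊤ᵁ {n})) size)
  where
  1<n : 1 < n
  1<n = ℕ.<⇒≤ 2<n
  0<n : 0 < n
  0<n = ℕ.<⇒≤ 1<n
  v₀ v₁ : Fin n
  v₀ = fromℕ< 0<n
  v₁ = fromℕ< 1<n
  opposite-v₁≢v₀ : opposite v₁ ≢ v₀
  opposite-v₁≢v₀ eq = ℕ.m>n⇒m∸n≢0 2<n (begin
    n ∸ 2               ≡⟨ cong (λ i → n ∸ suc i) (toℕ-fromℕ< 1<n) ⟨
    n ∸ suc (toℕ v₁)    ≡⟨ opposite-prop v₁ ⟨
    toℕ (opposite v₁)   ≡⟨ cong toℕ eq ⟩
    toℕ v₀              ≡⟨ toℕ-fromℕ< 0<n ⟩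
    0 ∎)
    where open ≡-Reasoning

corollary5p5 : (n : ℕ) → 2 < n →
    ∃₂ λ (c t : ℕ) →
    HasSize (maximalChainsWeakU n) c ×
    HasSize (standardYoungTableaux n) t ×
    c ≡ 2 * t ×
    fromℕ c ≡ fromℕ (2 * ((n C 2) !)) ℚ.* (∏[i< n ∸ 1 ] factor)
corollary5p5 (suc m) 2<n = 2 * t , t , chains-size 2<n (triangle-size m)
  , HasSize-resp {S = standardYoungTableaux (suc m)} {T = tableaux (Triangle (suc m)) K} SYT↔tableaux (triangle-size m) , refl , formula
  where
  K = suc m C 2
  t = fillings K (staircase m)
  formula : fromℕ (2 * t) ≡ fromℕ (2 * (K !)) ℚ.* (∏[i< m ] factor)
  formula = begin
    fromℕ (2 * t)                                             ≡⟨ fromℕ-* 2 t ⟩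
    fromℕ 2 ℚ.* fromℕ t                                       ≡⟨ cong (fromℕ 2 ℚ.*_) (fillings-formula K (staircase m) (staircase-strict m) (sum-staircase m)) ⟩
    fromℕ 2 ℚ.* (fromℕ (K !) ℚ.* density (staircase m))       ≡⟨ ℚ.*-assoc (fromℕ 2) (fromℕ (K !)) (density (staircase m)) ⟨
    (fromℕ 2 ℚ.* fromℕ (K !)) ℚ.* density (staircase m)       ≡⟨ cong₂ ℚ._*_ (sym (fromℕ-* 2 (K !))) (density≡∏ m) ⟩
    fromℕ (2 * (K !)) ℚ.* (∏[i< m ] factor) ∎
    where open ≡-Reasoning
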